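{- Let $p$ be a prime, let $m \ge 2$ be an integer, and let $\delta>0$, $\nu>0$, $\epsilon>0$. Then there exists $c_{\omega}(\delta,\nu,\epsilon,p,m)>0$ such that the following holds. If $s$ is a positive integer and $\mathcal{A}_1,\dots,\mathcal{A}_s$ are non-empty subsets of $\{0,1\}^n$ each with density at least $\delta$ inside $\{0,1\}^n$, then there exists a subset $Q\subset[s]$ with $|Q|\ge c_{\omega}(\delta,\nu,\epsilon,p,m)\,s$ such that for at least $(1-\epsilon)|Q|^m$ of the $m$-tuples $(i_1,\dots,i_m)\in Q^m$ we have \[\omega_{\mathcal{A}_{i_1},\dots,\mathcal{A}_{i_m}}\phi \ge 2^{ -(m+1)(p-1)}-\nu\] for every mod-$p$ form $\phi$.
   Context: A mod-$p$ form is a linear form $\phi:\mathbb{F}_p^n\to\mathbb{F}_p$, evaluated on $\{0,1\}^n$ by identifying $\{0,1\}$ with the elements $0,1$ of $\mathbb{F}_p$. The density of $\mathcal{A}\subset\{0,1\}^n$ is $|\mathcal{A}|/2^n$. For random variables $X_1,\dots,X_m$ taking values in a finite set $D$, the overlap is $\omega(X_1,\dots,X_m)=\sum_{d\in D}\min(\mathbb{P}[X_1=d],\dots,\mathbb{P}[X_m=d])$. For a function $F$ on $\{0,1\}^n$ and non-empty $\mathcal{A}_1,\dots,\mathcal{A}_m\subset\{0,1\}^n$, $\omega_{\mathcal{A}_1,\dots,\mathcal{A}_m}(F)$ denotes $\omega(X_1,\dots,X_m)$ where $X_i$ is distributed as $F(x)$ for $x$ uniform in $\mathcal{A}_i$.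 -}

module Defs where

open import Data.Bool using (Bool; true; false; _∧_; if_then_else_)
open import Data.Nat as ℕ using (ℕ; zero; suc; _≡ᵇ_; _%_)
open import Data.Integer using (+_)
open import Data.Fin using (Fin; toℕ)
open import Data.Vec using (Vec; []; _∷_; lookup)
open import Data.List using (List; []; _∷_; [_]; map; _++_; foldr; allFin)
open import Data.Rational using (ℚ; 0ℚ; _/_; _⊓_; _+_)

-- The cube {0,1}^n, with {0,1} represented by Bool (false ↦ 0, true ↦ 1).
Cube : ℕ → Set
Cube n = Vec Bool n

allBits : (n : ℕ) → List (Cube n)
allBits zero = [ [] ]
allBits (suc n) = map (false ∷_) (allBits n) ++ map (true ∷_) (allBits n)

CubeSet : ℕ → Set
CubeSet n = Cube n → Bool

countB : {X : Set} → (X → Bool) → List X → ℕ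
countB f [] = 0
countB f (x ∷ xs) = (if f x then 1 else 0) ℕ.+ countB f xs

card : {n : ℕ} → CubeSet n → ℕ
card {n} A = countB A (allBits n)

-- the rational number a / b (with the convention a / 0 = 0; only used for b > 0)
frac : ℕ → ℕ → ℚ
frac a zero = 0ℚ
frac a (suc b) = (+ a) / suc b

density : {n : ℕ} → CubeSet n → ℚ
density {n} A = frac (card A) (ℕ._^_ 2 n)

-- x mod p (p = 0 never occurs since p is prime)
modN : ℕ → ℕ → ℕ
modN zero x = x
modN (suc q) x = x % suc q

-- A mod-p form φ : F_p^n → F_p is given by its coefficient vector a ∈ F_p^n
-- (F_p represented by Fin p), φ(x) = Σ a_i x_i.
Form : ℕ → ℕ → Set
Form p n = Vec (Fin p) n

formSum : {p n : ℕ} → Form p n → Cube n → ℕ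
formSum [] [] = 0
formSum (a ∷ as) (false ∷ xs) = formSum as xs
formSum (a ∷ as) (true ∷ xs) = toℕ a ℕ.+ formSum as xs

evalForm : {p n : ℕ} → Form p n → Cube n → ℕ
evalForm {p} a x = modN p (formSum a x)

prob : {p n : ℕ} → CubeSet n → Form p n → Fin p → ℚ
prob A φ d = frac (countB (λ x → A x ∧ (evalForm φ x ≡ᵇ toℕ d)) (allBits _)) (card A)

-- minimum of a (non-empty) list of rationals; value on [] is irrelevant
minOf : List ℚ → ℚ
minOf [] = 0ℚ
minOf (x ∷ []) = x
minOf (x ∷ y ∷ xs) = x ⊓ minOf (y ∷ xs)

sumQ : List ℚ → ℚ
sumQ = foldr _+_ 0ℚ

omega : {p n : ℕ} → List (CubeSet n) → Form p n → ℚ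
omega {p} As φ = sumQ (map (λ d → minOf (map (λ A → prob A φ d) As)) (allFin p))

{-# OPTIONS --safe #-}
module Submission where

-- Write p = q + 1. A form is light if it has boundedly many non-zero coefficients.
--
-- Centres. Forms all of whose non-trivial combinations are heavy are almost pairwise independent
-- on the cube, so by a Bessel inequality each dense A has boundedly many centres such that every
-- form that is not (a multiple of) a centre plus a light form takes each value on A with
-- probability at least 1/(2p).
--
-- Cores. A sunflower argument passes to a positive proportion of the indices in which the centres
-- of almost all pairs meet only near a bounded common core. A form that is structured for two
-- members of a tuple is then κ c + ψ with c in the core and ψ light; for any other form the most
-- popular value on the only structured member works.
--
-- Coordinates. For each A an energy increment gives a bounded set J of coordinates such that few
-- further coordinates are almost uniform and independent of the J-coordinates on each A ∩ {c = u}.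
-- A second sunflower argument makes the sets J meet only in a core T, and pigeonholing makes the
-- most popular value v of κ c + ψ|T the same for all members. On J ∖ T every member has its own
-- popular value of ψ; these sets are disjoint, so a single point z realises all of them. The value
-- v + ψ|Tᶜ(z) then has probability at least p⁻² 2^{-q} ≥ 2^{-3q} (up to the error) on every
-- member, because an attained value of a form in independent uniform bits has probability at least
-- 2^{-q} by Cauchy–Davenport.

open import Defs
open import Data.Bool using (Bool; true; false; _∧_; _∨_; not; if_then_else_; T?)
open import Data.Bool.Properties using (T-≡; ∧-assoc; ∧-identityʳ; ∧-zeroʳ; ∨-zeroʳ) renaming (_≟_ to _≟ᵇ_)
open import Data.Empty using (⊥; ⊥-elim)
open import Data.Fin using (Fin; zero; suc; toℕ; fromℕ<)
import Data.Fin as Fin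
import Data.Fin.Properties as Fin
open import Data.List using (List; []; _∷_; map; _++_; length; take; drop; filterᵇ; upTo; allFin; cartesianProduct; cartesianProductWith)
import Data.List as List
open import Data.List.Properties using (length-++; length-drop; length-map; length-tabulate; length-take; length-upTo; take++drop≡id)
import Data.List.Membership.Propositional as List
open import Data.List.Membership.Propositional.Properties using (∈-++⁺ˡ; ∈-++⁺ʳ; ∈-allFin; ∈-cartesianProduct⁺; ∈-cartesianProductWith⁺; ∈-cartesianProductWith⁻; ∈-map⁺; ∈-map⁻; ∈-upTo⁺)
open import Data.List.Relation.Unary.All as All using (All; []; _∷_)
import Data.List.Relation.Unary.All.Properties as All
open import Data.List.Relation.Unary.AllPairs as AllPairs using (AllPairs; []; _∷_)
open import Data.List.Relation.Unary.Any as Any using (Any; here; there)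
open import Data.List.Relation.Unary.Unique.Propositional using (Unique)
import Data.List.Relation.Unary.Unique.Propositional.Properties as Unique
open import Data.Nat as ℕ using (ℕ; zero; suc; z≤n; s≤s; _%_; _≡ᵇ_)
open import Data.Nat.Coprimality using (prime⇒coprime; coprime-Bézout)
open import Data.Nat.DivMod using (%-distribˡ-+; %-distribˡ-*; m%n%n≡m%n; [m+kn]%n≡m%n; m%n<n; m<n⇒m%n≡m)
open import Data.Nat.GCD using (module Bézout)
open import Data.Nat.Primality using (Prime; prime⇒nonTrivial; ¬prime[0])
import Data.Nat.Properties as ℕ
open import Data.Nat.Tactic.RingSolver using () renaming (solve-∀ to solveℕ)
open import Data.Product using (Σ; ∃; _×_; _,_; proj₁; proj₂)
open import Data.Sum using (_⊎_; inj₁; inj₂)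
open import Data.Vec as Vec using (Vec; []; _∷_; lookup; replicate; tabulate; toList; zipWith; _[_]≔_)
open import Data.Vec.Properties using (length-toList; lookup-map; lookup-replicate; lookup-zipWith; lookup∘tabulate; lookup∘update; lookup∘update′; lookup⇒[]=)
open import Function using (_∘_; id; Equivalence)
open import Relation.Binary.PropositionalEquality hiding (J)
open import Relation.Nullary using (¬_; yes; no; Dec; does)
open import Relation.Nullary.Decidable using (_×-dec_; ¬?; dec-true; map′)
open import Relation.Unary using (Decidable)

-- The sets are unrelated to each other, yet one value must be frequent on all members of a tuple,
-- and the form is chosen only after the tuple. The forms that prefer a value on `A` depend on `A`;
-- the cores collect the preferences that several members can share. As the form is unknown when the
-- subfamily is chosen, every combination of a core form, a multiplier and coefficients on `T` is
-- pigeonholed in advance; bounded cores make this affordable.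
--
-- A core form may be heavy, hence not determined by boundedly many coordinates. Therefore the
-- coordinates are regularised on the slices c = u, after the first core is known.
--
-- The exponent 3q has three sources: a factor p ≤ 2^q for the common value, another one for the
-- private value, and 2^q for the fresh coordinates. It does not grow with m, since one point
-- realises all private values; m ≥ 2 gives 3 ≤ m + 1.
--
-- No characters are used: equidistribution of heavy forms comes from ranges of sums that contract
-- by Cauchy-Davenport, and pairs of forms are reduced to single forms by lines in the plane over
-- F_p. All estimates are integer inequalities scaled by 2^n.

module Counting where

  open import Data.Nat using (_+_; _*_; _≤_; _<_; _^_)
  open import Data.Nat.Properties
  open import Data.List.Membership.Propositional using (_∈_)

  -- Counting and pigeonholing in finite lists.

  private variable X Y : Set

  bit : Bool → ℕ
  bit b = if b then 1 else 0

  sumL : (X → ℕ) → List X → ℕ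
  sumL f [] = 0
  sumL f (x ∷ xs) = f x + sumL f xs

  sumL-mono : ∀ {f g : X → ℕ} xs → (∀ {x} → x ∈ xs → f x ≤ g x) → sumL f xs ≤ sumL g xs
  sumL-mono [] h = z≤n
  sumL-mono (x ∷ xs) h = +-mono-≤ (h (here refl)) (sumL-mono xs (h ∘ there))

  sumL-+ : ∀ (f g : X → ℕ) xs → sumL (λ x → f x + g x) xs ≡ sumL f xs + sumL g xs
  sumL-+ f g [] = refl
  sumL-+ f g (x ∷ xs) = trans (cong (f x + g x +_) (sumL-+ f g xs)) (lem (f x) (g x) (sumL f xs) (sumL g xs))
    where
    lem : ∀ a b c d → a + b + (c + d) ≡ a + c + (b + d)
    lem = solveℕ

  sumL-*ˡ : ∀ c (f : X → ℕ) xs → sumL (λ x → c * f x) xs ≡ c * sumL f xs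
  sumL-*ˡ c f [] = sym (*-zeroʳ c)
  sumL-*ˡ c f (x ∷ xs) = trans (cong (c * f x +_) (sumL-*ˡ c f xs)) (sym (*-distribˡ-+ c (f x) (sumL f xs)))

  sumL-const : ∀ c (xs : List X) → sumL (λ _ → c) xs ≡ length xs * c
  sumL-const c [] = refl
  sumL-const c (x ∷ xs) = cong (c +_) (sumL-const c xs)

  anyB : (X → Bool) → List X → Bool
  anyB f [] = false
  anyB f (x ∷ xs) = f x ∨ anyB f xs

  anyB-intro : ∀ {f : X → Bool} {x xs} → x ∈ xs → f x ≡ true → anyB f xs ≡ true
  anyB-intro (here refl) h rewrite h = refl
  anyB-intro {f = f} {xs = y ∷ _} (there x∈) h with f y
  ... | true = refl
  ... | false = anyB-intro x∈ h

  anyB-elim : ∀ {f : X → Bool} xs → anyB f xs ≡ true → ∃ λ x → x ∈ xs × f x ≡ true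
  anyB-elim {f = f} (x ∷ xs) h with f x in e
  ... | true = x , here refl , e
  ... | false = let (y , y∈ , e′) = anyB-elim xs h in y , there y∈ , e′

  countB-mono : ∀ {f g : X → Bool} xs → (∀ {x} → x ∈ xs → f x ≡ true → g x ≡ true) → countB f xs ≤ countB g xs
  countB-mono [] h = z≤n
  countB-mono {f = f} {g} (x ∷ xs) h = +-mono-≤ (go (f x) (g x) (h (here refl))) (countB-mono xs (h ∘ there))
    where
    go : ∀ a b → (a ≡ true → b ≡ true) → bit a ≤ bit b
    go false b h = z≤n
    go true b h rewrite h refl = ≤-refl

  countB-++ : ∀ (f : X → Bool) xs ys → countB f (xs ++ ys) ≡ countB f xs + countB f ys
  countB-++ f [] ys = refl
  countB-++ f (x ∷ xs) ys = trans (cong (bit (f x) +_) (countB-++ f xs ys)) (sym (+-assoc (bit (f x)) _ _))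

  countB-map : ∀ (f : Y → Bool) (g : X → Y) xs → countB f (map g xs) ≡ countB (f ∘ g) xs
  countB-map f g [] = refl
  countB-map f g (x ∷ xs) = cong (bit (f (g x)) +_) (countB-map f g xs)

  countB-complement : ∀ (f : X → Bool) xs → countB (not ∘ f) xs + countB f xs ≡ length xs
  countB-complement f [] = refl
  countB-complement f (x ∷ xs) with f x
  ... | true = trans (+-suc _ _) (cong suc (countB-complement f xs))
  ... | false = cong suc (countB-complement f xs)

  countB-∨ : ∀ (f g : X → Bool) xs → countB (λ x → f x ∨ g x) xs ≤ countB f xs + countB g xs
  countB-∨ f g [] = z≤n
  countB-∨ f g (x ∷ xs) = ≤-trans (+-mono-≤ (or (f x) (g x)) (countB-∨ f g xs)) (≤-reflexive (lem (bit (f x)) (bit (g x)) _ _))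
    where
    or : ∀ a b → bit (a ∨ b) ≤ bit a + bit b
    or true b = s≤s z≤n
    or false b = ≤-refl
    lem : ∀ a b c d → a + b + (c + d) ≡ a + c + (b + d)
    lem = solveℕ

  countB-const : ∀ b (xs : List X) → countB (λ _ → b) xs ≡ length xs * bit b
  countB-const b [] = refl
  countB-const b (x ∷ xs) = cong (bit b +_) (countB-const b xs)

  sumL-bit : ∀ (f : X → Bool) xs → sumL (bit ∘ f) xs ≡ countB f xs
  sumL-bit f [] = refl
  sumL-bit f (x ∷ xs) = cong (bit (f x) +_) (sumL-bit f xs)

  countB-product : ∀ {Z : Set} (f : Z → Bool) (g : X → Y → Z) xs ys →
    countB f (cartesianProductWith g xs ys) ≡ sumL (λ x → countB (λ y → f (g x y)) ys) xs
  countB-product f g [] ys = refl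
  countB-product f g (x ∷ xs) ys = trans (countB-++ f (map (g x) ys) _)
    (cong₂ _+_ (countB-map f (g x) ys) (countB-product f g xs ys))

  length-product : ∀ {Z : Set} (g : X → Y → Z) xs ys → length (cartesianProductWith g xs ys) ≡ length xs * length ys
  length-product g [] ys = refl
  length-product g (x ∷ xs) ys =
    trans (length-++ (map (g x) ys)) (cong₂ _+_ (length-map (g x) ys) (length-product g xs ys))

  filterᵇ-all : ∀ (ys : List X) → filterᵇ (λ _ → true) ys ≡ ys
  filterᵇ-all [] = refl
  filterᵇ-all (y ∷ ys) = cong (y ∷_) (filterᵇ-all ys)

  length-filterᵇ : ∀ (q : X → Bool) xs → length (filterᵇ q xs) ≡ countB q xs
  length-filterᵇ q [] = refl
  length-filterᵇ q (x ∷ xs) with q x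
  ... | true = cong suc (length-filterᵇ q xs)
  ... | false = length-filterᵇ q xs

  ∈-filterᵇ⁻ : ∀ (q : X → Bool) xs {x} → x ∈ filterᵇ q xs → x ∈ xs × q x ≡ true
  ∈-filterᵇ⁻ q (y ∷ xs) x∈ with q y in e
  ∈-filterᵇ⁻ q (y ∷ xs) (here refl) | true = here refl , e
  ∈-filterᵇ⁻ q (y ∷ xs) (there x∈) | true = let (a , b) = ∈-filterᵇ⁻ q xs x∈ in there a , b
  ∈-filterᵇ⁻ q (y ∷ xs) x∈ | false = let (a , b) = ∈-filterᵇ⁻ q xs x∈ in there a , b

  filterᵇ-filterᵇ : ∀ (q q′ : X → Bool) xs → filterᵇ q′ (filterᵇ q xs) ≡ filterᵇ (λ x → q x ∧ q′ x) xs
  filterᵇ-filterᵇ q q′ [] = refl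
  filterᵇ-filterᵇ q q′ (x ∷ xs) with q x
  ... | false = filterᵇ-filterᵇ q q′ xs
  ... | true with q′ x
  ...   | true = cong (x ∷_) (filterᵇ-filterᵇ q q′ xs)
  ...   | false = filterᵇ-filterᵇ q q′ xs

  sumL-filterᵇ : ∀ (f : X → ℕ) q xs → sumL f (filterᵇ q xs) ≤ sumL f xs
  sumL-filterᵇ f q [] = z≤n
  sumL-filterᵇ f q (x ∷ xs) with q x
  ... | true = +-monoʳ-≤ (f x) (sumL-filterᵇ f q xs)
  ... | false = ≤-trans (sumL-filterᵇ f q xs) (m≤n+m _ (f x))

  countB-filterᵇ : ∀ (f : X → Bool) q xs → countB f (filterᵇ q xs) ≤ countB f xs
  countB-filterᵇ f q [] = z≤n
  countB-filterᵇ f q (x ∷ xs) with q x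
  ... | true = +-monoʳ-≤ (bit (f x)) (countB-filterᵇ f q xs)
  ... | false = ≤-trans (countB-filterᵇ f q xs) (m≤n+m _ (bit (f x)))

  -- The diagonal is included. A tuple that repeats an index is then either bad, or the index does
  -- not clash with itself, and repetitions need no separate treatment.
  pairs : List X → (X → X → Bool) → ℕ
  pairs ys r = sumL (λ i → countB (r i) ys) ys

  pairs-filterᵇ : ∀ q (ys : List X) r → pairs (filterᵇ q ys) r ≤ pairs ys r
  pairs-filterᵇ q ys r = ≤-trans (sumL-mono (filterᵇ q ys) (λ {i} _ → countB-filterᵇ (r i) q ys)) (sumL-filterᵇ _ q ys)

  -- Averaging, phrased as a dichotomy so that the sunflower recursion can branch on it: continue
  -- with a popular row or stop.
  popular-row : ∀ E N (c : X → ℕ) ys → (∃ λ i → i ∈ ys × N < E * c i) ⊎ (E * sumL c ys ≤ N * length ys)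
  popular-row E N c [] = inj₂ (≤-trans (≤-reflexive (*-zeroʳ E)) z≤n)
  popular-row E N c (y ∷ ys) with N ℕ.<? E * c y | popular-row E N c ys
  ... | yes h | _ = inj₁ (y , here refl , h)
  ... | no _ | inj₁ (i , i∈ , h) = inj₁ (i , there i∈ , h)
  ... | no h | inj₂ k = inj₂ (≤-trans (≤-reflexive (*-distribˡ-+ E (c y) (sumL c ys)))
      (≤-trans (+-mono-≤ (≮⇒≥ h) k) (≤-reflexive (sym (*-suc N (length ys))))))

  anyB-count : ∀ (P : Y → X → Bool) us xs → countB (λ x → anyB (λ u → P u x) us) xs ≤ sumL (λ u → countB (P u) xs) us
  anyB-count P [] xs = ≤-reflexive (trans (countB-const false xs) (*-zeroʳ (length xs)))
  anyB-count P (u ∷ us) xs =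
    ≤-trans (countB-∨ (P u) (λ x → anyB (λ u → P u x) us) xs) (+-monoʳ-≤ _ (anyB-count P us xs))

  popular-item : ∀ (P : Y → X → Bool) us xs → 0 < countB (λ x → anyB (λ u → P u x) us) xs →
    ∃ λ u → u ∈ us × countB (λ x → anyB (λ u → P u x) us) xs ≤ length us * countB (P u) xs
  -- With `pred` the strict inequality of a popular row becomes the wanted one. The other
  -- alternative would bound the sum of the counts by `N - 1`, although that sum is at least `N`.
  popular-item {Y = Y} P us xs pos with popular-row (length us) (ℕ.pred N) (λ u → countB (P u) xs) us
    where N = countB (λ x → anyB (λ u → P u x) us) xs
  ... | inj₁ (u , u∈ , h) = u , u∈ , ≤-trans (≤-reflexive (sym (suc-pred _ {{ℕ.>-nonZero pos}}))) h
  ... | inj₂ h = ⊥-elim (contra us (countB (λ x → anyB (λ u → P u x) us) xs) pos (anyB-count P us xs) h)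
    where
    contra : ∀ (us : List Y) N → 0 < N → N ≤ sumL (λ u → countB (P u) xs) us →
      length us * sumL (λ u → countB (P u) xs) us ≤ ℕ.pred N * length us → ⊥
    contra [] (suc N) _ () _
    contra (u ∷ us) (suc N) _ le h = <-irrefl refl (≤-trans (≤-trans (s≤s (*-cancelˡ-≤ (length (u ∷ us))
        (≤-trans h (≤-reflexive (*-comm N (length (u ∷ us))))))) (s≤s ≤-refl)) le)

  -- A sunflower lemma: after passing to a positive proportion of the indices, nearly all pairs of
  -- item lists meet (with respect to sim) only in items covered by a bounded core.

  module Sunflower {X Y : Set} (sim : Y → Y → Bool) (V : X → List Y) (E K : ℕ) (E≥1 : 1 ≤ E) (K≥1 : 1 ≤ K) where

    covered : List Y → Y → Bool
    covered C u = anyB (λ c → sim c u) C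

    free : List Y → X → List Y
    free C i = filterᵇ (not ∘ covered C) (V i)

    clash : List Y → X → X → Bool
    clash C i j = anyB (λ u → anyB (sim u) (free C j)) (free C i)

    -- The loss in one round: a factor `E` for the popular row and a factor `K` for the popular item
    -- in it.
    B : ℕ
    B = E * K

    B≥1 : 1 ≤ B
    B≥1 = *-mono-≤ E≥1 K≥1

    Core : List X → List Y → Set
    Core ys C = ∀ {c i} → c ∈ C → i ∈ ys → anyB (sim c) (V i) ≡ true

    -- A free item similar to `u` exists and becomes covered. This is what makes the recursion end.
    free-shrinks : ∀ C u us → anyB (sim u) (filterᵇ (not ∘ covered C) us) ≡ true →
      length (filterᵇ (not ∘ covered (u ∷ C)) us) < length (filterᵇ (not ∘ covered C) us)
    free-shrinks C u (w ∷ us) h with covered C w | sim u w in e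
    ... | true | true = free-shrinks C u us h
    ... | true | false = free-shrinks C u us h
    ... | false | false rewrite e = s≤s (free-shrinks C u us h)
    ... | false | true = s≤s (weak us)
      where
      weak : ∀ us → length (filterᵇ (not ∘ covered (u ∷ C)) us) ≤ length (filterᵇ (not ∘ covered C) us)
      weak [] = z≤n
      weak (w ∷ us) with covered C w | sim u w
      ... | true | true = weak us
      ... | true | false = weak us
      ... | false | true = m≤n⇒m≤1+n (weak us)
      ... | false | false = s≤s (weak us)

    record Flower (ys : List X) : Set where
      field
        sel : X → Bool
        core : List Y
        core-small : length core ≤ K
        large : length ys ≤ B ^ K * length (filterᵇ sel ys)
        few : E * pairs (filterᵇ sel ys) (clash core) ≤ length (filterᵇ sel ys) * length (filterᵇ sel ys)
        core-common : Core (filterᵇ sel ys) core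

    sunflower : (ys : List X) → (∀ {i} → i ∈ ys → length (V i) ≤ K) → Flower ys
    sunflower ys bound with go K [] ys ≤-refl (λ {i} i∈ → ≤-trans (length-free i) (bound i∈)) (λ ())
      where
      length-free : ∀ i → length (free [] i) ≤ length (V i)
      length-free i = all (V i)
        where
        all : ∀ us → length (filterᵇ (not ∘ covered []) us) ≤ length us
        all [] = z≤n
        all (u ∷ us) = s≤s (all us)
      Goal : ℕ → List Y → List X → Set
      Goal k C ys = ∃ λ q → ∃ λ C′ → length C′ ≤ length C + k × length ys ≤ B ^ k * length (filterᵇ q ys) ×
        E * pairs (filterᵇ q ys) (clash C′) ≤ length (filterᵇ q ys) * length (filterᵇ q ys) × Core (filterᵇ q ys) C′
      stop : ∀ k C ys → E * pairs ys (clash C) ≤ length ys * length ys → Core ys C → Goal k C ys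
      stop k C ys h core = (λ _ → true) , C , m≤m+n _ k , bd , subst (λ zs → E * pairs zs (clash C) ≤ length zs * length zs) (sym (filterᵇ-all ys)) h ,
          subst (λ zs → Core zs C) (sym (filterᵇ-all ys)) core
        where
        bd : length ys ≤ B ^ k * length (filterᵇ (λ _ → true) ys)
        bd = subst (λ zs → length ys ≤ B ^ k * length zs) (sym (filterᵇ-all ys))
          (≤-trans (≤-reflexive (sym (*-identityˡ _))) (*-monoˡ-≤ (length ys) (m^n>0 B {{ℕ.>-nonZero B≥1}} k)))
      -- `k` bounds both the free items left in every list and the rounds still to come, so the core
      -- never gets more than `K` elements.
      go : ∀ k C ys → k ≤ K → (∀ {i} → i ∈ ys → length (free C i) ≤ k) → Core ys C → Goal k C ys
      go zero C ys k≤K small core = stop 0 C ys (≤-trans (≤-reflexive (trans (cong (E *_) none) (*-zeroʳ E))) z≤n) core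
        where
        empty : ∀ {us : List Y} → length us ≤ 0 → us ≡ []
        empty {[]} _ = refl
        none : pairs ys (clash C) ≡ 0
        none = n≤0⇒n≡0 (≤-trans (sumL-mono {g = λ _ → 0} ys (λ {i} i∈ → ≤-trans (countB-mono {g = λ _ → false} ys (λ {j} j∈ h → trans (sym (no-clash i j i∈)) h)) (≤-reflexive (trans (countB-const false ys) (*-zeroʳ (length ys))))))
          (≤-reflexive (trans (sumL-const 0 ys) (*-zeroʳ (length ys)))))
          where
          no-clash : ∀ i j → i ∈ ys → clash C i j ≡ false
          no-clash i j i∈ = cong (anyB (λ u → anyB (sim u) (free C j))) (empty {free C i} (small i∈))
      go (suc k) C ys k≤K small core with popular-row E (length ys) (λ i → countB (clash C i) ys) ys
      ... | inj₂ h = stop (suc k) C ys h core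
      -- One list clashes with more than a 1/`E` part of the family. One of its at most `K` free
      -- items is responsible for a 1/`K` part of these clashes; it joins the core and only the
      -- lists that it meets are kept.
      ... | inj₁ (i , i∈ , h) with popular-item (λ u j → anyB (sim u) (free C j)) (free C i) ys (positive (countB (clash C i) ys) h)
        where
        positive : ∀ c → length ys < E * c → 0 < c
        positive zero h = ⊥-elim (n≮0 (≤-trans h (≤-reflexive (*-zeroʳ E))))
        positive (suc c) h = s≤s z≤n
      ...   | u , u∈ , pop with go k (u ∷ C) ys₁ (<⇒≤ k≤K) small′ core′
        where
        q₁ : X → Bool
        q₁ j = anyB (sim u) (free C j)
        ys₁ = filterᵇ q₁ ys
        small′ : ∀ {j} → j ∈ ys₁ → length (free (u ∷ C) j) ≤ k
        small′ {j} j∈ = let (j∈ys , hit) = ∈-filterᵇ⁻ q₁ ys j∈ in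
          ℕ.s≤s⁻¹ (≤-trans (free-shrinks C u (V j) hit) (small j∈ys))
        core′ : Core ys₁ (u ∷ C)
        core′ = λ { (here refl) j∈ → hit j∈ ; (there c∈) j∈ → core c∈ (proj₁ (∈-filterᵇ⁻ q₁ ys j∈)) }
          where
          hit : ∀ {j} → j ∈ ys₁ → anyB (sim u) (V j) ≡ true
          hit {j} j∈ = let (w , w∈ , e) = anyB-elim (free C j) (proj₂ (∈-filterᵇ⁻ q₁ ys j∈)) in
            anyB-intro (proj₁ (∈-filterᵇ⁻ (not ∘ covered C) (V j) w∈)) e
      ...     | q₂ , C′ , lenC , size , few , coreC = (λ j → q₁ j ∧ q₂ j) , C′ ,
            ≤-trans lenC (≤-reflexive (sym (+-suc (length C) k))) ,
            subst (λ zs → length ys ≤ B ^ suc k * length zs) eq size′ ,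
            subst (λ zs → E * pairs zs (clash C′) ≤ length zs * length zs) eq few ,
            subst (λ zs → Core zs C′) eq coreC
        where
        q₁ : X → Bool
        q₁ j = anyB (sim u) (free C j)
        ys₁ = filterᵇ q₁ ys
        eq : filterᵇ q₂ ys₁ ≡ filterᵇ (λ j → q₁ j ∧ q₂ j) ys
        eq = filterᵇ-filterᵇ q₁ q₂ ys
        lem : ∀ E K x → E * (K * x) ≡ E * K * x
        lem = solveℕ
        size₁ : length ys ≤ B * length ys₁
        size₁ = ≤-trans (<⇒≤ h) (≤-trans (*-monoʳ-≤ E (≤-trans pop (≤-trans (*-monoˡ-≤ _ (≤-trans (small i∈) k≤K))
          (≤-reflexive (cong (K *_) (sym (length-filterᵇ q₁ ys))))))) (≤-reflexive (lem E K (length ys₁))))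
        size′ : length ys ≤ B ^ suc k * length (filterᵇ q₂ ys₁)
        size′ = ≤-trans size₁ (≤-trans (*-monoʳ-≤ B size) (≤-reflexive (sym (*-assoc B (B ^ k) _))))
    ... | sel , C , c , l , f , m = record { sel = sel ; core = C ; core-small = c ; large = l ; few = f ; core-common = m }

    no-clash : ∀ C i j → clash C i j ≡ false → ∀ {u w} → u ∈ V i → w ∈ V j → sim u w ≡ true →
      covered C u ≡ true ⊎ covered C w ≡ true
    no-clash C i j none {u} {w} u∈ w∈ s with covered C u in eu | covered C w in ew
    ... | true | _ = inj₁ refl
    ... | false | true = inj₂ refl
    ... | false | false = ⊥-elim (false≢true (trans (sym none)
        (anyB-intro (keep u∈ (cong not eu)) (anyB-intro (keep w∈ (cong not ew)) s))))
      where
      false≢true : false ≡ true → ⊥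
      false≢true ()
      keep : ∀ {u us} → u ∈ us → not (covered C u) ≡ true → u ∈ filterᵇ (not ∘ covered C) us
      keep {u} (here refl) e rewrite e = here refl
      keep {u} {y ∷ us} (there u∈) e with not (covered C y)
      ... | true = there (keep u∈ e)
      ... | false = keep u∈ e

  every-colour : ∀ k (f : X → ℕ) → (∀ x → f x < k) → ∀ zs → length zs ≤ countB (λ x → anyB (λ v → f x ≡ᵇ v) (upTo k)) zs
  every-colour k f bound [] = z≤n
  every-colour k f bound (z ∷ zs)
    rewrite anyB-intro {f = λ v → f z ≡ᵇ v} (∈-upTo⁺ (bound z)) (Equivalence.to T-≡ (≡⇒≡ᵇ (f z) (f z) refl)) =
    s≤s (every-colour k f bound zs)

  -- A popular colour is fixed for one key after the other, each at the cost of a factor `k`. All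
  -- keys are served at once, because the key that matters becomes known only with the form.
  monochromatic : ∀ {Key : Set} k (colour : Key → X → ℕ) → (∀ κ x → colour κ x < k) → ∀ (keys : List Key) ys →
    ∃ λ q → length ys ≤ k ^ length keys * length (filterᵇ q ys) ×
      (∀ {κ} → κ ∈ keys → ∃ λ v → ∀ {i} → i ∈ filterᵇ q ys → colour κ i ≡ v)
  monochromatic k colour bound [] ys =
    (λ _ → true) , ≤-reflexive (trans (cong length (sym (filterᵇ-all ys))) (sym (*-identityˡ _))) , λ ()
  monochromatic k colour bound (κ ∷ keys) [] = (λ _ → true) , z≤n , λ _ → 0 , λ ()
  monochromatic {X = X} k colour bound (κ ∷ keys) ys@(y ∷ _)
    with popular-item (λ v x → colour κ x ≡ᵇ v) (upTo k) ys (≤-trans (s≤s z≤n) (every-colour k (colour κ) (bound κ) ys))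
  ... | v , _ , pop with monochromatic k colour bound keys (filterᵇ (λ x → colour κ x ≡ᵇ v) ys)
  ...   | q₂ , size , mono = (λ x → q₁ x ∧ q₂ x) , subst (λ zs → length ys ≤ k ^ suc (length keys) * length zs) eq size′ , mono′
    where
    q₁ : X → Bool
    q₁ x = colour κ x ≡ᵇ v
    eq : filterᵇ q₂ (filterᵇ q₁ ys) ≡ filterᵇ (λ j → q₁ j ∧ q₂ j) ys
    eq = filterᵇ-filterᵇ q₁ q₂ ys
    size₁ : length ys ≤ k * length (filterᵇ q₁ ys)
    size₁ = ≤-trans (every-colour k (colour κ) (bound κ) ys) (≤-trans pop (≤-reflexive (cong₂ _*_ (length-upTo k) (sym (length-filterᵇ q₁ ys)))))
    size′ : length ys ≤ k ^ suc (length keys) * length (filterᵇ q₂ (filterᵇ q₁ ys))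
    size′ = ≤-trans size₁ (≤-trans (*-monoʳ-≤ k size) (≤-reflexive (sym (*-assoc k (k ^ length keys) _))))
    mono′ : ∀ {κ′} → κ′ ∈ κ ∷ keys → ∃ λ v → ∀ {i} → i ∈ filterᵇ (λ j → q₁ j ∧ q₂ j) ys → colour κ′ i ≡ v
    mono′ (here refl) = v , λ {i} i∈ → ≡ᵇ⇒≡ (colour κ i) v (Equivalence.from T-≡
      (proj₂ (∈-filterᵇ⁻ q₁ ys (proj₁ (∈-filterᵇ⁻ q₂ (filterᵇ q₁ ys) (subst (i ∈_) (sym eq) i∈))))))
    mono′ (there κ∈) = let (w , h) = mono κ∈ in w , λ {i} i∈ → h (subst (i ∈_) (sym eq) i∈)

  -- Tuples without bad pairs.

  tuples : List X → (m : ℕ) → List (Vec X m)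
  tuples ys zero = [] ∷ []
  tuples ys (suc m) = cartesianProductWith _∷_ ys (tuples ys m)

  touches : (X → X → Bool) → X → ∀ {m} → Vec X m → Bool
  touches r x [] = false
  touches r x (y ∷ t) = r x y ∨ touches r x t

  badTuple : (X → X → Bool) → ∀ {m} → Vec X m → Bool
  badTuple r [] = false
  badTuple r (x ∷ t) = touches r x t ∨ badTuple r t

  badTuple⇒AllPairs : ∀ (r : X → X → Bool) {m} (t : Vec X m) → badTuple r t ≡ false →
    AllPairs (λ i j → r i j ≡ false) (toList t)
  badTuple⇒AllPairs r [] h = []
  badTuple⇒AllPairs {X} r (x ∷ t) h = row t (∨-falseˡ h) ∷ badTuple⇒AllPairs r t (∨-falseʳ {touches r x t} h)
    where
    ∨-falseˡ : ∀ {a b} → a ∨ b ≡ false → a ≡ false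
    ∨-falseˡ {false} _ = refl
    ∨-falseʳ : ∀ {a b} → a ∨ b ≡ false → b ≡ false
    ∨-falseʳ {false} h = h
    row : ∀ {m} (t : Vec X m) → touches r x t ≡ false → All (λ j → r x j ≡ false) (toList t)
    row [] h = []
    row (y ∷ t) h = ∨-falseˡ h ∷ row t (∨-falseʳ {r x y} h)

  length-tuples : ∀ (ys : List X) m → length (tuples ys m) ≡ length ys ^ m
  length-tuples ys zero = refl
  length-tuples ys (suc m) = trans (length-product _∷_ ys (tuples ys m)) (cong (length ys *_) (length-tuples ys m))

  tuples-unique : ∀ {ys : List X} → Unique ys → ∀ m → Unique (tuples ys m)
  tuples-unique u zero = [] ∷ []
  tuples-unique u (suc m) = Unique.cartesianProductWith⁺ _∷_ (λ { refl → refl , refl }) u (tuples-unique u m)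

  tuples-∈ : ∀ (ys : List X) m {t} → t ∈ tuples ys m → All (_∈ ys) (toList t)
  tuples-∈ ys zero {[]} _ = []
  tuples-∈ ys (suc m) t∈ with ∈-cartesianProductWith⁻ _∷_ ys (tuples ys m) t∈
  ... | i , t , i∈ , t∈′ , refl = i∈ ∷ tuples-∈ ys m t∈′

  module BadTuples {X : Set} (ys : List X) (r : X → X → Bool) (E : ℕ) (few : E * pairs ys r ≤ length ys * length ys) where

    N = length ys

    U : ℕ → ℕ
    U m = sumL (λ i → countB (touches r i) (tuples ys m)) ys

    -- A union bound over the `m` entries of the tuple.
    U-bound : ∀ m → E * U m ≤ m * N ^ suc m
    U-bound zero = ≤-trans (≤-reflexive (trans (cong (E *_) (trans (sumL-const 0 ys) (*-zeroʳ N))) (*-zeroʳ E))) z≤n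
    U-bound (suc m) = ≤-trans (*-monoʳ-≤ E step) (≤-trans (≤-reflexive (lem E (N ^ m) (pairs ys r) N (U m)))
        (≤-trans (+-mono-≤ (*-monoʳ-≤ (N ^ m) few) (*-monoʳ-≤ N (U-bound m))) (≤-reflexive (lem′ (N ^ m) N m))))
      where
      row : ∀ i → countB (touches r i) (tuples ys (suc m)) ≤ N ^ m * countB (r i) ys + N * countB (touches r i) (tuples ys m)
      row i = ≤-trans (≤-reflexive (countB-product (touches r i) Vec._∷_ ys (tuples ys m)))
        (≤-trans (sumL-mono ys (λ {y} _ → ≤-trans (countB-∨ (λ _ → r i y) (touches r i) (tuples ys m))
                   (≤-reflexive (cong (_+ countB (touches r i) (tuples ys m)) (trans (countB-const (r i y) (tuples ys m)) (cong (_* bit (r i y)) (length-tuples ys m)))))))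
        (≤-reflexive (trans (sumL-+ (λ y → N ^ m * bit (r i y)) (λ _ → countB (touches r i) (tuples ys m)) ys)
          (cong₂ _+_ (trans (sumL-*ˡ (N ^ m) (bit ∘ r i) ys) (cong (N ^ m *_) (sumL-bit (r i) ys))) (sumL-const _ ys)))))
      step : U (suc m) ≤ N ^ m * pairs ys r + N * U m
      step = ≤-trans (sumL-mono ys (λ {i} _ → row i))
        (≤-reflexive (trans (sumL-+ (λ i → N ^ m * countB (r i) ys) (λ i → N * countB (touches r i) (tuples ys m)) ys)
          (cong₂ _+_ (sumL-*ˡ (N ^ m) (λ i → countB (r i) ys) ys) (sumL-*ˡ N (λ i → countB (touches r i) (tuples ys m)) ys))))
      lem : ∀ E P p N U → E * (P * p + N * U) ≡ P * (E * p) + N * (E * U)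
      lem = solveℕ
      lem′ : ∀ P N m → P * (N * N) + N * (m * (N * P)) ≡ (1 + m) * (N * (N * P))
      lem′ = solveℕ

    -- A union bound over the pairs of positions. The factor `m * m` is generous: in the recursion m
    -- + m² is rounded up to (m + 1)².
    bad-bound : ∀ m → E * countB (badTuple r) (tuples ys m) ≤ m * m * N ^ m
    bad-bound zero = ≤-reflexive (*-zeroʳ E)
    bad-bound (suc m) = ≤-trans (*-monoʳ-≤ E step) (≤-trans (≤-reflexive (*-distribˡ-+ E (U m) _))
        (≤-trans (+-mono-≤ (U-bound m) (≤-trans (≤-reflexive (lem E N (countB (badTuple r) (tuples ys m)))) (*-monoʳ-≤ N (bad-bound m))))
        (≤-trans (m≤m+n _ ((1 + m) * (N * N ^ m))) (≤-reflexive (lem′ N m (N ^ m))))))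
      where
      step : countB (badTuple r) (tuples ys (suc m)) ≤ U m + N * countB (badTuple r) (tuples ys m)
      step = ≤-trans (≤-reflexive (countB-product (badTuple r) Vec._∷_ ys (tuples ys m)))
        (≤-trans (sumL-mono ys (λ {i} _ → countB-∨ (touches r i) (badTuple r) (tuples ys m)))
        (≤-reflexive (trans (sumL-+ (λ i → countB (touches r i) (tuples ys m)) (λ _ → countB (badTuple r) (tuples ys m)) ys)
          (cong (U m +_) (sumL-const _ ys)))))
      lem : ∀ E N b → E * (N * b) ≡ N * (E * b)
      lem = solveℕ
      lem′ : ∀ N m P → m * (N * P) + N * (m * m * P) + (1 + m) * (N * P) ≡ (1 + m) * (1 + m) * (N * P)
      lem′ = solveℕ

-- Integer inequalities and sums over the cube.

module Density where

  open import Data.Integer using (ℤ; +_; -_; _+_; _*_; _-_; _≤_; _<_; 0ℤ; 1ℤ; +≤+; +<+; -[1+_]; -≤+; Positive)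
  open import Data.Integer.Properties
  open import Data.Integer.Tactic.RingSolver using (solve-∀)
  open import Data.List.Membership.Propositional using (_∈_; find)
  open Counting

  infix 4 _by_
  -- Almost all inequalities below have this form of certificate: the ring solver identifies the
  -- difference of the two sides with an expression that `_⊞_` and `_⊠_` build from non-negative
  -- pieces.
  _by_ : ∀ {x y r} → 0ℤ ≤ r → y - x ≡ r → x ≤ y
  h by eq = 0≤i-j⇒j≤i (subst (0ℤ ≤_) (sym eq) h)

  slack : ∀ {x y} → x ≤ y → 0ℤ ≤ y - x
  slack = i≤j⇒0≤j-i

  0≤+ : ∀ {n} → 0ℤ ≤ + n
  0≤+ = +≤+ z≤n

  infixl 6 _⊞_
  infixl 7 _⊠_

  _⊞_ : ∀ {x y} → 0ℤ ≤ x → 0ℤ ≤ y → 0ℤ ≤ x + y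
  _⊞_ = +-mono-≤

  _⊠_ : ∀ {x y} → 0ℤ ≤ x → 0ℤ ≤ y → 0ℤ ≤ x * y
  _⊠_ {+ m} {+ n} _ _ = subst (0ℤ ≤_) (pos-* m n) 0≤+

  0≤square : ∀ x → 0ℤ ≤ x * x
  0≤square (+ n) = subst (0ℤ ≤_) (pos-* n n) 0≤+
  0≤square -[1+ n ] = 0≤+

  ⟦_⟧ : Bool → ℤ
  ⟦ true ⟧ = 1ℤ
  ⟦ false ⟧ = 0ℤ

  square-cancel-≤ : ∀ {x y} → 0ℤ ≤ y → x * x ≤ y * y → x ≤ y
  square-cancel-≤ {+ m} {+ n} _ h with m ℕ.≤? n
  ... | yes m≤n = +≤+ m≤n
  ... | no m≰n = ⊥-elim (ℕ.<⇒≱ (ℕ.*-mono-< n<m n<m)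
                   (drop‿+≤+ (subst₂ _≤_ (sym (pos-* m m)) (sym (pos-* n n)) h)))
    where n<m = ℕ.≰⇒> m≰n
  square-cancel-≤ { -[1+ m ]} {+ n} _ h = -≤+

  0≤⟦⟧ : ∀ b → 0ℤ ≤ ⟦ b ⟧
  0≤⟦⟧ true = 0≤+
  0≤⟦⟧ false = 0≤+

  ⟦⟧≤1 : ∀ b → ⟦ b ⟧ ≤ 1ℤ
  ⟦⟧≤1 true = ≤-refl
  ⟦⟧≤1 false = 0≤+

  ⟦∧⟧ : ∀ a b → ⟦ a ∧ b ⟧ ≡ ⟦ a ⟧ * ⟦ b ⟧
  ⟦∧⟧ true b = sym (*-identityˡ _)
  ⟦∧⟧ false b = refl

  -- Sums over the cube

  Σc : ∀ {n} → (Cube n → ℤ) → ℤ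
  Σc {zero} f = f []
  Σc {suc n} f = Σc (λ x → f (false ∷ x)) + Σc (λ x → f (true ∷ x))

  Σc-cong : ∀ {n} {f g : Cube n → ℤ} → (∀ x → f x ≡ g x) → Σc f ≡ Σc g
  Σc-cong {zero} h = h []
  Σc-cong {suc n} h = cong₂ _+_ (Σc-cong (λ x → h (false ∷ x))) (Σc-cong (λ x → h (true ∷ x)))

  Σc-+ : ∀ {n} (f g : Cube n → ℤ) → Σc (λ x → f x + g x) ≡ Σc f + Σc g
  Σc-+ {zero} f g = refl
  Σc-+ {suc n} f g = trans (cong₂ _+_ (Σc-+ f₀ g₀) (Σc-+ f₁ g₁)) (lem (Σc f₀) (Σc g₀) (Σc f₁) (Σc g₁))
    where
    f₀ = λ x → f (false ∷ x)
    f₁ = λ x → f (true ∷ x)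
    g₀ = λ x → g (false ∷ x)
    g₁ = λ x → g (true ∷ x)
    lem : ∀ a b c d → (a + b) + (c + d) ≡ (a + c) + (b + d)
    lem = solve-∀

  Σc-*ˡ : ∀ {n} c (f : Cube n → ℤ) → Σc (λ x → c * f x) ≡ c * Σc f
  Σc-*ˡ {zero} c f = refl
  Σc-*ˡ {suc n} c f = trans (cong₂ _+_ (Σc-*ˡ c f₀) (Σc-*ˡ c f₁)) (sym (*-distribˡ-+ c (Σc f₀) (Σc f₁)))
    where
    f₀ = λ x → f (false ∷ x)
    f₁ = λ x → f (true ∷ x)

  Σc-0 : ∀ n → Σc {n} (λ _ → 0ℤ) ≡ 0ℤ
  Σc-0 zero = refl
  Σc-0 (suc n) = cong₂ _+_ (Σc-0 n) (Σc-0 n)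

  pow2 : ℕ → ℤ
  pow2 n = + (2 ℕ.^ n)

  pow2-suc : ∀ n → pow2 (suc n) ≡ pow2 n + pow2 n
  pow2-suc n = cong +_ (cong (2 ℕ.^ n ℕ.+_) (ℕ.+-identityʳ _))

  Σc-const : ∀ n c → Σc {n} (λ _ → c) ≡ c * pow2 n
  Σc-const zero c = sym (*-identityʳ c)
  Σc-const (suc n) c = trans (cong₂ _+_ (Σc-const n c) (Σc-const n c))
    (trans (sym (*-distribˡ-+ c (pow2 n) (pow2 n))) (cong (c *_) (sym (pow2-suc n))))

  Σc-mono : ∀ {n} {f g : Cube n → ℤ} → (∀ x → f x ≤ g x) → Σc f ≤ Σc g
  Σc-mono {zero} h = h []
  Σc-mono {suc n} h = +-mono-≤ (Σc-mono (λ x → h (false ∷ x))) (Σc-mono (λ x → h (true ∷ x)))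

  Σc-nonneg : ∀ {n} {f : Cube n → ℤ} → (∀ x → 0ℤ ≤ f x) → 0ℤ ≤ Σc f
  Σc-nonneg {n} {f} h = subst (_≤ Σc f) (Σc-0 n) (Σc-mono h)

  Σc-ind-witness : ∀ {n} (B : Cube n → Bool) → 0ℤ < Σc (λ x → ⟦ B x ⟧) → ∃ λ x → B x ≡ true
  Σc-ind-witness {zero} B h with B [] in eq
  ... | true = [] , eq
  ... | false = ⊥-elim (<-irrefl refl h)
  Σc-ind-witness {suc n} B h with Σc (λ x → ⟦ B (false ∷ x) ⟧) in eq
  ... | + zero = let (x , e) = Σc-ind-witness (λ x → B (true ∷ x)) (subst (0ℤ <_) (+-identityˡ _) h) in true ∷ x , e
  ... | + suc k = let (x , e) = Σc-ind-witness (λ x → B (false ∷ x)) (subst (0ℤ <_) (sym eq) (+<+ (s≤s z≤n))) in false ∷ x , e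
  ... | -[1+ k ] = ⊥-elim (neg (subst (0ℤ ≤_) eq (Σc-nonneg (λ x → 0≤⟦⟧ (B (false ∷ x))))))
    where
    neg : ¬ (0ℤ ≤ -[1+ k ])
    neg ()

  countB-allBits : ∀ {n} (B : Cube n → Bool) → + countB B (allBits n) ≡ Σc (λ x → ⟦ B x ⟧)
  countB-allBits {zero} B with B []
  ... | true = refl
  ... | false = refl
  countB-allBits {suc n} B =
    trans (cong +_ (countB-++ B (map (false ∷_) (allBits n)) _))
    (trans (cong₂ (λ u v → + (u ℕ.+ v)) (countB-map B _ (allBits n)) (countB-map B _ (allBits n)))
    (cong₂ _+_ (countB-allBits (B ∘ (false ∷_))) (countB-allBits (B ∘ (true ∷_)))))

  Σr : ℕ → (ℕ → ℤ) → ℤ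
  Σr zero f = 0ℤ
  Σr (suc k) f = Σr k f + f k

  Σr-cong : ∀ k {f g : ℕ → ℤ} → (∀ i → i ℕ.< k → f i ≡ g i) → Σr k f ≡ Σr k g
  Σr-cong zero h = refl
  Σr-cong (suc k) h = cong₂ _+_ (Σr-cong k (λ i l → h i (ℕ.m<n⇒m<1+n l))) (h k ℕ.≤-refl)

  Σr-mono : ∀ k {f g : ℕ → ℤ} → (∀ i → i ℕ.< k → f i ≤ g i) → Σr k f ≤ Σr k g
  Σr-mono zero h = ≤-refl
  Σr-mono (suc k) h = +-mono-≤ (Σr-mono k (λ i l → h i (ℕ.m<n⇒m<1+n l))) (h k ℕ.≤-refl)

  Σr-+ : ∀ k f g → Σr k (λ i → f i + g i) ≡ Σr k f + Σr k g
  Σr-+ zero f g = refl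
  Σr-+ (suc k) f g = trans (cong (_+ (f k + g k)) (Σr-+ k f g)) (lem (Σr k f) (Σr k g) (f k) (g k))
    where
    lem : ∀ a b c d → (a + b) + (c + d) ≡ (a + c) + (b + d)
    lem = solve-∀

  Σr-*ˡ : ∀ k c f → Σr k (λ i → c * f i) ≡ c * Σr k f
  Σr-*ˡ zero c f = sym (*-zeroʳ c)
  Σr-*ˡ (suc k) c f = trans (cong (_+ (c * f k)) (Σr-*ˡ k c f)) (sym (*-distribˡ-+ c (Σr k f) (f k)))

  Σr-const : ∀ k c → Σr k (λ _ → c) ≡ + k * c
  Σr-const zero c = refl
  Σr-const (suc k) c = trans (cong (_+ c) (Σr-const k c)) (lem (+ k) c)
    where
    lem : ∀ k c → k * c + c ≡ (1ℤ + k) * c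
    lem = solve-∀

  Σc-Σr : ∀ {n} k (f : ℕ → Cube n → ℤ) → Σc (λ x → Σr k (λ i → f i x)) ≡ Σr k (λ i → Σc (f i))
  Σc-Σr {n} zero f = Σc-0 n
  Σc-Σr (suc k) f = trans (Σc-+ (λ x → Σr k (λ i → f i x)) (f k)) (cong (_+ Σc (f k)) (Σc-Σr k f))

  Σr-term : ∀ k f j → (∀ i → i ℕ.< k → 0ℤ ≤ f i) → j ℕ.< k → f j ≤ Σr k f
  Σr-term (suc k) f j h j<sk with ℕ.m<1+n⇒m<n∨m≡n j<sk
  ... | inj₁ j<k = subst (_≤ Σr k f + f k) (+-identityʳ (f j)) (+-mono-≤ (Σr-term k f j (λ i l → h i (ℕ.m<n⇒m<1+n l)) j<k) (h k ℕ.≤-refl))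
  ... | inj₂ refl = subst (_≤ Σr k f + f k) (+-identityˡ (f j)) (+-mono-≤ (nn k (λ i l → h i (ℕ.m<n⇒m<1+n l))) ≤-refl)
    where
    nn : ∀ k → (∀ i → i ℕ.< k → 0ℤ ≤ f i) → 0ℤ ≤ Σr k f
    nn k h = subst (_≤ Σr k f) (trans (Σr-const k 0ℤ) (*-zeroʳ (+ k))) (Σr-mono k h)

  Σr-pigeonhole : ∀ k f → 0 ℕ.< k → ∃ λ i → i ℕ.< k × Σr k f ≤ + k * f i
  Σr-pigeonhole k f 0<k = go k 0<k
    where
    lem1 : ∀ k F u v → (1ℤ + k) * u - (F + v) ≡ (k * u - F) + (u - v)
    lem1 = solve-∀
    lem2 : ∀ k F u v → (1ℤ + k) * v - (F + v) ≡ (k * u - F) + k * (v - u)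
    lem2 = solve-∀
    go : ∀ k → 0 ℕ.< k → ∃ λ i → i ℕ.< k × Σr k f ≤ + k * f i
    go (suc zero) _ = 0 , s≤s z≤n , ≤-reflexive (trans (+-identityˡ _) (sym (*-identityˡ _)))
    go (suc (suc k)) _ with go (suc k) (s≤s z≤n)
    ... | i , i<k , h with ≤-total (f (suc k)) (f i)
    ...   | inj₁ le = i , ℕ.m<n⇒m<1+n i<k , (slack h ⊞ slack le by lem1 (+ suc k) (Σr (suc k) f) (f i) (f (suc k)))
    ...   | inj₂ le = suc k , ℕ.≤-refl , (slack h ⊞ (0≤+ {suc k} ⊠ slack le) by lem2 (+ suc k) (Σr (suc k) f) (f i) (f (suc k)))

  -- Sets of coordinates, measurable events and their energy.

  Mask : ℕ → Set
  Mask = Cube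

  _∈ₘ_ : ∀ {n} → Fin n → Mask n → Set
  k ∈ₘ J = lookup J k ≡ true

  _⊑_ : ∀ {n} → Mask n → Mask n → Set
  J ⊑ J′ = ∀ k → k ∈ₘ J → k ∈ₘ J′

  _∪ₘ_ : ∀ {n} → Mask n → Mask n → Mask n
  _∪ₘ_ = zipWith _∨_

  add : ∀ {n} → Fin n → Mask n → Mask n
  add k J = J [ k ]≔ true

  ∣_∣ₘ : ∀ {n} → Mask n → ℕ
  ∣ [] ∣ₘ = 0
  ∣ true ∷ J ∣ₘ = suc ∣ J ∣ₘ
  ∣ false ∷ J ∣ₘ = ∣ J ∣ₘ

  ∨-trueˡ : ∀ {a} b → a ≡ true → a ∨ b ≡ true
  ∨-trueˡ b refl = refl

  ∨-elim : ∀ a {b} → a ∨ b ≡ true → a ≡ true ⊎ b ≡ true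
  ∨-elim true _ = inj₁ refl
  ∨-elim false e = inj₂ e

  ∪-left : ∀ {n} (J I : Mask n) → J ⊑ (J ∪ₘ I)
  ∪-left J I k h = trans (lookup-zipWith _∨_ k J I) (∨-trueˡ (lookup I k) h)

  ∪-right : ∀ {n} (J I : Mask n) → I ⊑ (J ∪ₘ I)
  ∪-right J I k h = trans (lookup-zipWith _∨_ k J I) (trans (cong (lookup J k ∨_) h) (∨-zeroʳ _))

  ∪-elim : ∀ {n} (J I : Mask n) k → k ∈ₘ (J ∪ₘ I) → k ∈ₘ J ⊎ k ∈ₘ I
  ∪-elim J I k h = ∨-elim (lookup J k) (trans (sym (lookup-zipWith _∨_ k J I)) h)

  ∪-card : ∀ {n} (J I : Mask n) → ∣ J ∪ₘ I ∣ₘ ℕ.≤ ∣ J ∣ₘ ℕ.+ ∣ I ∣ₘ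
  ∪-card [] [] = z≤n
  ∪-card (true ∷ J) (true ∷ I) = s≤s (ℕ.≤-trans (∪-card J I) (ℕ.+-monoʳ-≤ ∣ J ∣ₘ (ℕ.n≤1+n _)))
  ∪-card (true ∷ J) (false ∷ I) = s≤s (∪-card J I)
  ∪-card (false ∷ J) (true ∷ I) = ℕ.≤-trans (s≤s (∪-card J I)) (ℕ.≤-reflexive (sym (ℕ.+-suc _ _)))
  ∪-card (false ∷ J) (false ∷ I) = ∪-card J I

  ∈-add : ∀ {n} (k : Fin n) J → k ∈ₘ add k J
  ∈-add k J = lookup∘update k J true

  ⊑-add : ∀ {n} (k : Fin n) J → J ⊑ add k J
  ⊑-add k J j h with j Fin.≟ k
  ... | yes refl = ∈-add k J
  ... | no j≢k = trans (lookup∘update′ j≢k J true) h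

  add-elim : ∀ {n} (k : Fin n) J j → j ∈ₘ add k J → j ≡ k ⊎ j ∈ₘ J
  add-elim k J j h with j Fin.≟ k
  ... | yes e = inj₁ e
  ... | no j≢k = inj₂ (trans (sym (lookup∘update′ j≢k J true)) h)

  Agree : ∀ {n} → Mask n → Cube n → Cube n → Set
  Agree J x y = ∀ k → k ∈ₘ J → lookup x k ≡ lookup y k

  Measurable : ∀ {n} → Mask n → (Cube n → Bool) → Set
  Measurable J B = ∀ x y → Agree J x y → B x ≡ B y

  meas-⊑ : ∀ {n} {J J′ : Mask n} {B} → J ⊑ J′ → Measurable J B → Measurable J′ B
  meas-⊑ s m x y a = m x y (λ k h → a k (s k h))

  meas-∧ : ∀ {n} {J : Mask n} {B B′} → Measurable J B → Measurable J B′ → Measurable J (λ x → B x ∧ B′ x)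
  meas-∧ m m′ x y a = cong₂ _∧_ (m x y a) (m′ x y a)

  meas-in : ∀ {n} {J : Mask n} {B} → Measurable (true ∷ J) B → ∀ b → Measurable J (λ x → B (b ∷ x))
  meas-in m b x y a = m _ _ λ { zero _ → refl ; (suc k) h → a k h }

  meas-out : ∀ {n} {J : Mask n} {B} → Measurable (false ∷ J) B → ∀ b → Measurable J (λ x → B (b ∷ x))
  meas-out m b x y a = m _ _ λ { zero () ; (suc k) h → a k h }

  meas-flip : ∀ {n} {J : Mask n} {B} → Measurable (false ∷ J) B → ∀ x → B (true ∷ x) ≡ B (false ∷ x)
  meas-flip m x = m _ _ λ { zero () ; (suc k) h → refl }

  low high : ∀ {n} {Z : Set} → (Cube (suc n) → Z) → Cube n → Z
  low f x = f (false ∷ x)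
  high f x = f (true ∷ x)

  -- Energy: 2^|J| times the sum over the atoms of the J-coordinates of the squared mass of f.

  energy : ∀ {n} → Mask n → (Cube n → ℤ) → ℤ
  energy [] f = f [] * f []
  energy (true ∷ J) f = + 2 * (energy J (λ x → f (false ∷ x)) + energy J (λ x → f (true ∷ x)))
  energy (false ∷ J) f = energy J (λ x → f (false ∷ x) + f (true ∷ x))

  energy-cong : ∀ {n} (J : Mask n) {f g} → (∀ x → f x ≡ g x) → energy J f ≡ energy J g
  energy-cong [] h = cong₂ _*_ (h []) (h [])
  energy-cong (true ∷ J) h = cong (+ 2 *_) (cong₂ _+_ (energy-cong J (λ x → h (false ∷ x))) (energy-cong J (λ x → h (true ∷ x))))
  energy-cong (false ∷ J) h = energy-cong J (λ x → cong₂ _+_ (h (false ∷ x)) (h (true ∷ x)))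

  energy-nonneg : ∀ {n} (J : Mask n) f → 0ℤ ≤ energy J f
  energy-nonneg [] f = 0≤square (f [])
  energy-nonneg (true ∷ J) f = 0≤+ {2} ⊠ (energy-nonneg J _ ⊞ energy-nonneg J _)
  energy-nonneg (false ∷ J) f = energy-nonneg J _

  -- A coordinate enters the energy either revealed (the two halves kept apart) or hidden (the two
  -- halves added). This law says that revealing it gains exactly the energy of the difference of
  -- the halves.
  parallelogram : ∀ {n} (J : Mask n) f g →
    energy J (λ x → f x + g x) + energy J (λ x → f x - g x) ≡ + 2 * (energy J f + energy J g)
  parallelogram [] f g = lem (f []) (g [])
    where
    lem : ∀ a b → (a + b) * (a + b) + (a - b) * (a - b) ≡ + 2 * (a * a + b * b)
    lem = solve-∀
  parallelogram {suc n} (true ∷ J) f g =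
    trans (lem (e (λ x → f₀ x + g₀ x)) (e (λ x → f₁ x + g₁ x)) (e (λ x → f₀ x - g₀ x)) (e (λ x → f₁ x - g₁ x)))
    (trans (cong₂ (λ u v → + 2 * u + + 2 * v) (parallelogram J f₀ g₀) (parallelogram J f₁ g₁))
    (lem′ (e f₀) (e f₁) (e g₀) (e g₁)))
    where
    e = energy J
    f₀ = low f
    f₁ = high f
    g₀ = low g
    g₁ = high g
    lem : ∀ a b c d → + 2 * (a + b) + + 2 * (c + d) ≡ + 2 * (a + c) + + 2 * (b + d)
    lem = solve-∀
    lem′ : ∀ a b c d → + 2 * (+ 2 * (a + c)) + + 2 * (+ 2 * (b + d)) ≡ + 2 * (+ 2 * (a + b) + + 2 * (c + d))
    lem′ = solve-∀
  parallelogram {suc n} (false ∷ J) f g =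
    trans (cong₂ _+_ (energy-cong J (λ x → lem (f₀ x) (f₁ x) (g₀ x) (g₁ x)))
                     (energy-cong J (λ x → lem′ (f₀ x) (f₁ x) (g₀ x) (g₁ x))))
          (parallelogram J (λ x → f₀ x + f₁ x) (λ x → g₀ x + g₁ x))
    where
    f₀ = low f
    f₁ = high f
    g₀ = low g
    g₁ = high g
    lem : ∀ a b c d → (a + c) + (b + d) ≡ (a + b) + (c + d)
    lem = solve-∀
    lem′ : ∀ a b c d → (a - c) + (b - d) ≡ (a + b) - (c + d)
    lem′ = solve-∀

  energy-mono : ∀ {n} (J J′ : Mask n) f → J ⊑ J′ → energy J f ≤ energy J′ f
  energy-mono [] [] f s = ≤-refl
  energy-mono (true ∷ J) (true ∷ J′) f s =
    *-monoˡ-≤-nonNeg (+ 2) (+-mono-≤ (energy-mono J J′ _ (s ∘ suc)) (energy-mono J J′ _ (s ∘ suc)))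
  energy-mono (true ∷ J) (false ∷ J′) f s with () ← s zero refl
  energy-mono {suc n} (false ∷ J) (true ∷ J′) f s =
    ≤-trans (energy-mono J J′ (λ x → f₀ x + f₁ x) (s ∘ suc))
      (energy-nonneg J′ (λ x → f₀ x - f₁ x)
        by trans (cong (_- energy J′ (λ x → f₀ x + f₁ x)) (sym (parallelogram J′ f₀ f₁)))
                 (lem (energy J′ (λ x → f₀ x + f₁ x)) (energy J′ (λ x → f₀ x - f₁ x))))
    where
    f₀ = low f
    f₁ = high f
    lem : ∀ a b → (a + b) - a ≡ b
    lem = solve-∀
  energy-mono (false ∷ J) (false ∷ J′) f s = energy-mono J J′ _ (s ∘ suc)

  -- `M` is general because hiding a coordinate adds two values of `f` and so doubles the bound.
  energy-bound : ∀ {n} (J : Mask n) f M → (∀ x → 0ℤ ≤ f x) → (∀ x → f x ≤ M) →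
    energy J f ≤ M * M * (pow2 n * pow2 n)
  energy-bound [] f M lo hi =
    (slack (hi []) ⊠ (lo [] ⊞ ≤-trans (lo []) (hi []))) by lem (f []) M
    where
    lem : ∀ a M → M * M * 1ℤ - a * a ≡ (M - a) * (a + M)
    lem = solve-∀
  energy-bound {suc n} (true ∷ J) f M lo hi =
    (0≤+ {2} ⊠ (slack (energy-bound J f₀ M (lo ∘ (false ∷_)) (hi ∘ (false ∷_))) ⊞
                slack (energy-bound J f₁ M (lo ∘ (true ∷_)) (hi ∘ (true ∷_)))))
    by trans (cong (λ u → M * M * (u * u) - + 2 * (energy J f₀ + energy J f₁)) (pow2-suc n))
             (lem M (pow2 n) (energy J f₀) (energy J f₁))
    where
    f₀ = low f
    f₁ = high f
    lem : ∀ M u a b → M * M * ((u + u) * (u + u)) - + 2 * (a + b) ≡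
                      + 2 * ((M * M * (u * u) - a) + (M * M * (u * u) - b))
    lem = solve-∀
  energy-bound {suc n} (false ∷ J) f M lo hi =
    ≤-trans (energy-bound J (λ x → f (false ∷ x) + f (true ∷ x)) (M + M)
              (λ x → lo (false ∷ x) ⊞ lo (true ∷ x))
              (λ x → +-mono-≤ (hi (false ∷ x)) (hi (true ∷ x))))
    (≤-reflexive (trans (lem M (pow2 n)) (cong (λ u → M * M * (u * u)) (sym (pow2-suc n)))))
    where
    lem : ∀ M u → (M + M) * (M + M) * (u * u) ≡ M * M * ((u + u) * (u + u))
    lem = solve-∀

  mass : ∀ {n} → (Cube n → ℤ) → (Cube n → Bool) → ℤ
  mass f B = Σc (λ x → f x * ⟦ B x ⟧)

  -- Cauchy-Schwarz over the atoms of `J`, whose number is the factor 2^|J| in the energy. Each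
  -- revealed coordinate contributes (a + b)² ≤ 2 (a² + b²).
  mass²≤energy : ∀ {n} (J : Mask n) f B → Measurable J B → mass f B * mass f B ≤ energy J f
  mass²≤energy [] f B m with B []
  ... | true = ≤-reflexive (cong₂ _*_ (*-identityʳ (f [])) (*-identityʳ (f [])))
  ... | false = ≤-trans (≤-reflexive (cong₂ _*_ (*-zeroʳ (f [])) (*-zeroʳ (f [])))) (0≤square (f []))
  mass²≤energy {suc n} (true ∷ J) f B m =
    (0≤+ {2} ⊠ (slack (mass²≤energy J f₀ B₀ (meas-in m false)) ⊞ slack (mass²≤energy J f₁ B₁ (meas-in m true))))
      ⊞ 0≤square (mass f₀ B₀ - mass f₁ B₁)
    by lem (mass f₀ B₀) (mass f₁ B₁) (energy J f₀) (energy J f₁)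
    where
    f₀ = low f
    f₁ = high f
    B₀ = low B
    B₁ = high B
    lem : ∀ a b E F → + 2 * (E + F) - (a + b) * (a + b) ≡
                      + 2 * ((E - a * a) + (F - b * b)) + (a - b) * (a - b)
    lem = solve-∀
  mass²≤energy {suc n} (false ∷ J) f B m =
    subst (λ u → u * u ≤ energy J f₊) eq (mass²≤energy J f₊ B₀ (meas-out m false))
    where
    f₊ : Cube n → ℤ
    f₊ x = f (false ∷ x) + f (true ∷ x)
    B₀ = low B
    eq : mass f₊ B₀ ≡ mass f B
    eq = trans (Σc-cong (λ x → trans (*-distribʳ-+ ⟦ B₀ x ⟧ (f (false ∷ x)) (f (true ∷ x)))
                  (cong (λ b → f (false ∷ x) * ⟦ B₀ x ⟧ + f (true ∷ x) * ⟦ b ⟧) (sym (meas-flip m x)))))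
               (Σc-+ (λ x → f (false ∷ x) * ⟦ B₀ x ⟧) (λ x → f (true ∷ x) * ⟦ B (true ∷ x) ⟧))

  sign : Bool → ℤ
  sign false = 1ℤ
  sign true = - 1ℤ

  bias : ∀ {n} → Fin n → (Cube n → ℤ) → (Cube n → Bool) → ℤ
  bias k f B = Σc (λ x → f x * ⟦ B x ⟧ * sign (lookup x k))

  -- Revealing `k` gains the energy of the difference of the two halves, and the bias is the mass of
  -- this difference on `B`. So if little energy can be gained, `k` is nearly a fair coin on every
  -- `J`-measurable event.
  bias²≤increment : ∀ {n} (J : Mask n) k f B → lookup J k ≡ false → Measurable J B →
    bias k f B * bias k f B + energy J f ≤ energy (add k J) f
  bias²≤increment {suc n} (false ∷ J) zero f B _ m =
    slack (mass²≤energy J f₋ B₀ (meas-out m false))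
    by trans (cong₂ (λ u v → u - (v * v + energy J f₊)) (sym (parallelogram J f₀ f₁)) (sym eq))
             (lem (energy J f₊) (energy J f₋) (mass f₋ B₀))
    where
    f₀ = low f
    f₁ = high f
    f₊ f₋ : Cube n → ℤ
    f₊ x = f₀ x + f₁ x
    f₋ x = f₀ x - f₁ x
    B₀ = low B
    lem : ∀ a b v → (a + b) - (v * v + a) ≡ b - v * v
    lem = solve-∀
    lem′ : ∀ a b c → (a - b) * c ≡ a * c * 1ℤ + b * c * - 1ℤ
    lem′ = solve-∀
    eq : mass f₋ B₀ ≡ bias zero f B
    eq = trans (Σc-cong (λ x → trans (lem′ (f₀ x) (f₁ x) ⟦ B₀ x ⟧)
                 (cong (λ b → f₀ x * ⟦ B₀ x ⟧ * 1ℤ + f₁ x * ⟦ b ⟧ * - 1ℤ) (sym (meas-flip m x)))))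
               (Σc-+ (λ x → f₀ x * ⟦ B₀ x ⟧ * 1ℤ) (λ x → f₁ x * ⟦ B (true ∷ x) ⟧ * - 1ℤ))
  bias²≤increment {suc n} (true ∷ J) (suc k) f B h m =
    (0≤+ {2} ⊠ (slack (bias²≤increment J k f₀ B₀ h (meas-in m false)) ⊞
                slack (bias²≤increment J k f₁ B₁ h (meas-in m true))))
      ⊞ 0≤square (bias k f₀ B₀ - bias k f₁ B₁)
    by lem (bias k f₀ B₀) (bias k f₁ B₁) (energy J f₀) (energy J f₁) (energy (add k J) f₀) (energy (add k J) f₁)
    where
    f₀ = low f
    f₁ = high f
    B₀ = low B
    B₁ = high B
    lem : ∀ a b E F E′ F′ → + 2 * (E′ + F′) - ((a + b) * (a + b) + + 2 * (E + F)) ≡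
      + 2 * ((E′ - (a * a + E)) + (F′ - (b * b + F))) + (a - b) * (a - b)
    lem = solve-∀
  bias²≤increment {suc n} (false ∷ J) (suc k) f B h m =
    subst (λ u → u * u + energy J f₊ ≤ energy (add k J) f₊) eq (bias²≤increment J k f₊ B₀ h (meas-out m false))
    where
    f₊ : Cube n → ℤ
    f₊ x = f (false ∷ x) + f (true ∷ x)
    B₀ = low B
    lem : ∀ a b c s → (a + b) * c * s ≡ a * c * s + b * c * s
    lem = solve-∀
    eq : bias k f₊ B₀ ≡ bias (suc k) f B
    eq = trans (Σc-cong (λ x → trans (lem (f (false ∷ x)) (f (true ∷ x)) ⟦ B₀ x ⟧ (sign (lookup x k)))
                  (cong (λ b → f (false ∷ x) * ⟦ B₀ x ⟧ * sign (lookup x k) + f (true ∷ x) * ⟦ b ⟧ * sign (lookup x k)) (sym (meas-flip m x)))))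
               (Σc-+ (λ x → f (false ∷ x) * ⟦ B₀ x ⟧ * sign (lookup x k)) (λ x → f (true ∷ x) * ⟦ B (true ∷ x) ⟧ * sign (lookup x k)))

  -- Fixing nearly fair coordinates one by one.

  same : Bool → Bool → Bool
  same true b = b
  same false b = not b

  same⇒≡ : ∀ a b → same a b ≡ true → a ≡ b
  same⇒≡ true true _ = refl
  same⇒≡ false false _ = refl

  mass-cong : ∀ {n} f {B B′ : Cube n → Bool} → (∀ x → B x ≡ B′ x) → mass f B ≡ mass f B′
  mass-cong f h = Σc-cong (λ x → cong (λ b → f x * ⟦ b ⟧) (h x))

  agreeOn : ∀ {n} → List (Fin n) → Cube n → Cube n → Bool
  agreeOn [] x z = true
  agreeOn (k ∷ ks) x z = same (lookup x k) (lookup z k) ∧ agreeOn ks x z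

  module Halving {n} (f : Cube n → ℤ) (r : ℕ) where

    R = + r

    half-bias : ∀ k B b → + 2 * mass f (λ x → B x ∧ same (lookup x k) b) ≡ mass f B + sign b * bias k f B
    half-bias k B b =
      trans (sym (Σc-*ˡ (+ 2) (λ x → f x * ⟦ B x ∧ same (lookup x k) b ⟧)))
      (trans (Σc-cong (λ x → pointwise x))
      (trans (Σc-+ (λ x → f x * ⟦ B x ⟧) (λ x → sign b * (f x * ⟦ B x ⟧ * sign (lookup x k))))
             (cong (λ u → mass f B + u) (Σc-*ˡ (sign b) (λ x → f x * ⟦ B x ⟧ * sign (lookup x k))))))
      where
      core : ∀ u s → + 2 * ⟦ same s b ⟧ * u ≡ u + sign b * (u * sign s)
      core u s = go s b
        where
        l₁ : ∀ u → + 2 * 1ℤ * u ≡ u + 1ℤ * (u * 1ℤ)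
        l₁ = solve-∀
        l₂ : ∀ u → + 2 * 0ℤ * u ≡ u + 1ℤ * (u * - 1ℤ)
        l₂ = solve-∀
        l₃ : ∀ u → + 2 * 0ℤ * u ≡ u + - 1ℤ * (u * 1ℤ)
        l₃ = solve-∀
        l₄ : ∀ u → + 2 * 1ℤ * u ≡ u + - 1ℤ * (u * - 1ℤ)
        l₄ = solve-∀
        go : ∀ s b → + 2 * ⟦ same s b ⟧ * u ≡ u + sign b * (u * sign s)
        go false false = l₁ u
        go true false = l₂ u
        go false true = l₃ u
        go true true = l₄ u
      comm : ∀ f B s → + 2 * (f * (B * s)) ≡ + 2 * s * (f * B)
      comm = solve-∀
      pointwise : ∀ x → + 2 * (f x * ⟦ B x ∧ same (lookup x k) b ⟧) ≡
                        f x * ⟦ B x ⟧ + sign b * (f x * ⟦ B x ⟧ * sign (lookup x k))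
      pointwise x = trans (cong (λ u → + 2 * (f x * u)) (⟦∧⟧ (B x) (same (lookup x k) b)))
        (trans (comm (f x) ⟦ B x ⟧ ⟦ same (lookup x k) b ⟧) (core (f x * ⟦ B x ⟧) (lookup x k)))

    -- The half in question is (mass ± bias) / 2, and `R` times the bias is at most 2^n in absolute
    -- value because its square is at most R² times the energy gain.
    halve₁ : ∀ J k B b → lookup J k ≡ false → Measurable J B →
      R * R * (energy (add k J) f - energy J f) ≤ pow2 n * pow2 n →
      R * mass f B ≤ + 2 * R * mass f (λ x → B x ∧ same (lookup x k) b) + pow2 n
    halve₁ J k B b out m small = slack (upper b) by
      trans (cong (λ u → u + pow2 n - R * mass f B) (trans (shuffle R M′) (cong (R *_) (half-bias k B b))))
            (final R (mass f B) (sign b) S (pow2 n))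
      where
      S = bias k f B
      M′ = mass f (λ x → B x ∧ same (lookup x k) b)
      shuffle : ∀ R M → + 2 * R * M ≡ R * (+ 2 * M)
      shuffle = solve-∀
      final : ∀ R M s S P → R * (M + s * S) + P - R * M ≡ P - - (s * (R * S))
      final = solve-∀
      sq : ∀ R S E E′ P → P * P - (R * S) * (R * S) ≡ (P * P - R * R * (E′ - E)) + (R * R) * (E′ - (S * S + E))
      sq = solve-∀
      square : (R * S) * (R * S) ≤ pow2 n * pow2 n
      square = slack small ⊞ ((0≤+ {r} ⊠ 0≤+ {r}) ⊠ slack (bias²≤increment J k f B out m))
        by sq R S (energy J f) (energy (add k J) f) (pow2 n)
      neg² : ∀ x → - (1ℤ * x) * - (1ℤ * x) ≡ x * x
      neg² = solve-∀
      pos² : ∀ x → - (- 1ℤ * x) * - (- 1ℤ * x) ≡ x * x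
      pos² = solve-∀
      upper : ∀ b → - (sign b * (R * S)) ≤ pow2 n
      upper false = square-cancel-≤ 0≤+ (subst (_≤ pow2 n * pow2 n) (sym (neg² (R * S))) square)
      upper true = square-cancel-≤ 0≤+ (subst (_≤ pow2 n * pow2 n) (sym (pos² (R * S))) square)

    same-meas : ∀ (J : Mask n) k b → k ∈ₘ J → Measurable J (λ x → same (lookup x k) b)
    same-meas J k b h x y a = cong (λ u → same u b) (a k h)

    -- By monotonicity the gain at each single step is at most the gain from `J₀` to `U`, so one
    -- hypothesis serves all steps. The errors satisfy e′ = 2e + 1, which gives 2^k - 1 after k
    -- steps.
    halve : ∀ J₀ U → R * R * (energy U f - energy J₀ f) ≤ pow2 n * pow2 n →
      ∀ ks J B z → Unique ks → (∀ {k} → k ∈ ks → lookup J k ≡ false) → (∀ {k} → k ∈ ks → k ∈ₘ U) →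
      J₀ ⊑ J → J ⊑ U → Measurable J B →
      R * mass f B ≤ R * pow2 (length ks) * mass f (λ x → B x ∧ agreeOn ks x z) + (pow2 (length ks) - 1ℤ) * pow2 n
    halve J₀ U small [] J B z _ _ _ _ _ _ =
      ≤-reflexive (trans (lem R (mass f B) (pow2 n))
        (cong (λ u → R * 1ℤ * u + (1ℤ - 1ℤ) * pow2 n) (mass-cong f (λ x → sym (∧-identityʳ (B x))))))
      where
      lem : ∀ R M P → R * M ≡ R * 1ℤ * M + (1ℤ - 1ℤ) * P
      lem = solve-∀
    halve J₀ U small (k ∷ ks) J B z (k∉ ∷ uniq) out inU lo up m =
      slack step ⊞ (0≤+ {2} ⊠ slack ih)
      by trans (cong₂ (λ u v → R * u * v + (u - 1ℤ) * pow2 n - R * mass f B) (pow2-suc (length ks))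
                  (mass-cong f (λ x → sym (∧-assoc (B x) (same (lookup x k) (lookup z k)) (agreeOn ks x z)))))
               (lem R (pow2 (length ks)) (mass f (λ x → B′ x ∧ agreeOn ks x z)) (mass f B′) (mass f B) (pow2 n))
      where
      B′ : Cube n → Bool
      B′ x = B x ∧ same (lookup x k) (lookup z k)
      up′ : add k J ⊑ U
      up′ j h with add-elim k J j h
      ... | inj₁ refl = inU (here refl)
      ... | inj₂ h′ = up j h′
      lem₀ : ∀ R E₀ E E′ EU P → P * P - R * R * (E′ - E) ≡
        (P * P - R * R * (EU - E₀)) + R * R * ((EU - E′) + (E - E₀))
      lem₀ = solve-∀
      step : R * mass f B ≤ + 2 * R * mass f B′ + pow2 n
      step = halve₁ J k B (lookup z k) (out (here refl)) m
        (slack small ⊞ ((0≤+ {r} ⊠ 0≤+ {r}) ⊠ (slack (energy-mono (add k J) U f up′) ⊞ slack (energy-mono J₀ J f lo)))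
         by lem₀ R (energy J₀ f) (energy J f) (energy (add k J) f) (energy U f) (pow2 n))
      out′ : ∀ {j} → j ∈ ks → lookup (add k J) j ≡ false
      out′ {j} j∈ = trans (lookup∘update′ (λ e → All.lookup k∉ j∈ (sym e)) J true) (out (there j∈))
      ih : R * mass f B′ ≤ R * pow2 (length ks) * mass f (λ x → B′ x ∧ agreeOn ks x z) + (pow2 (length ks) - 1ℤ) * pow2 n
      ih = halve J₀ U small ks (add k J) B′ z uniq out′ (inU ∘ there)
        (λ j h → ⊑-add k J j (lo j h)) up′
        (meas-∧ {J = add k J} {B = B} (meas-⊑ {J = J} {J′ = add k J} {B = B} (⊑-add k J) m) (same-meas (add k J) k (lookup z k) (∈-add k J)))
      lem : ∀ R p M″ M′ M P → R * (p + p) * M″ + ((p + p) - 1ℤ) * P - R * M ≡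
        (+ 2 * R * M′ + P - R * M) + + 2 * (R * p * M″ + (p - 1ℤ) * P - R * M′)
      lem = solve-∀

  -- The energy increment.

  anyCube? : ∀ {n} {P : Cube n → Set} → Decidable P → Dec (∃ P)
  anyCube? {zero} P? with P? []
  ... | yes p = yes ([] , p)
  ... | no ¬p = no λ { ([] , p) → ¬p p }
  anyCube? {suc n} P? with anyCube? (λ x → P? (false ∷ x)) | anyCube? (λ x → P? (true ∷ x))
  ... | yes (x , p) | _ = yes (false ∷ x , p)
  ... | no _ | yes (x , p) = yes (true ∷ x , p)
  ... | no ¬f | no ¬t = no λ { (false ∷ x , p) → ¬f (x , p) ; (true ∷ x , p) → ¬t (x , p) }

  Bounded : ∀ {n} → (Cube n → ℤ) → Set
  Bounded f = (∀ x → 0ℤ ≤ f x) × (∀ x → f x ≤ 1ℤ)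

  total : ∀ {n} → Mask n → List (Cube n → ℤ) → ℤ
  total J [] = 0ℤ
  total J (f ∷ fs) = energy J f + total J fs

  total-mono : ∀ {n} (J J′ : Mask n) fs → J ⊑ J′ → total J fs ≤ total J′ fs
  total-mono J J′ [] s = ≤-refl
  total-mono J J′ (f ∷ fs) s = +-mono-≤ (energy-mono J J′ f s) (total-mono J J′ fs s)

  total-nonneg : ∀ {n} (J : Mask n) fs → 0ℤ ≤ total J fs
  total-nonneg J [] = ≤-refl
  total-nonneg J (f ∷ fs) = energy-nonneg J f ⊞ total-nonneg J fs

  total-bound : ∀ {n} (J : Mask n) fs → All Bounded fs → total J fs ≤ + length fs * (pow2 n * pow2 n)
  total-bound J [] [] = ≤-refl
  total-bound {n} J (f ∷ fs) ((lo , hi) ∷ bs) =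
    slack (energy-bound J f 1ℤ lo hi) ⊞ slack (total-bound J fs bs)
    by lem (+ length fs) (pow2 n) (energy J f) (total J fs)
    where
    lem : ∀ l P e t → (1ℤ + l) * (P * P) - (e + t) ≡ (1ℤ * 1ℤ * (P * P) - e) + (l * (P * P) - t)
    lem = solve-∀

  energy-gap≤total-gap : ∀ {n} (J J′ : Mask n) fs → J ⊑ J′ → ∀ {f} → f ∈ fs →
    energy J′ f - energy J f ≤ total J′ fs - total J fs
  energy-gap≤total-gap J J′ (f ∷ fs) s (here refl) =
    slack (total-mono J J′ fs s) by lem (energy J f) (energy J′ f) (total J fs) (total J′ fs)
    where
    lem : ∀ e e′ t t′ → ((e′ + t′) - (e + t)) - (e′ - e) ≡ t′ - t
    lem = solve-∀
  energy-gap≤total-gap J J′ (g ∷ fs) s {f} (there f∈) =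
    slack (energy-mono J J′ g s) ⊞ slack (energy-gap≤total-gap J J′ fs s f∈)
    by lem (energy J g) (energy J′ g) (total J fs) (total J′ fs) (energy J f) (energy J′ f)
    where
    lem : ∀ e e′ t t′ u u′ → ((e′ + t′) - (e + t)) - (u′ - u) ≡ (e′ - e) + ((t′ - t) - (u′ - u))
    lem = solve-∀

  0<pow2 : ∀ n → 0ℤ < pow2 n
  0<pow2 n = +<+ (ℕ.m^n>0 2 n)

  -- Whole sets `I` are tested instead of single coordinates, because the support of a light form is
  -- revealed on top of `J` at one stroke.
  Stable : ∀ {n} → ℕ → ℕ → List (Cube n → ℤ) → Mask n → Set
  Stable {n} D R fs J = ∀ I → ∣ I ∣ₘ ℕ.≤ D → ∀ {f} → f ∈ fs →
    + R * (energy (J ∪ₘ I) f - energy J f) ≤ pow2 n * pow2 n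

  -- An unstable step raises the total energy by more than 4^n / `R`, and the total is at most `l`
  -- times 4^n. So `R * l + 1` steps cannot happen, and each step adds at most `D` coordinates.
  stable-bound : ℕ → ℕ → ℕ → ℕ
  stable-bound D R l = suc (R ℕ.* l) ℕ.* D

  ∣empty∣ : ∀ n → ∣ replicate n false ∣ₘ ≡ 0
  ∣empty∣ zero = refl
  ∣empty∣ (suc n) = ∣empty∣ n

  -- The potential is the total energy of all functions in `fs`, which yields a single `J` for all
  -- of them: no term decreases, so the gain of one function is at most the gain of the total.
  stable-mask : ∀ {n} D R (fs : List (Cube n → ℤ)) → All Bounded fs →
    ∃ λ J → ∣ J ∣ₘ ℕ.≤ stable-bound D R (length fs) × Stable D R fs J
  stable-mask {n} D R fs bs =
    go (suc (R ℕ.* length fs)) 0 (replicate n false) (ℕ.+-identityʳ _)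
      (ℕ.≤-reflexive (∣empty∣ n)) (0≤+ {R} ⊠ total-nonneg (replicate n false) fs)
    where
    P = pow2 n * pow2 n
    Bad : Mask n → Mask n → Set
    Bad J I = ∣ I ∣ₘ ℕ.≤ D × ¬ (+ R * (total (J ∪ₘ I) fs - total J fs) ≤ P)
    Bad? : ∀ J → Decidable (Bad J)
    Bad? J I = (∣ I ∣ₘ ℕ.≤? D) ×-dec ¬? (+ R * (total (J ∪ₘ I) fs - total J fs) ≤? P)
    lem₁ : ∀ P R t l → R * (l * P) - R * t ≡ R * (l * P - t)
    lem₁ = solve-∀
    lem₂ : ∀ P R t t′ j → R * t′ - (1ℤ + j) * P ≡ (R * t - j * P) + (R * (t′ - t) - P)
    lem₂ = solve-∀
    lem₃ : ∀ P R g G → P - R * g ≡ (P - R * G) + R * (G - g)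
    lem₃ = solve-∀
    lem₄ : ∀ P R l → R * (l * P) - (1ℤ + R * l) * P ≡ - P
    lem₄ = solve-∀
    0≤-P : ¬ (0ℤ ≤ - P)
    0≤-P h = <-irrefl refl (<-≤-trans (*-mono (0<pow2 n)) (neg-cancel-≤ h))
      where
      *-mono : 0ℤ < pow2 n → 0ℤ < P
      *-mono (+<+ h) = subst (0ℤ <_) (pos-* (2 ℕ.^ n) (2 ℕ.^ n)) (+<+ (ℕ.*-mono-< h h))
    go : ∀ fuel j J → fuel ℕ.+ j ≡ suc (R ℕ.* length fs) → ∣ J ∣ₘ ℕ.≤ j ℕ.* D → + j * P ≤ + R * total J fs →
      ∃ λ J → ∣ J ∣ₘ ℕ.≤ stable-bound D R (length fs) × Stable D R fs J
    go zero j J refl _ e = ⊥-elim (0≤-P (subst (0ℤ ≤_)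
      (trans (cong (λ u → + R * (+ length fs * P) - (1ℤ + u) * P) (pos-* R (length fs))) (lem₄ P (+ R) (+ length fs)))
      (slack {y = + R * (+ length fs * P)} (≤-trans e (0≤+ {R} ⊠ slack (total-bound J fs bs) by lem₁ P (+ R) (total J fs) (+ length fs))))))
    go (suc fuel) j J eq c e with anyCube? (Bad? J)
    ... | yes (I , small , bad) = go fuel (suc j) (J ∪ₘ I) (trans (ℕ.+-suc fuel j) eq)
            (ℕ.≤-trans (∪-card J I) (ℕ.≤-trans (ℕ.+-mono-≤ c small) (ℕ.≤-reflexive (ℕ.+-comm (j ℕ.* D) D))))
            (slack e ⊞ slack (<⇒≤ (≰⇒> bad)) by lem₂ P (+ R) (total J fs) (total (J ∪ₘ I) fs) (+ j))
    ... | no none = J , ℕ.≤-trans c (ℕ.*-monoˡ-≤ D (ℕ.≤-trans (ℕ.m≤n+m j (suc fuel)) (ℕ.≤-reflexive eq))) , stable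
      where
      stable : Stable D R fs J
      stable I small {f} f∈ with + R * (total (J ∪ₘ I) fs - total J fs) ≤? P
      ... | no bad = ⊥-elim (none (I , small , bad))
      ... | yes ok = slack ok ⊞ (0≤+ {R} ⊠ slack (energy-gap≤total-gap J (J ∪ₘ I) fs (∪-left J I) f∈))
        by lem₃ P (+ R) (energy (J ∪ₘ I) f - energy J f) (total (J ∪ₘ I) fs - total J fs)

-- Arithmetic modulo p and the distribution of linear forms.

module Residues (q : ℕ) (pr : Prime (suc q)) where

  open import Data.Integer using (ℤ; +_; -_; _+_; _*_; _-_; _≤_; _<_; 0ℤ; 1ℤ; +≤+; +<+; -[1+_]; -≤+; Positive)
  open import Data.Integer.Properties
  open import Data.Integer.Tactic.RingSolver using (solve-∀)
  open import Data.List.Membership.Propositional using (_∈_; find)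
  open Counting
  open Density

  p : ℕ
  p = suc q

  infix 4 _≈_ _≉_

  -- A record, so that `a` and `b` can be inferred from a proof; the bare equation of remainders
  -- does not determine them.
  record _≈_ (a b : ℕ) : Set where
    constructor mod≡
    field %-≡ : a % p ≡ b % p

  open _≈_

  _≉_ : ℕ → ℕ → Set
  a ≉ b = ¬ (a ≈ b)

  ≡⇒≈ : ∀ {a b} → a ≡ b → a ≈ b
  ≡⇒≈ refl = mod≡ refl

  ≈-refl : ∀ {a} → a ≈ a
  ≈-refl = mod≡ refl

  ≈-sym : ∀ {a b} → a ≈ b → b ≈ a
  ≈-sym (mod≡ h) = mod≡ (sym h)

  ≈-trans : ∀ {a b c} → a ≈ b → b ≈ c → a ≈ c
  ≈-trans (mod≡ h) (mod≡ k) = mod≡ (trans h k)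

  ≈-+ : ∀ {a b c d} → a ≈ b → c ≈ d → a ℕ.+ c ≈ b ℕ.+ d
  ≈-+ {a} {b} {c} {d} (mod≡ h) (mod≡ k) = mod≡ (trans (%-distribˡ-+ a c p) (trans (cong₂ (λ u v → (u ℕ.+ v) % p) h k) (sym (%-distribˡ-+ b d p))))

  ≈-* : ∀ {a b c d} → a ≈ b → c ≈ d → a ℕ.* c ≈ b ℕ.* d
  ≈-* {a} {b} {c} {d} (mod≡ h) (mod≡ k) = mod≡ (trans (%-distribˡ-* a c p) (trans (cong₂ (λ u v → (u ℕ.* v) % p) h k) (sym (%-distribˡ-* b d p))))

  %-≈ : ∀ a → a % p ≈ a
  %-≈ a = mod≡ (m%n%n≡m%n a p)

  +kp : ∀ a k → a ℕ.+ k ℕ.* p ≈ a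
  +kp a k = mod≡ ([m+kn]%n≡m%n a k p)

  -- Multiplication by q = p − 1 is negation modulo p.
  +q*-cancel : ∀ a c → a ℕ.+ c ℕ.+ q ℕ.* c ≈ a
  +q*-cancel a c = ≈-trans (≡⇒≈ (lem a c q)) (+kp a c)
    where
    lem : ∀ a c q → a ℕ.+ c ℕ.+ q ℕ.* c ≡ a ℕ.+ c ℕ.* (1 ℕ.+ q)
    lem = solveℕ

  ≈-cancelʳ : ∀ {a b} c → a ℕ.+ c ≈ b ℕ.+ c → a ≈ b
  ≈-cancelʳ {a} {b} c h = ≈-trans (≈-sym (+q*-cancel a c)) (≈-trans (≈-+ h ≈-refl) (+q*-cancel b c))

  ≈-cancelˡ : ∀ {a b} c → c ℕ.+ a ≈ c ℕ.+ b → a ≈ b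
  ≈-cancelˡ {a} {b} c h = ≈-cancelʳ c (≈-trans (≡⇒≈ (ℕ.+-comm a c)) (≈-trans h (≡⇒≈ (ℕ.+-comm c b))))

  inverse : ∀ a → a ≉ 0 → ∃ λ b → b ℕ.* a ≈ 1
  inverse a a≉0 = go (coprime-Bézout (prime⇒coprime pr {{ℕ.≢-nonZero (a≉0 ∘ mod≡)}} (m%n<n a p)))
    where
    a′ = a % p
    lem : ∀ q y a → 1 ℕ.+ q ℕ.* (1 ℕ.+ y ℕ.* a) ≡ (q ℕ.* y ℕ.* a) ℕ.+ 1 ℕ.* (1 ℕ.+ q)
    lem = solveℕ
    lem′ : ∀ q x p → 1 ℕ.+ q ℕ.* (x ℕ.* p) ≡ 1 ℕ.+ q ℕ.* x ℕ.* p
    lem′ = solveℕ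
    go : Bézout.Identity 1 p a′ → ∃ λ b → b ℕ.* a ≈ 1
    -- In this case `y` is minus the inverse, hence the factor `q`.
    go (Bézout.+- x y eq) = q ℕ.* y ,
      ≈-trans (≈-* (≈-refl {q ℕ.* y}) (≈-sym (%-≈ a)))
      (≈-trans (≈-sym (+kp (q ℕ.* y ℕ.* a′) 1))
      (≈-trans (≡⇒≈ (sym (lem q y a′)))
      (≈-trans (≡⇒≈ (cong (λ u → 1 ℕ.+ q ℕ.* u) eq)) (≈-trans (≡⇒≈ (lem′ q x p)) (+kp 1 (q ℕ.* x))))))
    go (Bézout.-+ x y eq) = y ,
      ≈-trans (≈-* (≈-refl {y}) (≈-sym (%-≈ a))) (≈-trans (≡⇒≈ (sym eq)) (+kp 1 x))

  eqm : ℕ → ℕ → Bool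
  eqm a b = (a % p) ≡ᵇ (b % p)

  eqm⇒≈ : ∀ {a b} → eqm a b ≡ true → a ≈ b
  eqm⇒≈ {a} {b} h = mod≡ (ℕ.≡ᵇ⇒≡ (a % p) (b % p) (Equivalence.from T-≡ h))

  ≈⇒eqm : ∀ {a b} → a ≈ b → eqm a b ≡ true
  ≈⇒eqm {a} {b} h = Equivalence.to T-≡ (ℕ.≡⇒≡ᵇ (a % p) (b % p) (%-≡ h))

  eqm-false : ∀ {a b} → eqm a b ≡ false → a ≉ b
  eqm-false {a} {b} e h with () ← trans (sym e) (≈⇒eqm {a} {b} h)

  ≉⇒eqm : ∀ {a b} → a ≉ b → eqm a b ≡ false
  ≉⇒eqm {a} {b} h with eqm a b in e
  ... | false = refl
  ... | true = ⊥-elim (h (eqm⇒≈ {a} {b} e))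

  bool-ext : ∀ {a b} → (a ≡ true → b ≡ true) → (b ≡ true → a ≡ true) → a ≡ b
  bool-ext {true} f g = sym (f refl)
  bool-ext {false} {true} f g = g refl
  bool-ext {false} {false} f g = refl

  eqm-cong : ∀ {a b c d} → a ≈ b → c ≈ d → eqm a c ≡ eqm b d
  eqm-cong h k = cong₂ _≡ᵇ_ (%-≡ h) (%-≡ k)

  _≈?_ : ∀ a b → Dec (a ≈ b)
  a ≈? b = map′ mod≡ %-≡ (a % p ℕ.≟ b % p)

  -- Cauchy–Davenport for two-element sets

  count : ℕ → (ℕ → Bool) → ℕ
  count zero S = 0
  count (suc k) S = count k S ℕ.+ (if S k then 1 else 0)

  count-grow : ∀ k S S′ → (∀ a → S a ≡ true → S′ a ≡ true) → count k S ℕ.≤ count k S′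
  count-grow zero S S′ h = z≤n
  count-grow (suc k) S S′ h = ℕ.+-mono-≤ (count-grow k S S′ h) (go (S k) (S′ k) (h k))
    where
    go : ∀ b b′ → (b ≡ true → b′ ≡ true) → (if b then 1 else 0) ℕ.≤ (if b′ then 1 else 0)
    go false _ _ = z≤n
    go true b′ h rewrite h refl = ℕ.≤-refl

  count-strict : ∀ k S S′ a → (∀ a → S a ≡ true → S′ a ≡ true) → a ℕ.< k → S a ≡ false → S′ a ≡ true →
    count k S ℕ.< count k S′
  count-strict (suc k) S S′ a h a<sk f t with ℕ.m<1+n⇒m<n∨m≡n a<sk
  ... | inj₁ a<k = ℕ.+-mono-<-≤ (count-strict k S S′ a h a<k f t) (ℕ.+-cancelˡ-≤ 0 _ _ (count-grow′ k))
    where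
    count-grow′ : ∀ k → (if S k then 1 else 0) ℕ.≤ (if S′ k then 1 else 0)
    count-grow′ k with S k in e
    ... | false = z≤n
    ... | true rewrite h k e = ℕ.≤-refl
  ... | inj₂ refl rewrite f | t = ℕ.+-mono-≤-< (count-grow k S S′ h) (s≤s z≤n)

  count≤ : ∀ k S → count k S ℕ.≤ k
  count≤ zero S = z≤n
  count≤ (suc k) S with S k
  ... | true = ℕ.≤-trans (ℕ.+-monoˡ-≤ 1 (count≤ k S)) (ℕ.≤-reflexive (ℕ.+-comm k 1))
  ... | false = ℕ.≤-trans (ℕ.+-monoˡ-≤ 0 (count≤ k S)) (ℕ.≤-trans (ℕ.≤-reflexive (ℕ.+-identityʳ k)) (ℕ.n≤1+n k))

  count-full : ∀ k S → k ℕ.≤ count k S → ∀ a → a ℕ.< k → S a ≡ true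
  count-full (suc k) S h a a<sk with S k in e
  ... | false = ⊥-elim (ℕ.<-irrefl refl (ℕ.≤-trans h (ℕ.≤-trans (ℕ.≤-reflexive (ℕ.+-identityʳ _)) (count≤ k S))))
  ... | true with ℕ.m<1+n⇒m<n∨m≡n a<sk
  ...   | inj₁ a<k = count-full k S (ℕ.s≤s⁻¹ (ℕ.≤-trans h (ℕ.≤-reflexive (ℕ.+-comm _ 1)))) a a<k
  ...   | inj₂ refl = e

  Periodic : {A : Set} → (ℕ → A) → Set
  Periodic S = ∀ {a b} → a ≈ b → S a ≡ S b

  -- As `α` is invertible modulo p, some multiple of `α` leads from `a` to `r`, namely (r - a) / α
  -- times `α`; closure then leads back from `r` to `a`.
  shift-closed⇒full : ∀ (S : ℕ → Bool) → Periodic S → ∀ α r → α ≉ 0 → S r ≡ true →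
    (∀ a → S (a ℕ.+ α) ≡ true → S a ≡ true) → ∀ a → S a ≡ true
  shift-closed⇒full S per α r α≉0 Sr closed a =
    back (b ℕ.* (r ℕ.+ q ℕ.* a)) a (trans (per eq) Sr)
    where
    b = proj₁ (inverse α α≉0)
    back : ∀ j a → S (a ℕ.+ j ℕ.* α) ≡ true → S a ≡ true
    back zero a h = trans (cong S (sym (ℕ.+-identityʳ a))) h
    back (suc j) a h = closed a (back j (a ℕ.+ α) (trans (cong S (ℕ.+-assoc a α (j ℕ.* α))) h))
    lem : ∀ a b c α → a ℕ.+ b ℕ.* c ℕ.* α ≡ a ℕ.+ c ℕ.* (b ℕ.* α)
    lem = solveℕ
    lem′ : ∀ a r x → a ℕ.+ (r ℕ.+ x) ℕ.* 1 ≡ r ℕ.+ a ℕ.+ x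
    lem′ = solveℕ
    eq : a ℕ.+ b ℕ.* (r ℕ.+ q ℕ.* a) ℕ.* α ≈ r
    eq = ≈-trans (≡⇒≈ (lem a b (r ℕ.+ q ℕ.* a) α))
         (≈-trans (≈-+ (≈-refl {a}) (≈-* (≈-refl {r ℕ.+ q ℕ.* a}) (proj₂ (inverse α α≉0))))
         (≈-trans (≡⇒≈ (lem′ a r (q ℕ.* a))) (+q*-cancel r a)))

  -- The starting values from which adding some of the `αs` leads to `r`, that is, `r` minus the set
  -- of subset sums.
  reach : List ℕ → ℕ → ℕ → Bool
  reach [] r a = eqm a r
  reach (α ∷ αs) r a = reach αs r a ∨ reach αs r (a ℕ.+ α)

  reach-periodic : ∀ αs r → Periodic (reach αs r)
  reach-periodic [] r h = eqm-cong h (≈-refl {r})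
  reach-periodic (α ∷ αs) r {a} {b} h = cong₂ _∨_ (reach-periodic αs r h) (reach-periodic αs r (≈-+ h (≈-refl {α})))

  reach-self : ∀ αs r → reach αs r r ≡ true
  reach-self [] r = ≈⇒eqm (≈-refl {r})
  reach-self (α ∷ αs) r rewrite reach-self αs r = refl

  Nonzero : ℕ → Set
  Nonzero a = a ≉ 0

  -- If a non-zero `α` added no new starting value, the set would be closed under subtraction of `α`
  -- and hence be everything. So each coefficient contributes at least one new value until the set
  -- is full.
  reach-count : ∀ αs r → All Nonzero αs → p ℕ.≤ count p (reach αs r) ⊎ suc (length αs) ℕ.≤ count p (reach αs r)
  reach-count [] r [] = inj₂ (ℕ.≤-trans (s≤s z≤n) (count-strict p (λ _ → false) (reach [] r) (r % p) (λ _ ()) (m%n<n r p) refl (≈⇒eqm (%-≈ r))))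
  reach-count (α ∷ αs) r (α≉0 ∷ nz) with reach-count αs r nz
  ... | inj₁ full = inj₁ (ℕ.≤-trans full (count-grow p S S′ incl))
    where
    S = reach αs r
    S′ = reach (α ∷ αs) r
    incl : ∀ a → S a ≡ true → S′ a ≡ true
    incl a h rewrite h = refl
  ... | inj₂ big with ℕ.anyUpTo? (λ a → (reach αs r a ≟ᵇ false) ×-dec (reach αs r (a ℕ.+ α) ≟ᵇ true)) p
  ...   | yes (a , a<p , f , t) = inj₂ (ℕ.≤-trans (s≤s big) (count-strict p S S′ a incl a<p f new))
    where
    S = reach αs r
    S′ = reach (α ∷ αs) r
    incl : ∀ a → S a ≡ true → S′ a ≡ true
    incl a h rewrite h = refl
    new : S′ a ≡ true
    new rewrite f = t
  ...   | no none = inj₁ (all-count p S′ (λ a → incl a (full a)))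
    where
    S = reach αs r
    S′ = reach (α ∷ αs) r
    incl : ∀ a → S a ≡ true → S′ a ≡ true
    incl a h rewrite h = refl
    closed′ : ∀ a → a ℕ.< p → S (a ℕ.+ α) ≡ true → S a ≡ true
    closed′ a a<p h with S a in e
    ... | true = refl
    ... | false = ⊥-elim (none (a , a<p , e , h))
    closed : ∀ a → S (a ℕ.+ α) ≡ true → S a ≡ true
    closed a h = trans (reach-periodic αs r (≈-sym (%-≈ a)))
      (closed′ (a % p) (m%n<n a p) (trans (reach-periodic αs r (≈-+ (%-≈ a) (≈-refl {α}))) h))
    full : ∀ a → S a ≡ true
    full = shift-closed⇒full S (reach-periodic αs r) α r α≉0 (reach-self αs r) closed
    all-count : ∀ k S → (∀ a → S a ≡ true) → k ℕ.≤ count k S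
    all-count zero S h = z≤n
    all-count (suc k) S h rewrite h k = ℕ.≤-trans (ℕ.≤-reflexive (ℕ.+-comm 1 k)) (ℕ.+-monoˡ-≤ 1 (all-count k S h))

  reach-all : ∀ αs → All Nonzero αs → q ℕ.≤ length αs → ∀ r a → reach αs r a ≡ true
  reach-all αs nz long r a = trans (reach-periodic αs r (≈-sym (%-≈ a)))
    (count-full p (reach αs r) (go (reach-count αs r nz)) (a % p) (m%n<n a p))
    where
    go : p ℕ.≤ count p (reach αs r) ⊎ suc (length αs) ℕ.≤ count p (reach αs r) → p ℕ.≤ count p (reach αs r)
    go (inj₁ h) = h
    go (inj₂ h) = ℕ.≤-trans (s≤s long) h

  -- Equidistribution of a form of large weight

  -- The sum of `F` over `a` plus all subset sums of `αs`; for the non-zero coefficients of a form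
  -- these are the values of the form on the cube.
  W : List ℕ → (ℕ → ℤ) → ℕ → ℤ
  W [] F a = F a
  W (α ∷ αs) F a = W αs F a + W αs F (a ℕ.+ α)

  W-periodic : ∀ αs {F} → Periodic F → Periodic (W αs F)
  W-periodic [] per h = per h
  W-periodic (α ∷ αs) per h = cong₂ _+_ (W-periodic αs per h) (W-periodic αs per (≈-+ h (≈-refl {α})))

  W-++ : ∀ β γ F a → W (β ++ γ) F a ≡ W β (W γ F) a
  W-++ [] γ F a = refl
  W-++ (b ∷ β) γ F a = cong₂ _+_ (W-++ β γ F a) (W-++ β γ F (a ℕ.+ b))

  Range : (ℕ → ℤ) → ℤ → ℤ → Set
  Range F lo hi = ∀ a → (lo ≤ F a) × (F a ≤ hi)

  W-range : ∀ αs {F lo hi} → Range F lo hi → Range (W αs F) (pow2 (length αs) * lo) (pow2 (length αs) * hi)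
  W-range [] {F} {lo} {hi} r a = ≤-trans (≤-reflexive (*-identityˡ lo)) (proj₁ (r a)) , ≤-trans (proj₂ (r a)) (≤-reflexive (sym (*-identityˡ hi)))
  W-range (α ∷ αs) {F} {lo} {hi} r a =
    ≤-trans (≤-reflexive (double lo)) (+-mono-≤ (proj₁ (W-range αs r a)) (proj₁ (W-range αs r (a ℕ.+ α)))) ,
    ≤-trans (+-mono-≤ (proj₂ (W-range αs r a)) (proj₂ (W-range αs r (a ℕ.+ α)))) (≤-reflexive (sym (double hi)))
    where
    l = length αs
    double : ∀ c → pow2 (suc l) * c ≡ pow2 l * c + pow2 l * c
    double c = trans (cong (_* c) (pow2-suc l)) (*-distribʳ-+ c (pow2 l) (pow2 l))

  -- One of the 2^|αs| terms of W αs F a is F r.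
  W-reach-range : ∀ αs {F lo hi} → Periodic F → Range F lo hi → ∀ r a → reach αs r a ≡ true →
    ((pow2 (length αs) - 1ℤ) * lo + F r ≤ W αs F a) × (W αs F a ≤ (pow2 (length αs) - 1ℤ) * hi + F r)
  W-reach-range [] {F} {lo} {hi} per ran r a h =
    ≤-reflexive (trans (lem lo (F r)) (sym eq)) , ≤-reflexive (trans eq (sym (lem hi (F r))))
    where
    eq : F a ≡ F r
    eq = per (eqm⇒≈ {a} {r} h)
    lem : ∀ c f → (1ℤ - 1ℤ) * c + f ≡ f
    lem = solve-∀
  W-reach-range (α ∷ αs) {F} {lo} {hi} per ran r a h = go (reach αs r a) refl
    where
    l = length αs
    ra = W-range αs ran a
    rb = W-range αs ran (a ℕ.+ α)
    split : ∀ c → (pow2 (suc l) - 1ℤ) * c + F r ≡ ((pow2 l - 1ℤ) * c + F r) + pow2 l * c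
    split c = trans (cong (λ u → (u - 1ℤ) * c + F r) (pow2-suc l)) (lem (pow2 l) c (F r))
      where
      lem : ∀ P c f → ((P + P) - 1ℤ) * c + f ≡ ((P - 1ℤ) * c + f) + P * c
      lem = solve-∀
    go : ∀ b → reach αs r a ≡ b →
      ((pow2 (suc l) - 1ℤ) * lo + F r ≤ W αs F a + W αs F (a ℕ.+ α)) × (W αs F a + W αs F (a ℕ.+ α) ≤ (pow2 (suc l) - 1ℤ) * hi + F r)
    go true e = let (x , y) = W-reach-range αs per ran r a e in
      ≤-trans (≤-reflexive (split lo)) (+-mono-≤ x (proj₁ rb)) ,
      ≤-trans (+-mono-≤ y (proj₂ rb)) (≤-reflexive (sym (split hi)))
    go false e = let (x , y) = W-reach-range αs per ran r (a ℕ.+ α) (trans (cong (_∨ reach αs r (a ℕ.+ α)) (sym e)) h) in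
      ≤-trans (≤-reflexive (trans (split lo) (+-comm ((pow2 l - 1ℤ) * lo + F r) (pow2 l * lo)))) (+-mono-≤ (proj₁ ra) x) ,
      ≤-trans (+-mono-≤ (proj₂ ra) y) (≤-reflexive (sym (trans (split hi) (+-comm ((pow2 l - 1ℤ) * hi + F r) (pow2 l * hi)))))

  u : ℕ
  u = 2 ℕ.^ q ℕ.∸ 1

  1+u : suc u ≡ 2 ℕ.^ q
  1+u = ℕ.m+[n∸m]≡n (ℕ.m^n>0 2 q)

  +u : + u ≡ pow2 q - 1ℤ
  +u = trans (lem (+ u)) (cong (λ v → + v - 1ℤ) 1+u)
    where
    lem : ∀ x → x ≡ (1ℤ + x) - 1ℤ
    lem = solve-∀

  -- A block of `q` non-zero coefficients reaches 0 from every starting value. Hence all sums over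
  -- the block have one of their 2^q terms in common, and only the other `u` terms contribute to the
  -- width of the range. Each of the `e` leftover coefficients merely doubles the width.
  W-contract : ∀ M e γ → All Nonzero γ → length γ ≡ M ℕ.* q ℕ.+ e → ∀ {F lo hi} → Periodic F → Range F lo hi →
    ∃ λ lo′ → ∃ λ hi′ → Range (W γ F) lo′ hi′ × hi′ - lo′ ≡ + (u ℕ.^ M ℕ.* 2 ℕ.^ e) * (hi - lo)
  W-contract zero e γ nz refl {F} {lo} {hi} per ran =
    pow2 (length γ) * lo , pow2 (length γ) * hi , W-range γ ran ,
    trans (lem (pow2 e) lo hi) (cong (λ v → + v * (hi - lo)) (sym (ℕ.+-identityʳ (2 ℕ.^ e))))
    where
    lem : ∀ P a b → P * b - P * a ≡ P * (b - a)
    lem = solve-∀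
  W-contract (suc M) e γ nz len {F} {lo} {hi} per ran
    with W-contract M e (drop q γ) (All.drop⁺ q nz)
           (trans (length-drop q γ) (trans (cong (ℕ._∸ q) (trans len (ℕ.+-assoc q (M ℕ.* q) e))) (ℕ.m+n∸m≡n q (M ℕ.* q ℕ.+ e)))) per ran
  ... | lo′ , hi′ , ran′ , width =
    (pow2 q - 1ℤ) * lo′ + G 0 , (pow2 q - 1ℤ) * hi′ + G 0 , ran″ ,
    trans (lem (pow2 q - 1ℤ) lo′ hi′ (G 0))
    (trans (cong₂ _*_ (sym +u) width)
    (trans (sym (*-assoc (+ u) (+ (u ℕ.^ M ℕ.* 2 ℕ.^ e)) (hi - lo)))
      (cong (_* (hi - lo)) (trans (sym (pos-* u (u ℕ.^ M ℕ.* 2 ℕ.^ e))) (cong +_ (sym (ℕ.*-assoc u (u ℕ.^ M) (2 ℕ.^ e))))))))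
    where
    β = take q γ
    G = W (drop q γ) F
    lenβ : length β ≡ q
    lenβ = trans (length-take q γ) (ℕ.m≤n⇒m⊓n≡m (ℕ.≤-trans (ℕ.m≤m+n q (M ℕ.* q ℕ.+ e)) (ℕ.≤-reflexive (sym (trans len (ℕ.+-assoc q (M ℕ.* q) e))))))
    lem : ∀ P a b g → (P * b + g) - (P * a + g) ≡ P * (b - a)
    lem = solve-∀
    eq : ∀ a → W β G a ≡ W γ F a
    eq a = trans (sym (W-++ β (drop q γ) F a)) (cong (λ δ → W δ F a) (take++drop≡id q γ))
    ran″ : Range (W γ F) ((pow2 q - 1ℤ) * lo′ + G 0) ((pow2 q - 1ℤ) * hi′ + G 0)
    ran″ a = let (x , y) = W-reach-range β (W-periodic (drop q γ) per) ran′ 0 a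
                             (reach-all β (All.take⁺ q nz) (ℕ.≤-reflexive (sym lenβ)) 0 a) in
      subst₂ (λ v w → (pow2 v - 1ℤ) * lo′ + G 0 ≤ w) lenβ (eq a) x ,
      subst₂ (λ v w → w ≤ (pow2 v - 1ℤ) * hi′ + G 0) lenβ (eq a) y

  -- Coefficients are natural numbers read modulo p, so that combinations of forms need no
  -- reduction.
  NForm : ℕ → Set
  NForm = Vec ℕ

  nsum : ∀ {n} → NForm n → Cube n → ℕ
  nsum [] [] = 0
  nsum (a ∷ α) (false ∷ x) = nsum α x
  nsum (a ∷ α) (true ∷ x) = a ℕ.+ nsum α x

  wt zeros : ∀ {n} → NForm n → ℕ
  wt [] = 0
  wt (a ∷ α) = (if eqm a 0 then 0 else 1) ℕ.+ wt α
  zeros [] = 0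
  zeros (a ∷ α) = (if eqm a 0 then 1 else 0) ℕ.+ zeros α

  support : ∀ {n} → NForm n → List ℕ
  support [] = []
  support (a ∷ α) = if eqm a 0 then support α else a ∷ support α

  support-nonzero : ∀ {n} (α : NForm n) → All Nonzero (support α)
  support-nonzero [] = []
  support-nonzero (a ∷ α) with eqm a 0 in e
  ... | true = support-nonzero α
  ... | false = eqm-false {a} {0} e ∷ support-nonzero α

  length-support : ∀ {n} (α : NForm n) → length (support α) ≡ wt α
  length-support [] = refl
  length-support (a ∷ α) with eqm a 0
  ... | true = length-support α
  ... | false = cong suc (length-support α)

  zeros+wt : ∀ {n} (α : NForm n) → zeros α ℕ.+ wt α ≡ n
  zeros+wt [] = refl
  zeros+wt (a ∷ α) with eqm a 0
  ... | true = cong suc (zeros+wt α)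
  ... | false = trans (ℕ.+-suc (zeros α) (wt α)) (cong suc (zeros+wt α))

  Σc-form : ∀ {n} (α : NForm n) F → Periodic F → ∀ b → Σc (λ x → F (b ℕ.+ nsum α x)) ≡ pow2 (zeros α) * W (support α) F b
  Σc-form [] F per b = trans (cong F (ℕ.+-identityʳ b)) (sym (*-identityˡ (F b)))
  Σc-form (a ∷ α) F per b = trans (cong₂ _+_ (Σc-form α F per b)
      (trans (Σc-cong (λ x → cong F (sym (ℕ.+-assoc b a (nsum α x))))) (Σc-form α F per (b ℕ.+ a)))) rest
    where
    Z = pow2 (zeros α)
    rest : Z * W (support α) F b + Z * W (support α) F (b ℕ.+ a) ≡ pow2 (zeros (a ∷ α)) * W (support (a ∷ α)) F b
    rest with eqm a 0 in e
    ... | false = sym (*-distribˡ-+ Z (W (support α) F b) (W (support α) F (b ℕ.+ a)))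
    ... | true = trans (cong (λ v → Z * W (support α) F b + Z * v)
                    (W-periodic (support α) per (≈-trans (≈-+ (≈-refl {b}) (eqm⇒≈ {a} {0} e)) (≡⇒≈ (ℕ.+-identityʳ b)))))
                 (trans (sym (*-distribʳ-+ (W (support α) F b) Z Z)) (cong (_* W (support α) F b) (sym (pow2-suc (zeros α)))))

  #sol : ∀ {n} → NForm n → ℕ → ℤ
  #sol α e = Σc (λ x → ⟦ eqm (nsum α x) e ⟧)

  Σr-eqm : ∀ y → Σr p (λ e → ⟦ eqm y e ⟧) ≡ 1ℤ
  Σr-eqm y = ones p (ℕ.≤-refl) (m%n<n y p)
    where
    nones : ∀ k → k ℕ.≤ p → k ℕ.≤ y % p → Σr k (λ e → ⟦ eqm y e ⟧) ≡ 0ℤ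
    nones zero _ _ = refl
    nones (suc k) k<p k<y = cong₂ _+_ (nones k (ℕ.<⇒≤ k<p) (ℕ.<⇒≤ k<y))
      (cong ⟦_⟧ (≉⇒eqm {y} {k} (λ h → ℕ.<⇒≢ k<y (trans (sym (m<n⇒m%n≡m k<p)) (sym (_≈_.%-≡ h))))))
    ones : ∀ k → k ℕ.≤ p → y % p ℕ.< k → Σr k (λ e → ⟦ eqm y e ⟧) ≡ 1ℤ
    ones (suc k) k<p y<sk with ℕ.m<1+n⇒m<n∨m≡n y<sk
    ... | inj₁ y<k = cong₂ _+_ (ones k (ℕ.<⇒≤ k<p) y<k)
      (cong ⟦_⟧ (≉⇒eqm {y} {k} (λ h → ℕ.<⇒≢ y<k (trans (_≈_.%-≡ h) (m<n⇒m%n≡m k<p)))))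
    ... | inj₂ refl = cong₂ _+_ (nones (y % p) (ℕ.<⇒≤ k<p) ℕ.≤-refl) (cong ⟦_⟧ (≈⇒eqm {y} {y % p} (≈-sym (%-≈ y))))

  Σr-# : ∀ {n} (α : NForm n) → Σr p (λ e → #sol α e) ≡ pow2 n
  Σr-# {n} α = trans (sym (Σc-Σr p (λ e x → ⟦ eqm (nsum α x) e ⟧)))
    (trans (Σc-cong (λ x → Σr-eqm (nsum α x))) (trans (Σc-const n 1ℤ) (*-identityˡ (pow2 n))))

  q-positive : 1 ℕ.≤ q
  q-positive = ℕ.s≤s⁻¹ (ℕ.nonTrivial⇒n>1 p {{prime⇒nonTrivial pr}})

  blocks : ℕ → ℕ
  blocks K = K ℕ.* u

  -- The factor `p` is there because `equidistribution` compares p times a count with 2^n.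
  far-weight : ℕ → ℕ
  far-weight K = blocks (p ℕ.* K) ℕ.* q

  u-positive : 1 ℕ.≤ u
  u-positive = ℕ.s≤s⁻¹ (ℕ.≤-trans (ℕ.^-monoʳ-≤ 2 q-positive) (ℕ.≤-reflexive (sym 1+u)))

  -- Bernoulli's inequality (1 + 1/v)^M ≥ 1 + M/v with denominators cleared. It shows without
  -- logarithms that `K * u` blocks shrink the range by the factor `K`.
  power-growth : ∀ v M → (M ℕ.+ v) ℕ.* v ℕ.^ M ℕ.≤ v ℕ.* suc v ℕ.^ M
  power-growth v zero = ℕ.≤-refl
  power-growth v (suc M) = ℕ.≤-trans (ℕ.m≤m+n _ (M ℕ.* v ℕ.^ M))
    (ℕ.≤-trans (ℕ.≤-reflexive (lem v M (v ℕ.^ M)))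
    (ℕ.≤-trans (ℕ.*-monoʳ-≤ (suc v) (power-growth v M)) (ℕ.≤-reflexive (lem′ v (suc v ℕ.^ M)))))
    where
    lem : ∀ v M x → (1 ℕ.+ M ℕ.+ v) ℕ.* (v ℕ.* x) ℕ.+ M ℕ.* x ≡ (1 ℕ.+ v) ℕ.* ((M ℕ.+ v) ℕ.* x)
    lem = solveℕ
    lem′ : ∀ v x → (1 ℕ.+ v) ℕ.* (v ℕ.* x) ≡ v ℕ.* ((1 ℕ.+ v) ℕ.* x)
    lem′ = solveℕ

  blocks-contract : ∀ K → K ℕ.* u ℕ.^ blocks K ℕ.≤ 2 ℕ.^ (blocks K ℕ.* q)
  blocks-contract K = ℕ.≤-trans (ℕ.*-cancelˡ-≤ u {{ℕ.>-nonZero u-positive}} (ℕ.≤-trans (ℕ.≤-reflexive (lem u K (u ℕ.^ M)))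
      (ℕ.≤-trans (ℕ.*-monoˡ-≤ (u ℕ.^ M) (ℕ.m≤m+n M u)) (power-growth u M))))
    (ℕ.≤-reflexive (trans (cong (ℕ._^ M) 1+u) (trans (ℕ.^-*-assoc 2 q M) (cong (2 ℕ.^_) (ℕ.*-comm q M)))))
    where
    M = blocks K
    lem : ∀ u K x → u ℕ.* (K ℕ.* x) ≡ K ℕ.* u ℕ.* x
    lem = solveℕ

  -- The counts for the different values lie in one short interval and add up to 2^n, so each is
  -- close to the average 2^n / p.
  equidistribution : ∀ {n} K (α : NForm n) → far-weight K ℕ.≤ wt α → ∀ e →
    (+ K * (+ p * #sol α e - pow2 n) ≤ pow2 n) × (+ K * (pow2 n - + p * #sol α e) ≤ pow2 n)
  equidistribution {n} K α big e
    with W-contract M f (support α) (support-nonzero α) len {F} {0ℤ} {1ℤ} per (λ a → 0≤⟦⟧ (eqm a 0) , ⟦⟧≤1 (eqm a 0))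
    where
    M = blocks (p ℕ.* K)
    f = wt α ℕ.∸ far-weight K
    F : ℕ → ℤ
    F a = ⟦ eqm a 0 ⟧
    per : Periodic F
    per h = cong ⟦_⟧ (eqm-cong h (≈-refl {0}))
    len : length (support α) ≡ M ℕ.* q ℕ.+ f
    len = trans (length-support α) (sym (ℕ.m+[n∸m]≡n big))
  ... | lo , hi , ran , width = upper , lower
    where
    M = blocks (p ℕ.* K)
    f = wt α ℕ.∸ far-weight K
    Z = pow2 (zeros α)
    F : ℕ → ℤ
    F a = ⟦ eqm a 0 ⟧
    per : Periodic F
    per h = cong ⟦_⟧ (eqm-cong h (≈-refl {0}))
    -- Since `q * e` is minus `e`, all counts are read off from one function at different starting
    -- values.
    move : ∀ x e → eqm (nsum α x) e ≡ eqm (q ℕ.* e ℕ.+ nsum α x) 0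
    move x e = bool-ext
      (λ h → ≈⇒eqm (≈-trans (≈-+ (≈-refl {q ℕ.* e}) (eqm⇒≈ {nsum α x} {e} h)) (≈-trans (≡⇒≈ (ℕ.+-comm (q ℕ.* e) e)) (+q*-cancel 0 e))))
      (λ h → ≈⇒eqm (≈-cancelˡ (q ℕ.* e) (≈-trans (eqm⇒≈ {q ℕ.* e ℕ.+ nsum α x} {0} h)
               (≈-sym (≈-trans (≡⇒≈ (ℕ.+-comm (q ℕ.* e) e)) (+q*-cancel 0 e))))))
    value : ∀ e → #sol α e ≡ Z * W (support α) F (q ℕ.* e)
    value e = trans (Σc-cong (λ x → cong ⟦_⟧ (move x e))) (Σc-form α F per (q ℕ.* e))
    nonneg-Z : 0ℤ ≤ Z
    nonneg-Z = 0≤+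
    l₁ : ∀ Z a b → Z * b - Z * a ≡ Z * (b - a)
    l₁ = solve-∀
    above : ∀ e → Z * lo ≤ #sol α e
    above e = subst (Z * lo ≤_) (sym (value e)) (nonneg-Z ⊠ slack (proj₁ (ran (q ℕ.* e))) by l₁ Z lo (W (support α) F (q ℕ.* e)))
    below : ∀ e → #sol α e ≤ Z * hi
    below e = subst (_≤ Z * hi) (sym (value e)) (nonneg-Z ⊠ slack (proj₂ (ran (q ℕ.* e))) by l₁ Z (W (support α) F (q ℕ.* e)) hi)
    avg-lo : + p * (Z * lo) ≤ pow2 n
    avg-lo = subst₂ _≤_ (Σr-const p (Z * lo)) (Σr-# α) (Σr-mono p (λ e _ → above e))
    avg-hi : pow2 n ≤ + p * (Z * hi)
    avg-hi = subst₂ _≤_ (Σr-# α) (Σr-const p (Z * hi)) (Σr-mono p (λ e _ → below e))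
    total-exp : zeros α ℕ.+ (M ℕ.* q ℕ.+ f) ≡ n
    total-exp = trans (cong (zeros α ℕ.+_) (ℕ.m+[n∸m]≡n big)) (zeros+wt α)
    small-ℕ : p ℕ.* K ℕ.* (2 ℕ.^ zeros α ℕ.* (u ℕ.^ M ℕ.* 2 ℕ.^ f)) ℕ.≤ 2 ℕ.^ n
    small-ℕ = ℕ.≤-trans (ℕ.≤-reflexive (rearrange (p ℕ.* K) (2 ℕ.^ zeros α) (u ℕ.^ M) (2 ℕ.^ f)))
      (ℕ.≤-trans (ℕ.*-monoʳ-≤ (2 ℕ.^ zeros α) (ℕ.*-monoˡ-≤ (2 ℕ.^ f) (blocks-contract (p ℕ.* K))))
      (ℕ.≤-reflexive (trans (cong (2 ℕ.^ zeros α ℕ.*_) (sym (ℕ.^-distribˡ-+-* 2 (M ℕ.* q) f)))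
        (trans (sym (ℕ.^-distribˡ-+-* 2 (zeros α) (M ℕ.* q ℕ.+ f))) (cong (2 ℕ.^_) total-exp)))))
      where
      rearrange : ∀ a z v w → a ℕ.* (z ℕ.* (v ℕ.* w)) ≡ z ℕ.* ((a ℕ.* v) ℕ.* w)
      rearrange = solveℕ
    small : + p * + K * (Z * (hi - lo)) ≤ pow2 n
    small = subst (_≤ pow2 n) (trans (pos-* (p ℕ.* K) (2 ℕ.^ zeros α ℕ.* (u ℕ.^ M ℕ.* 2 ℕ.^ f)))
        (cong₂ _*_ (pos-* p K) (trans (pos-* (2 ℕ.^ zeros α) (u ℕ.^ M ℕ.* 2 ℕ.^ f))
          (cong (Z *_) (sym (trans width (*-identityʳ (+ (u ℕ.^ M ℕ.* 2 ℕ.^ f))))))))) (+≤+ small-ℕ)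
    l₃ : ∀ K p N P Z lo hi → P - K * (p * N - P) ≡
      (P - p * K * (Z * (hi - lo))) + K * (p * (Z * hi - N) + (P - p * (Z * lo)))
    l₃ = solve-∀
    upper : + K * (+ p * #sol α e - pow2 n) ≤ pow2 n
    upper = slack small ⊞ (0≤+ {K} ⊠ ((0≤+ {p} ⊠ slack (below e)) ⊞ slack avg-lo))
      by l₃ (+ K) (+ p) (#sol α e) (pow2 n) Z lo hi
    l₄ : ∀ K p N P Z lo hi → P - K * (P - p * N) ≡
      (P - p * K * (Z * (hi - lo))) + K * (p * (N - Z * lo) + (p * (Z * hi) - P))
    l₄ = solve-∀
    lower : + K * (pow2 n - + p * #sol α e) ≤ pow2 n
    lower = slack small ⊞ (0≤+ {K} ⊠ ((0≤+ {p} ⊠ slack (above e)) ⊞ slack avg-hi))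
      by l₄ (+ K) (+ p) (#sol α e) (pow2 n) Z lo hi

  -- Almost pairwise independence of heavy forms.

  comb : ∀ {n} → NForm n → ℕ → NForm n → NForm n
  comb φ l c = zipWith (λ a b → a ℕ.+ l ℕ.* b) φ c

  nsum-comb : ∀ {n} (φ : NForm n) l c x → nsum (comb φ l c) x ≡ nsum φ x ℕ.+ l ℕ.* nsum c x
  nsum-comb [] l [] [] = sym (ℕ.*-zeroʳ l)
  nsum-comb (a ∷ φ) l (b ∷ c) (false ∷ x) = nsum-comb φ l c x
  nsum-comb (a ∷ φ) l (b ∷ c) (true ∷ x) = trans (cong (a ℕ.+ l ℕ.* b ℕ.+_) (nsum-comb φ l c x)) (lem a l b (nsum φ x) (nsum c x))
    where
    lem : ∀ a l b s t → a ℕ.+ l ℕ.* b ℕ.+ (s ℕ.+ l ℕ.* t) ≡ a ℕ.+ s ℕ.+ l ℕ.* (b ℕ.+ t)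
    lem = solveℕ

  comb-0 : ∀ {n} (φ c : NForm n) → comb φ 0 c ≡ φ
  comb-0 [] [] = refl
  comb-0 (a ∷ φ) (b ∷ c) = cong₂ _∷_ (ℕ.+-identityʳ a) (comb-0 φ c)

  -- The lines through a point cover the plane over F_p, so a pair of values is controlled by the
  -- values of single linear combinations.
  lines-cover : ∀ s t d e →
    + p * (⟦ eqm s d ⟧ * ⟦ eqm t e ⟧) + 1ℤ ≤ ⟦ eqm s d ⟧ + Σr p (λ l → ⟦ eqm (t ℕ.+ l ℕ.* s) (e ℕ.+ l ℕ.* d) ⟧)
  lines-cover s t d e with eqm s d in es | eqm t e in et
  ... | true | true = ≤-reflexive (trans (lem (+ p)) (cong (λ v → 1ℤ + v)
      (sym (trans (Σr-cong p (λ l _ → cong ⟦_⟧ (≈⇒eqm (≈-+ (eqm⇒≈ {t} {e} et) (≈-* (≈-refl {l}) (eqm⇒≈ {s} {d} es))))))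
                  (trans (Σr-const p 1ℤ) (*-identityʳ (+ p)))))))
    where
    lem : ∀ p → p * (1ℤ * 1ℤ) + 1ℤ ≡ 1ℤ + p
    lem = solve-∀
  ... | true | false = slack-nonneg
    where
    L = λ l → ⟦ eqm (t ℕ.+ l ℕ.* s) (e ℕ.+ l ℕ.* d) ⟧
    lem : ∀ p S → (1ℤ + S) - (p * (1ℤ * 0ℤ) + 1ℤ) ≡ S
    lem = solve-∀
    slack-nonneg : + p * (1ℤ * 0ℤ) + 1ℤ ≤ 1ℤ + Σr p L
    slack-nonneg = ≤-trans (0≤⟦⟧ (eqm (t ℕ.+ 0 ℕ.* s) (e ℕ.+ 0 ℕ.* d)))
      (Σr-term p L 0 (λ l _ → 0≤⟦⟧ (eqm (t ℕ.+ l ℕ.* s) (e ℕ.+ l ℕ.* d))) (s≤s z≤n)) by lem (+ p) (Σr p L)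
  ... | false | b = ≤-trans (≤-reflexive (lem (+ p) ⟦ b ⟧)) (≤-trans
      (≤-reflexive (cong ⟦_⟧ (sym (≈⇒eqm on-line))))
      (≤-trans (Σr-term p L l (λ l _ → 0≤⟦⟧ (eqm (t ℕ.+ l ℕ.* s) (e ℕ.+ l ℕ.* d))) (m%n<n l′ p)) (≤-reflexive (sym (+-identityˡ (Σr p L))))))
    where
    L = λ l → ⟦ eqm (t ℕ.+ l ℕ.* s) (e ℕ.+ l ℕ.* d) ⟧
    lem : ∀ p b → p * (0ℤ * b) + 1ℤ ≡ 1ℤ
    lem = solve-∀
    y = s ℕ.+ q ℕ.* d
    y≉0 : y ≉ 0
    y≉0 h = eqm-false {s} {d} es (≈-cancelʳ (q ℕ.* d) (≈-trans h (≈-sym (+q*-cancel 0 d))))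
    b′ = proj₁ (inverse y y≉0)
    -- The solution (e - t) / (s - d) of t + l s = e + l d.
    l′ = b′ ℕ.* (e ℕ.+ q ℕ.* t)
    l = l′ % p
    l*y : l ℕ.* y ≈ e ℕ.+ q ℕ.* t
    l*y = ≈-trans (≈-* (%-≈ l′) (≈-refl {y})) (≈-trans (≡⇒≈ (r₁ b′ (e ℕ.+ q ℕ.* t) y))
            (≈-trans (≈-* (≈-refl {e ℕ.+ q ℕ.* t}) (proj₂ (inverse y y≉0))) (≡⇒≈ (ℕ.*-identityʳ _))))
      where
      r₁ : ∀ b c y → b ℕ.* c ℕ.* y ≡ c ℕ.* (b ℕ.* y)
      r₁ = solveℕ
    r₂ : ∀ t l s q d → (t ℕ.+ l ℕ.* s) ℕ.+ (l ℕ.* (q ℕ.* d) ℕ.+ q ℕ.* t) ≡ l ℕ.* (s ℕ.+ q ℕ.* d) ℕ.+ t ℕ.+ q ℕ.* t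
    r₂ = solveℕ
    r₃ : ∀ e l d q t → (e ℕ.+ l ℕ.* d) ℕ.+ (l ℕ.* (q ℕ.* d) ℕ.+ q ℕ.* t) ≡ (e ℕ.+ q ℕ.* t) ℕ.+ l ℕ.* d ℕ.* (1 ℕ.+ q)
    r₃ = solveℕ
    on-line : t ℕ.+ l ℕ.* s ≈ e ℕ.+ l ℕ.* d
    on-line = ≈-cancelʳ (l ℕ.* (q ℕ.* d) ℕ.+ q ℕ.* t)
      (≈-trans (≡⇒≈ (r₂ t l s q d)) (≈-trans (+q*-cancel (l ℕ.* y) t) (≈-trans l*y
      (≈-sym (≈-trans (≡⇒≈ (r₃ e l d q t)) (+kp (e ℕ.+ q ℕ.* t) (l ℕ.* d)))))))

  balanced : ∀ {n} → NForm n → ℕ → Cube n → ℤ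
  balanced α d x = + p * ⟦ eqm (nsum α x) d ⟧ - 1ℤ

  -- `lines-cover`, summed over the cube, bounds the joint count by counts for `φ` and for the `p`
  -- combinations. The constant p + 3 collects one unit of error for each combination, two for `φ`,
  -- whose count is estimated from both sides, and one for `φ′`.
  almost-orthogonal : ∀ {n} K (φ φ′ : NForm n) → far-weight K ℕ.≤ wt φ → (∀ l → l ℕ.< p → far-weight K ℕ.≤ wt (comb φ′ l φ)) →
    ∀ d d′ → + K * Σc (λ x → balanced φ d x * balanced φ′ d′ x) ≤ (+ p + + 3) * pow2 n
  almost-orthogonal {n} K φ φ′ big far d d′ =
    ((((0≤+ {K} ⊠ 0≤+ {p}) ⊠ slack cover) ⊞ slack (proj₁ (equidistribution K φ big d))) ⊞ slack lines)
      ⊞ slack (proj₂ (equidistribution K φ big d)) ⊞ slack (proj₂ (equidistribution K φ′ big′ d′))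
    by trans (cong (λ v → (+ p + + 3) * P - + K * v) expand) (cert (+ K) (+ p) N N₁ N₂ S P)
    where
    P = pow2 n
    I₁ I₂ : Cube n → ℤ
    I₁ x = ⟦ eqm (nsum φ x) d ⟧
    I₂ x = ⟦ eqm (nsum φ′ x) d′ ⟧
    N = Σc (λ x → I₁ x * I₂ x)
    N₁ = #sol φ d
    N₂ = #sol φ′ d′
    L : ℕ → ℤ
    L l = #sol (comb φ′ l φ) (d′ ℕ.+ l ℕ.* d)
    S = Σr p L
    big′ : far-weight K ℕ.≤ wt φ′
    big′ = subst (λ v → far-weight K ℕ.≤ wt v) (comb-0 φ′ φ) (far 0 (s≤s z≤n))
    cover : + p * N + P ≤ N₁ + S
    cover = subst₂ _≤_
      (trans (Σc-+ (λ x → + p * (I₁ x * I₂ x)) (λ _ → 1ℤ))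
        (cong₂ _+_ (Σc-*ˡ (+ p) (λ x → I₁ x * I₂ x)) (trans (Σc-const n 1ℤ) (*-identityˡ P))))
      (trans (Σc-+ I₁ (λ x → Σr p (λ l → ⟦ eqm (nsum φ′ x ℕ.+ l ℕ.* nsum φ x) (d′ ℕ.+ l ℕ.* d) ⟧)))
        (cong (λ v → N₁ + v) (trans (Σc-Σr p (λ l x → ⟦ eqm (nsum φ′ x ℕ.+ l ℕ.* nsum φ x) (d′ ℕ.+ l ℕ.* d) ⟧))
          (Σr-cong p (λ l _ → Σc-cong (λ x → cong (λ v → ⟦ eqm v (d′ ℕ.+ l ℕ.* d) ⟧) (sym (nsum-comb φ′ l φ x))))))))
      (Σc-mono (λ x → lines-cover (nsum φ x) (nsum φ′ x) d d′))
    l₀ : ∀ K p M P → (K + 1ℤ) * P - K * p * M ≡ P - K * (p * M - P)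
    l₀ = solve-∀
    lines : + K * + p * S ≤ + p * ((+ K + 1ℤ) * P)
    lines = subst₂ _≤_ (Σr-*ˡ p (+ K * + p) L) (Σr-const p ((+ K + 1ℤ) * P))
      (Σr-mono p (λ l l<p → slack (proj₁ (equidistribution K (comb φ′ l φ) (far l l<p) (d′ ℕ.+ l ℕ.* d))) by l₀ (+ K) (+ p) (L l) P))
    expand : Σc (λ x → balanced φ d x * balanced φ′ d′ x) ≡ (+ p * + p * N - + p * N₁) + (P - + p * N₂)
    expand = trans (Σc-cong (λ x → e₁ (+ p) (I₁ x) (I₂ x)))
      (trans (Σc-+ (λ x → + p * + p * (I₁ x * I₂ x) + - (+ p) * I₁ x) (λ x → 1ℤ + - (+ p) * I₂ x))
      (trans (cong₂ _+_
        (trans (Σc-+ (λ x → + p * + p * (I₁ x * I₂ x)) (λ x → - (+ p) * I₁ x))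
          (cong₂ _+_ (Σc-*ˡ (+ p * + p) (λ x → I₁ x * I₂ x)) (Σc-*ˡ (- (+ p)) I₁)))
        (trans (Σc-+ (λ _ → 1ℤ) (λ x → - (+ p) * I₂ x))
          (cong₂ _+_ (trans (Σc-const n 1ℤ) (*-identityˡ P)) (Σc-*ˡ (- (+ p)) I₂))))
        (e₂ (+ p) N N₁ N₂ P)))
      where
      e₁ : ∀ p a b → (p * a - 1ℤ) * (p * b - 1ℤ) ≡ (p * p * (a * b) + - p * a) + (1ℤ + - p * b)
      e₁ = solve-∀
      e₂ : ∀ p N N₁ N₂ P → (p * p * N + - p * N₁) + (P + - p * N₂) ≡ (p * p * N - p * N₁) + (P - p * N₂)
      e₂ = solve-∀
    cert : ∀ K p N N₁ N₂ S P → (p + + 3) * P - K * ((p * p * N - p * N₁) + (P - p * N₂)) ≡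
      (((K * p) * (N₁ + S - (p * N + P)) + (P - K * (p * N₁ - P))) + (p * ((K + 1ℤ) * P) - K * p * S))
        + (P - K * (P - p * N₁)) + (P - K * (P - p * N₂))
    cert = solve-∀

  anyVec? : ∀ {k n} {P : Vec (Fin k) n → Set} → Decidable P → Dec (∃ P)
  anyVec? {n = zero} P? = map′ (λ h → [] , h) (λ { ([] , h) → h }) (P? [])
  anyVec? {n = suc n} P? = map′ (λ { (i , v , h) → i ∷ v , h }) (λ { (i ∷ v , h) → i , v , h })
    (Fin.any? (λ i → anyVec? (λ v → P? (i ∷ v))))

  toN : ∀ {n} → Form p n → NForm n
  toN = Vec.map toℕ

  indicator : ∀ {n} → CubeSet n → Cube n → ℤ
  indicator A x = ⟦ A x ⟧

  size : ∀ {n} → CubeSet n → ℤ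
  size A = Σc (indicator A)

  hits : ∀ {n} → CubeSet n → NForm n → ℕ → ℤ
  hits A α d = mass (indicator A) (λ x → eqm (nsum α x) d)

  Far : ∀ {n} → ℕ → NForm n → NForm n → Set
  Far D φ c = ∀ l → l ℕ.< p → D ℕ.≤ wt (comb φ l c)

  far? : ∀ {n} D (φ c : NForm n) → Dec (Far D φ c)
  far? D φ c = map′ (λ h l → h {l}) (λ h {l} → h l) (ℕ.allUpTo? (λ l → D ℕ.≤? wt (comb φ l c)) p)

  -- Centres of a dense set.

  module Centers (a : ℕ) where

    -- In units of 2^n, the square norm of a sum `H` of 2κ biased functions is at most 2κp² + 4κ²(p
    -- + 3)/K, and the choice of `K` makes the second term κ²/(2a). Adding κ·1_A changes the square
    -- norm by at most -κ²/a. The result is negative as soon as κ/(2a) > 2p², and here κ/(2a) = 4p².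
    K κ : ℕ
    K = 8 ℕ.* a ℕ.* (p ℕ.+ 3)
    κ = 8 ℕ.* a ℕ.* (p ℕ.* p)

    radius centers : ℕ
    radius = far-weight K
    centers = suc (κ ℕ.+ κ)

    +K : + K ≡ + 8 * + a * (+ p + + 3)
    +K = trans (pos-* (8 ℕ.* a) (p ℕ.+ 3)) (cong (_* (+ p + + 3)) (pos-* 8 a))
    +κ : + κ ≡ + 8 * + a * (+ p * + p)
    +κ = trans (pos-* (8 ℕ.* a) (p ℕ.* p)) (cong₂ _*_ (pos-* 8 a) (pos-* p p))

    module _ {n} (A : CubeSet n) (a≥1 : 1 ℕ.≤ a) (dense : pow2 n ≤ + a * size A) where

      P = pow2 n

      Spread : List (NForm n) → Set
      Spread V = ∀ (φ : Form p n) → All (Far radius (toN φ)) V → ∀ d → d ℕ.< p → size A ≤ + 2 * + p * hits A (toN φ) d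

      Biased : List (NForm n) → Form p n → Set
      Biased V φ = All (Far radius (toN φ)) V × ∃ λ d → d ℕ.< p × ¬ (size A ≤ + 2 * + p * hits A (toN φ) d)

      biased? : ∀ V → Decidable (Biased V)
      biased? V φ = All.all? (far? radius (toN φ)) V ×-dec
        ℕ.anyUpTo? (λ d → ¬? (size A ≤? + 2 * + p * hits A (toN φ) d)) p

      -- `H` is the sum of the balanced functions of the biased forms found so far. Each of them has
      -- inner product at most -|A|/2 with the indicator of `A`. `V₀` keeps the list of centres
      -- non-empty: the multiple `l = 0` in `Far` then says that a new form is itself heavy.
      record State (k : ℕ) : Set where
        field
          V₀ : NForm n
          V : List (NForm n)
          H : Cube n → ℤ
          len : length V ≡ k
          negative : + 2 * Σc (λ x → ⟦ A x ⟧ * H x) ≤ - (+ k * size A)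
          norm : + K * Σc (λ x → H x * H x) ≤ (+ K * + k * (+ p * + p) + + k * + k * (+ p + + 3)) * P
          ortho : ∀ (φ : NForm n) → All (Far radius φ) (V₀ ∷ V) → ∀ d →
            + K * Σc (λ x → H x * balanced φ d x) ≤ + k * (+ p + + 3) * P

      start : State 0
      start = record
        { V₀ = replicate n 0 ; V = [] ; H = λ _ → 0ℤ ; len = refl
        ; negative = ≤-reflexive (trans (cong (+ 2 *_) (trans (Σc-cong (λ x → *-zeroʳ ⟦ A x ⟧)) (Σc-0 n))) (z₁ (size A)))
        ; norm = ≤-reflexive (trans (cong (+ K *_) (Σc-0 n)) (z₂ (+ K) (+ p) P))
        ; ortho = λ φ _ d → ≤-reflexive (trans (cong (+ K *_) (trans (Σc-cong (λ x → *-zeroˡ (balanced φ d x))) (Σc-0 n))) (z₃ (+ K) (+ p) P)) }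
        where
        z₁ : ∀ s → + 2 * 0ℤ ≡ - (0ℤ * s)
        z₁ = solve-∀
        z₂ : ∀ K p P → K * 0ℤ ≡ (K * 0ℤ * (p * p) + 0ℤ * 0ℤ * (p + + 3)) * P
        z₂ = solve-∀
        z₃ : ∀ K p P → K * 0ℤ ≡ 0ℤ * (p + + 3) * P
        z₃ = solve-∀

      extend : ∀ {k} (st : State k) φ → Biased (State.V₀ st ∷ State.V st) φ → State (suc k)
      extend {k} st φ (far , d , d<p , biased) = record
        { V₀ = V₀ ; V = α ∷ V ; H = H′ ; len = cong suc len ; negative = negative′ ; norm = norm′ ; ortho = ortho′ }
        where
        open State st
        α = toN φ
        g = balanced α d
        H′ : Cube n → ℤ
        H′ x = H x + g x
        big : radius ℕ.≤ wt α
        big = subst (λ v → radius ℕ.≤ wt v) (comb-0 α V₀) (All.head far 0 (s≤s z≤n))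
        e₁ : ∀ a h p i → a * (h + (p * i - 1ℤ)) ≡ (a * h + p * (a * i)) + - 1ℤ * a
        e₁ = solve-∀
        sumA : Σc (λ x → ⟦ A x ⟧ * H′ x) ≡ (Σc (λ x → ⟦ A x ⟧ * H x) + + p * hits A α d) + - 1ℤ * size A
        sumA = trans (Σc-cong (λ x → e₁ ⟦ A x ⟧ (H x) (+ p) ⟦ eqm (nsum α x) d ⟧))
          (trans (Σc-+ (λ x → ⟦ A x ⟧ * H x + + p * (⟦ A x ⟧ * ⟦ eqm (nsum α x) d ⟧)) (λ x → - 1ℤ * ⟦ A x ⟧))
          (cong₂ _+_ (trans (Σc-+ (λ x → ⟦ A x ⟧ * H x) (λ x → + p * (⟦ A x ⟧ * ⟦ eqm (nsum α x) d ⟧)))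
                       (cong (λ v → Σc (λ x → ⟦ A x ⟧ * H x) + v) (Σc-*ˡ (+ p) (λ x → ⟦ A x ⟧ * ⟦ eqm (nsum α x) d ⟧))))
                     (Σc-*ˡ (- 1ℤ) (indicator A))))
        e₂ : ∀ k s h t p → - ((1ℤ + k) * s) - + 2 * ((t + p * h) + - 1ℤ * s) ≡ (- (k * s) - + 2 * t) + (s - + 2 * p * h)
        e₂ = solve-∀
        negative′ : + 2 * Σc (λ x → ⟦ A x ⟧ * H′ x) ≤ - (+ suc k * size A)
        negative′ = slack negative ⊞ slack (<⇒≤ (≰⇒> biased))
          by trans (cong (λ v → - (+ suc k * size A) - + 2 * v) sumA) (e₂ (+ k) (size A) (hits A α d) (Σc (λ x → ⟦ A x ⟧ * H x)) (+ p))
        g² : ∀ b → (+ p * ⟦ b ⟧ - 1ℤ) * (+ p * ⟦ b ⟧ - 1ℤ) ≤ + p * + p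
        g² true = (0≤+ {q} ⊞ 0≤+ {p}) by e (+ q)
          where
          e : ∀ q → (1ℤ + q) * (1ℤ + q) - ((1ℤ + q) * 1ℤ - 1ℤ) * ((1ℤ + q) * 1ℤ - 1ℤ) ≡ q + (1ℤ + q)
          e = solve-∀
        g² false = (0≤+ {q} ⊠ (0≤+ {q} ⊞ 0≤+ {2})) by e (+ q)
          where
          e : ∀ q → (1ℤ + q) * (1ℤ + q) - ((1ℤ + q) * 0ℤ - 1ℤ) * ((1ℤ + q) * 0ℤ - 1ℤ) ≡ q * (q + + 2)
          e = solve-∀
        Σg² : Σc (λ x → g x * g x) ≤ + p * + p * P
        Σg² = subst (Σc (λ x → g x * g x) ≤_) (Σc-const n (+ p * + p)) (Σc-mono (λ x → g² (eqm (nsum α x) d)))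
        e₃ : ∀ h g → (h + g) * (h + g) ≡ (h * h + + 2 * (h * g)) + g * g
        e₃ = solve-∀
        sumH : Σc (λ x → H′ x * H′ x) ≡ (Σc (λ x → H x * H x) + + 2 * Σc (λ x → H x * g x)) + Σc (λ x → g x * g x)
        sumH = trans (Σc-cong (λ x → e₃ (H x) (g x)))
          (trans (Σc-+ (λ x → H x * H x + + 2 * (H x * g x)) (λ x → g x * g x))
            (cong (_+ Σc (λ x → g x * g x)) (trans (Σc-+ (λ x → H x * H x) (λ x → + 2 * (H x * g x)))
              (cong (λ v → Σc (λ x → H x * H x) + v) (Σc-*ˡ (+ 2) (λ x → H x * g x))))))
        e₄ : ∀ K k p P s t w → (K * (1ℤ + k) * (p * p) + (1ℤ + k) * (1ℤ + k) * (p + + 3)) * P - K * ((s + + 2 * t) + w) ≡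
          (((K * k * (p * p) + k * k * (p + + 3)) * P - K * s) + + 2 * (k * (p + + 3) * P - K * t)) + (K * (p * p * P - w) + (p + + 3) * P)
        e₄ = solve-∀
        norm′ : + K * Σc (λ x → H′ x * H′ x) ≤ (+ K * + suc k * (+ p * + p) + + suc k * + suc k * (+ p + + 3)) * P
        norm′ = (slack norm ⊞ (0≤+ {2} ⊠ slack (ortho α far d))) ⊞ ((0≤+ {K} ⊠ slack Σg²) ⊞ ((0≤+ {p} ⊞ 0≤+ {3}) ⊠ 0≤+ {2 ℕ.^ n}))
          by trans (cong (λ v → (+ K * + suc k * (+ p * + p) + + suc k * + suc k * (+ p + + 3)) * P - + K * v) sumH)
                   (e₄ (+ K) (+ k) (+ p) P (Σc (λ x → H x * H x)) (Σc (λ x → H x * g x)) (Σc (λ x → g x * g x)))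
        e₅ : ∀ K k p P s t → (1ℤ + k) * (p + + 3) * P - K * (s + t) ≡ (k * (p + + 3) * P - K * s) + ((p + + 3) * P - K * t)
        e₅ = solve-∀
        ortho′ : ∀ (φ′ : NForm n) → All (Far radius φ′) (V₀ ∷ α ∷ V) → ∀ d′ →
          + K * Σc (λ x → H′ x * balanced φ′ d′ x) ≤ + suc k * (+ p + + 3) * P
        ortho′ φ′ (f₀ ∷ f₁ ∷ fs) d′ = slack (ortho φ′ (f₀ ∷ fs) d′) ⊞ slack (almost-orthogonal K α φ′ big f₁ d d′)
          by trans (cong (λ v → + suc k * (+ p + + 3) * P - + K * v)
                     (trans (Σc-cong (λ x → *-distribʳ-+ (balanced φ′ d′ x) (H x) (g x)))
                            (Σc-+ (λ x → H x * balanced φ′ d′ x) (λ x → g x * balanced φ′ d′ x))))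
                   (e₅ (+ K) (+ k) (+ p) P (Σc (λ x → H x * balanced φ′ d′ x)) (Σc (λ x → g x * balanced φ′ d′ x)))

      -- At k = 2κ the vector H + κ·1_A would have negative square norm.
      no-long-state : ¬ State (κ ℕ.+ κ)
      no-long-state st = <-irrefl refl (<-≤-trans impossible nonneg)
        where
        open State st
        SA = Σc (λ x → ⟦ A x ⟧ * H x)
        SH = Σc (λ x → H x * H x)
        ⟦⟧² : ∀ b → ⟦ b ⟧ * ⟦ b ⟧ ≡ ⟦ b ⟧
        ⟦⟧² true = refl
        ⟦⟧² false = refl
        e₁ : ∀ h κ a → (h + κ * a) * (h + κ * a) ≡ (h * h + + 2 * κ * (a * h)) + κ * κ * (a * a)
        e₁ = solve-∀
        square : 0ℤ ≤ (SH + + 2 * + κ * SA) + + κ * + κ * size A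
        square = subst (0ℤ ≤_)
          (trans (Σc-cong (λ x → trans (e₁ (H x) (+ κ) ⟦ A x ⟧) (cong (λ v → (H x * H x + + 2 * + κ * (⟦ A x ⟧ * H x)) + + κ * + κ * v) (⟦⟧² (A x)))))
          (trans (Σc-+ (λ x → H x * H x + + 2 * + κ * (⟦ A x ⟧ * H x)) (λ x → + κ * + κ * ⟦ A x ⟧))
            (cong₂ _+_ (trans (Σc-+ (λ x → H x * H x) (λ x → + 2 * + κ * (⟦ A x ⟧ * H x)))
                              (cong (λ v → SH + v) (Σc-*ˡ (+ 2 * + κ) (λ x → ⟦ A x ⟧ * H x))))
                       (Σc-*ˡ (+ κ * + κ) (indicator A)))))
          (Σc-nonneg (λ x → 0≤square (H x + + κ * ⟦ A x ⟧)))
        e₂ : ∀ a K κ p P SH SA s →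
          a * K * ((SH + + 2 * κ * SA) + κ * κ * s)
            + a * ((K * (κ + κ) * (p * p) + (κ + κ) * (κ + κ) * (p + + 3)) * P - K * SH)
            + a * K * κ * (- ((κ + κ) * s) - + 2 * SA)
            + K * κ * κ * (a * s - P)
          ≡ (+ 2 * a * K * κ * (p * p) + + 4 * a * κ * κ * (p + + 3) - K * κ * κ) * P
        e₂ = solve-∀
        e₃ : ∀ a p P → (+ 2 * a * (+ 8 * a * (p + + 3)) * (+ 8 * a * (p * p)) * (p * p) + + 4 * a * (+ 8 * a * (p * p)) * (+ 8 * a * (p * p)) * (p + + 3)
            - (+ 8 * a * (p + + 3)) * (+ 8 * a * (p * p)) * (+ 8 * a * (p * p))) * P
          ≡ - (+ 128 * (a * a * a) * (p * p * (p * p)) * (p + + 3) * P)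
        e₃ = solve-∀
        nonneg : 0ℤ ≤ - (+ 128 * (+ a * + a * + a) * (+ p * + p * (+ p * + p)) * (+ p + + 3) * P)
        nonneg = subst (0ℤ ≤_) (trans (e₂ (+ a) (+ K) (+ κ) (+ p) P SH SA (size A))
            (trans (cong₂ (λ K κ → (+ 2 * + a * K * κ * (+ p * + p) + + 4 * + a * κ * κ * (+ p + + 3) - K * κ * κ) * P) +K +κ) (e₃ (+ a) (+ p) P)))
          (((0≤+ {a} ⊠ 0≤+ {K}) ⊠ square) ⊞ (0≤+ {a} ⊠ slack norm) ⊞ (((0≤+ {a} ⊠ 0≤+ {K}) ⊠ 0≤+ {κ}) ⊠ slack negative)
            ⊞ (((0≤+ {K} ⊠ 0≤+ {κ}) ⊠ 0≤+ {κ}) ⊠ slack dense))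
        impossible : - (+ 128 * (+ a * + a * + a) * (+ p * + p * (+ p * + p)) * (+ p + + 3) * P) < 0ℤ
        impossible = neg-mono-< (pos⁺ (pos⁺ (pos⁺ (pos⁺ (lt {128} (s≤s z≤n)) (pos⁺ (pos⁺ 0<a 0<a) 0<a)) (pos⁺ (pos⁺ 0<p 0<p) (pos⁺ 0<p 0<p)))
            (+-mono-< 0<p (lt {3} (s≤s z≤n)))) (lt (ℕ.m^n>0 2 n)))
          where
          lt : ∀ {m} → 0 ℕ.< m → 0ℤ < + m
          lt = +<+
          0<a = lt a≥1
          0<p = lt {p} (s≤s z≤n)
          pos⁺ : ∀ {x y} → 0ℤ < x → 0ℤ < y → 0ℤ < x * y
          pos⁺ {+ x} {+ y} (+<+ h) (+<+ h′) = subst (0ℤ <_) (pos-* x y) (lt (ℕ.*-mono-< h h′))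

      centers-exist : ∃ λ V → length V ℕ.≤ centers × Spread V
      centers-exist = go (κ ℕ.+ κ) 0 start (ℕ.+-identityʳ _)
        where
        go : ∀ fuel k → State k → fuel ℕ.+ k ≡ κ ℕ.+ κ → ∃ λ V → length V ℕ.≤ centers × Spread V
        go zero k st refl = ⊥-elim (no-long-state st)
        go (suc fuel) k st eq with anyVec? (biased? (State.V₀ st ∷ State.V st))
        ... | yes (φ , b) = go fuel (suc k) (extend st φ b) (trans (ℕ.+-suc fuel k) eq)
        ... | no none = State.V₀ st ∷ State.V st ,
                s≤s (ℕ.≤-trans (ℕ.≤-reflexive (State.len st)) (ℕ.≤-trans (ℕ.m≤n+m k (suc fuel)) (ℕ.≤-reflexive eq))) , spread
          where
          spread : Spread (State.V₀ st ∷ State.V st)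
          spread φ far d d<p with size A ≤? + 2 * + p * hits A (toN φ) d
          ... | yes h = h
          ... | no h = ⊥-elim (none (φ , far , d , d<p , h))

  ∧-true : ∀ {a b} → a ≡ true → b ≡ true → a ∧ b ≡ true
  ∧-true refl refl = refl

  ∧-left : ∀ {a b} → a ∧ b ≡ true → a ≡ true
  ∧-left {true} _ = refl

  ∧-right : ∀ {a b} → a ∧ b ≡ true → b ≡ true
  ∧-right {true} h = h

  mass-mono : ∀ {n} {f : Cube n → ℤ} {B B′ : Cube n → Bool} → (∀ x → 0ℤ ≤ f x) → (∀ x → B x ≡ true → B′ x ≡ true) → mass f B ≤ mass f B′
  mass-mono {f = f} {B} {B′} nn h = Σc-mono (λ x → go (f x) (B x) (B′ x) (nn x) (h x))
    where
    go : ∀ y a b → 0ℤ ≤ y → (a ≡ true → b ≡ true) → y * ⟦ a ⟧ ≤ y * ⟦ b ⟧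
    go y false b 0≤y _ = subst (_≤ y * ⟦ b ⟧) (sym (*-zeroʳ y)) (0≤y ⊠ 0≤⟦⟧ b)
    go y true b 0≤y h rewrite h refl = ≤-refl

  mass-nonneg : ∀ {n} {f : Cube n → ℤ} {B : Cube n → Bool} → (∀ x → 0ℤ ≤ f x) → 0ℤ ≤ mass f B
  mass-nonneg {B = B} nn = Σc-nonneg (λ x → nn x ⊠ 0≤⟦⟧ (B x))

  mass-partition : ∀ {n} (f : Cube n → ℤ) B (y : Cube n → ℕ) →
    Σr p (λ r → mass f (λ x → B x ∧ eqm (y x) r)) ≡ mass f B
  mass-partition f B y = trans (sym (Σc-Σr p (λ r x → f x * ⟦ B x ∧ eqm (y x) r ⟧)))
    (Σc-cong (λ x → trans (Σr-cong p (λ r _ → trans (cong (f x *_) (⟦∧⟧ (B x) (eqm (y x) r))) (sym (*-assoc (f x) ⟦ B x ⟧ ⟦ eqm (y x) r ⟧))))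
      (trans (Σr-*ˡ p (f x * ⟦ B x ⟧) (λ r → ⟦ eqm (y x) r ⟧)) (trans (cong (f x * ⟦ B x ⟧ *_) (Σr-eqm (y x))) (*-identityʳ _)))))

  -- Restrictions of forms and revealing all but q coordinates.

  restr : ∀ {n} → Mask n → NForm n → NForm n
  restr [] [] = []
  restr (b ∷ J) (a ∷ ψ) = (if b then a else 0) ∷ restr J ψ

  compl : ∀ {n} → Mask n → Mask n
  compl = Vec.map not

  _∖_ : ∀ {n} → Mask n → Mask n → Mask n
  _∖_ = zipWith (λ a b → a ∧ not b)

  lookup-restr : ∀ {n} (J : Mask n) ψ k → lookup (restr J ψ) k ≡ (if lookup J k then lookup ψ k else 0)
  lookup-restr (b ∷ J) (a ∷ ψ) zero = refl
  lookup-restr (b ∷ J) (a ∷ ψ) (suc k) = lookup-restr J ψ k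

  restr-out : ∀ {n} (J : Mask n) ψ k → lookup J k ≡ false → lookup (restr J ψ) k ≡ 0
  restr-out J ψ k e = trans (lookup-restr J ψ k) (cong (λ b → if b then lookup ψ k else 0) e)

  nsum-compl : ∀ {n} (J : Mask n) ψ x → nsum ψ x ≡ nsum (restr J ψ) x ℕ.+ nsum (restr (compl J) ψ) x
  nsum-compl [] [] [] = refl
  nsum-compl (b ∷ J) (a ∷ ψ) (false ∷ x) = nsum-compl J ψ x
  nsum-compl (true ∷ J) (a ∷ ψ) (true ∷ x) = trans (cong (a ℕ.+_) (nsum-compl J ψ x)) (sym (ℕ.+-assoc a _ _))
  nsum-compl (false ∷ J) (a ∷ ψ) (true ∷ x) = trans (cong (a ℕ.+_) (nsum-compl J ψ x)) (lem a (nsum (restr J ψ) x) (nsum (restr (compl J) ψ) x))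
    where
    lem : ∀ a b c → a ℕ.+ (b ℕ.+ c) ≡ b ℕ.+ (a ℕ.+ c)
    lem = solveℕ

  nsum-∖ : ∀ {n} (J T : Mask n) → T ⊑ J → ∀ ψ x →
    nsum (restr (compl T) ψ) x ≡ nsum (restr (J ∖ T) ψ) x ℕ.+ nsum (restr (compl J) ψ) x
  nsum-∖ [] [] s [] [] = refl
  nsum-∖ (b ∷ J) (b′ ∷ T) s (a ∷ ψ) (false ∷ x) = nsum-∖ J T (s ∘ suc) ψ x
  nsum-∖ (true ∷ J) (true ∷ T) s (a ∷ ψ) (true ∷ x) = nsum-∖ J T (s ∘ suc) ψ x
  nsum-∖ (true ∷ J) (false ∷ T) s (a ∷ ψ) (true ∷ x) = trans (cong (a ℕ.+_) (nsum-∖ J T (s ∘ suc) ψ x)) (sym (ℕ.+-assoc a _ _))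
  nsum-∖ (false ∷ J) (true ∷ T) s (a ∷ ψ) (true ∷ x) with () ← s zero refl
  nsum-∖ (false ∷ J) (false ∷ T) s (a ∷ ψ) (true ∷ x) = trans (cong (a ℕ.+_) (nsum-∖ J T (s ∘ suc) ψ x)) (lem a (nsum (restr (J ∖ T) ψ) x) (nsum (restr (compl J) ψ) x))
    where
    lem : ∀ a b c → a ℕ.+ (b ℕ.+ c) ≡ b ℕ.+ (a ℕ.+ c)
    lem = solveℕ

  nsum-agree : ∀ {n} (ψ : NForm n) x y → (∀ k → lookup ψ k ≉ 0 → lookup x k ≡ lookup y k) → nsum ψ x ≈ nsum ψ y
  nsum-agree [] [] [] h = ≈-refl
  nsum-agree (a ∷ ψ) (b ∷ x) (b′ ∷ y) h = go b b′ (a ≈? 0) (λ nz → h zero nz) (nsum-agree ψ x y (h ∘ suc))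
    where
    go : ∀ b b′ → Dec (a ≈ 0) → (a ≉ 0 → b ≡ b′) → nsum ψ x ≈ nsum ψ y → nsum (a ∷ ψ) (b ∷ x) ≈ nsum (a ∷ ψ) (b′ ∷ y)
    go false false _ _ e = e
    go true true _ _ e = ≈-+ (≈-refl {a}) e
    go false true (yes z) _ e = ≈-trans e (≈-+ (≈-sym z) ≈-refl)
    go true false (yes z) _ e = ≈-trans (≈-+ z ≈-refl) e
    go false true (no nz) h e with () ← h nz
    go true false (no nz) h e with () ← h nz

  nsum-restr-agree : ∀ {n} (J : Mask n) ψ x y → Agree J x y → nsum (restr J ψ) x ≈ nsum (restr J ψ) y
  nsum-restr-agree J ψ x y a = nsum-agree (restr J ψ) x y λ k nz → go k nz (lookup J k) refl
    where
    go : ∀ k → lookup (restr J ψ) k ≉ 0 → ∀ b → lookup J k ≡ b → lookup x k ≡ lookup y k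
    go k nz true e = a k e
    go k nz false e = ⊥-elim (nz (≡⇒≈ (restr-out J ψ k e)))

  suppMask : ∀ {n} → NForm n → Mask n
  suppMask = Vec.map (λ a → not (eqm a 0))

  ∣suppMask∣ : ∀ {n} (ψ : NForm n) → ∣ suppMask ψ ∣ₘ ≡ wt ψ
  ∣suppMask∣ [] = refl
  ∣suppMask∣ (a ∷ ψ) with eqm a 0
  ... | true = ∣suppMask∣ ψ
  ... | false = cong suc (∣suppMask∣ ψ)

  ≉⇒∈supp : ∀ {n} (ψ : NForm n) k → lookup ψ k ≉ 0 → k ∈ₘ suppMask ψ
  ≉⇒∈supp ψ k nz = trans (lookup-map k _ ψ) (cong not (≉⇒eqm nz))

  ∈supp⇒≉ : ∀ {n} (ψ : NForm n) k → k ∈ₘ suppMask ψ → lookup ψ k ≉ 0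
  ∈supp⇒≉ ψ k h z with () ← trans (sym (trans (lookup-map k _ ψ) (cong not (≈⇒eqm z)))) h

  top : ∀ {n} → ℕ → NForm n → Mask n
  top b [] = []
  top b (a ∷ ψ) with eqm a 0
  top b (a ∷ ψ) | true = false ∷ top b ψ
  top zero (a ∷ ψ) | false = false ∷ top zero ψ
  top (suc b) (a ∷ ψ) | false = true ∷ top b ψ

  ∣top∣ : ∀ {n} b (ψ : NForm n) → ∣ top b ψ ∣ₘ ℕ.≤ b
  ∣top∣ b [] = z≤n
  ∣top∣ b (a ∷ ψ) with eqm a 0
  ∣top∣ b (a ∷ ψ) | true = ∣top∣ b ψ
  ∣top∣ zero (a ∷ ψ) | false = ∣top∣ zero ψ
  ∣top∣ (suc b) (a ∷ ψ) | false = s≤s (∣top∣ b ψ)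

  top⊑supp : ∀ {n} b (ψ : NForm n) k → k ∈ₘ top b ψ → lookup ψ k ≉ 0
  top⊑supp b (a ∷ ψ) k h with eqm a 0 in e
  top⊑supp b (a ∷ ψ) (suc k) h | true = top⊑supp b ψ k h
  top⊑supp zero (a ∷ ψ) (suc k) h | false = top⊑supp zero ψ k h
  top⊑supp (suc b) (a ∷ ψ) zero h | false = eqm-false {a} {0} e
  top⊑supp (suc b) (a ∷ ψ) (suc k) h | false = top⊑supp b ψ k h

  top-full : ∀ {n} b (ψ : NForm n) → b ℕ.≤ wt (restr (top b ψ) ψ) ⊎ (∀ x → nsum (restr (compl (top b ψ)) ψ) x ≈ 0)
  top-full zero ψ = inj₁ z≤n
  top-full (suc b) [] = inj₂ λ { [] → ≈-refl }
  top-full (suc b) (a ∷ ψ) with eqm a 0 in e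
  ... | true with top-full (suc b) ψ
  ...   | inj₁ h = inj₁ h
  ...   | inj₂ h = inj₂ λ { (false ∷ x) → h x ; (true ∷ x) → ≈-+ (eqm⇒≈ {a} {0} e) (h x) }
  top-full (suc b) (a ∷ ψ) | false with top-full b ψ
  ...   | inj₁ h rewrite e = inj₁ (s≤s h)
  ...   | inj₂ h = inj₂ λ { (false ∷ x) → h x ; (true ∷ x) → h x }

  reach⇒point : ∀ {n} (ψ : NForm n) r a → reach (support ψ) r a ≡ true → ∃ λ z → a ℕ.+ nsum ψ z ≈ r
  reach⇒point [] r a h = [] , ≈-trans (≡⇒≈ (ℕ.+-identityʳ a)) (eqm⇒≈ {a} {r} h)
  reach⇒point (b ∷ ψ) r a h with eqm b 0
  ... | true = let (z , e) = reach⇒point ψ r a h in false ∷ z , e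
  ... | false with reach (support ψ) r a in e
  ...   | true = let (z , e′) = reach⇒point ψ r a e in false ∷ z , e′
  ...   | false = let (z , e′) = reach⇒point ψ r (a ℕ.+ b) h in true ∷ z , ≈-trans (≡⇒≈ (sym (ℕ.+-assoc a b (nsum ψ z)))) e′

  elems : ∀ {n} → Mask n → List (Fin n)
  elems [] = []
  elems (true ∷ J) = zero ∷ map suc (elems J)
  elems (false ∷ J) = map suc (elems J)

  length-elems : ∀ {n} (J : Mask n) → length (elems J) ≡ ∣ J ∣ₘ
  length-elems [] = refl
  length-elems (true ∷ J) = cong suc (trans (length-map suc (elems J)) (length-elems J))
  length-elems (false ∷ J) = trans (length-map suc (elems J)) (length-elems J)

  elems⁻ : ∀ {n} (J : Mask n) {k} → k ∈ elems J → k ∈ₘ J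
  elems⁻ (true ∷ J) (here refl) = refl
  elems⁻ (true ∷ J) (there k∈) with ∈-map⁻ suc k∈
  ... | j , j∈ , refl = elems⁻ J j∈
  elems⁻ (false ∷ J) k∈ with ∈-map⁻ suc k∈
  ... | j , j∈ , refl = elems⁻ J j∈

  elems⁺ : ∀ {n} (J : Mask n) k → k ∈ₘ J → k ∈ elems J
  elems⁺ (true ∷ J) zero h = here refl
  elems⁺ (true ∷ J) (suc k) h = there (∈-map⁺ suc (elems⁺ J k h))
  elems⁺ (false ∷ J) (suc k) h = ∈-map⁺ suc (elems⁺ J k h)

  elems-unique : ∀ {n} (J : Mask n) → Unique (elems J)
  elems-unique [] = []
  elems-unique (true ∷ J) = All.map⁺ (All.universal (λ _ ()) (elems J)) ∷ Unique.map⁺ Fin.suc-injective (elems-unique J)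
  elems-unique (false ∷ J) = Unique.map⁺ Fin.suc-injective (elems-unique J)

  agreeOn⇒ : ∀ {n} (ks : List (Fin n)) x z → agreeOn ks x z ≡ true → ∀ {k} → k ∈ ks → lookup x k ≡ lookup z k
  agreeOn⇒ (j ∷ ks) x z h (here refl) = same⇒≡ _ _ (∧-left h)
  agreeOn⇒ (j ∷ ks) x z h (there k∈) = agreeOn⇒ ks x z (∧-right {same (lookup x j) (lookup z j)} h) k∈

  not-true : ∀ {b} → ¬ (b ≡ true) → b ≡ false
  not-true {true} h = ⊥-elim (h refl)
  not-true {false} h = refl

  -- Once all but q non-zero coordinates of ψ are revealed, by Cauchy–Davenport the remaining ones
  -- can still produce the value ψ(z), and stability makes each of them nearly unbiased.
  module Fresh {n} (f : Cube n → ℤ) (nn : ∀ x → 0ℤ ≤ f x) (r D : ℕ) (J : Mask n)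
    (stable : ∀ I → ∣ I ∣ₘ ℕ.≤ D → + r * + r * (energy (J ∪ₘ I) f - energy J f) ≤ pow2 n * pow2 n)
    (B : Cube n → Bool) (meas : Measurable J B)
    (ψ : NForm n) (off : ∀ k → k ∈ₘ J → lookup ψ k ≡ 0) (light : wt ψ ℕ.≤ D) (z : Cube n) where

    open Halving f r using (R; halve)

    S : Mask n
    S = top q ψ
    ks : List (Fin n)
    ks = elems S
    ψ₁ ψ₂ : NForm n
    ψ₁ = restr (compl S) ψ
    ψ₂ = restr S ψ
    J′ U : Mask n
    J′ = J ∪ₘ suppMask ψ₁
    U = J ∪ₘ suppMask ψ
    P = pow2 n

    E : Cube n → Bool
    E x = eqm (nsum ψ x) (nsum ψ z)

    small : R * R * (energy U f - energy J f) ≤ P * P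
    small = stable (suppMask ψ) (ℕ.≤-trans (ℕ.≤-reflexive (∣suppMask∣ ψ)) light)

    ψ₁-nonzero : ∀ k → lookup ψ₁ k ≉ 0 → lookup S k ≡ false × lookup ψ k ≉ 0
    ψ₁-nonzero k nz = go (lookup S k) refl
      where
      val : lookup ψ₁ k ≡ (if not (lookup S k) then lookup ψ k else 0)
      val = trans (lookup-restr (compl S) ψ k) (cong (λ b → if b then lookup ψ k else 0) (lookup-map k not S))
      go : ∀ b → lookup S k ≡ b → lookup S k ≡ false × lookup ψ k ≉ 0
      go true e = ⊥-elim (nz (≡⇒≈ (trans val (cong (λ b → if not b then lookup ψ k else 0) e))))
      go false e = e , λ h → nz (≈-trans (≡⇒≈ (trans val (cong (λ b → if not b then lookup ψ k else 0) e))) h)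

    out : ∀ {k} → k ∈ ks → lookup J′ k ≡ false
    out {k} k∈ = not-true λ h → go (∪-elim J (suppMask ψ₁) k h)
      where
      kS = elems⁻ S k∈
      go : k ∈ₘ J ⊎ k ∈ₘ suppMask ψ₁ → ⊥
      go (inj₁ kJ) = top⊑supp q ψ k kS (≡⇒≈ (off k kJ))
      go (inj₂ k₁) with () ← trans (sym kS) (proj₁ (ψ₁-nonzero k (∈supp⇒≉ ψ₁ k k₁)))

    inU : ∀ {k} → k ∈ ks → k ∈ₘ U
    inU {k} k∈ = ∪-right J (suppMask ψ) k (≉⇒∈supp ψ k (top⊑supp q ψ k (elems⁻ S k∈)))

    J′⊑U : J′ ⊑ U
    J′⊑U k h with ∪-elim J (suppMask ψ₁) k h
    ... | inj₁ kJ = ∪-left J (suppMask ψ) k kJ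
    ... | inj₂ k₁ = ∪-right J (suppMask ψ) k (≉⇒∈supp ψ k (proj₂ (ψ₁-nonzero k (∈supp⇒≉ ψ₁ k k₁))))

    Bᵣ : ℕ → Cube n → Bool
    Bᵣ v x = B x ∧ eqm (nsum ψ₁ x) v

    Bᵣ-meas : ∀ v → Measurable J′ (Bᵣ v)
    Bᵣ-meas v = meas-∧ {J = J′} {B = B} (meas-⊑ {J = J} {J′ = J′} {B = B} (∪-left J (suppMask ψ₁)) meas)
      (λ x y a → eqm-cong (nsum-agree ψ₁ x y (λ k nz → a k (∪-right J (suppMask ψ₁) k (≉⇒∈supp ψ₁ k nz)))) (≈-refl {v}))

    ℓ = length ks

    ℓ≤q : ℓ ℕ.≤ q
    ℓ≤q = ℕ.≤-trans (ℕ.≤-reflexive (length-elems S)) (∣top∣ q ψ)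

    Goalᵣ : ℕ → Set
    Goalᵣ v = R * mass f (Bᵣ v) ≤ R * pow2 q * mass f (λ x → (B x ∧ E x) ∧ eqm (nsum ψ₁ x) v) + pow2 q * P

    -- Given that `ψ₁` equals `v`, forcing the coordinates in `S` to be those of `z′` produces the
    -- value ψ(z). Each forced coordinate costs a factor two, and there are at most `q` of them.
    hit : ∀ v z′ → v ℕ.+ nsum ψ₂ z′ ≈ nsum ψ z → Goalᵣ v
    hit v z′ eq = ≤-trans (halve J U small ks J′ (Bᵣ v) z′ (elems-unique S) out inU (∪-left J (suppMask ψ₁)) J′⊑U (Bᵣ-meas v))
        (((0≤+ {r} ⊠ slack 2^ℓ≤2^q) ⊠ mass-nonneg nn) ⊞ ((0≤+ {r} ⊠ 0≤+ {2 ℕ.^ q}) ⊠ slack sub) ⊞ ((slack 2^ℓ≤2^q ⊞ 0≤+ {1}) ⊠ 0≤+ {2 ℕ.^ n})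
         by lem R (pow2 ℓ) (pow2 q) M M′ P)
      where
      M = mass f (λ x → Bᵣ v x ∧ agreeOn ks x z′)
      M′ = mass f (λ x → (B x ∧ E x) ∧ eqm (nsum ψ₁ x) v)
      2^ℓ≤2^q : pow2 ℓ ≤ pow2 q
      2^ℓ≤2^q = +≤+ (ℕ.^-monoʳ-≤ 2 ℓ≤q)
      lem : ∀ R a b M M′ P → (R * b * M′ + b * P) - (R * a * M + (a - 1ℤ) * P) ≡
        R * (b - a) * M + R * b * (M′ - M) + ((b - a) + 1ℤ) * P
      lem = solve-∀
      imp : ∀ x → Bᵣ v x ∧ agreeOn ks x z′ ≡ true → (B x ∧ E x) ∧ eqm (nsum ψ₁ x) v ≡ true
      imp x h = ∧-true (∧-true (∧-left (∧-left h)) (≈⇒eqm final)) v-eq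
        where
        v-eq : eqm (nsum ψ₁ x) v ≡ true
        v-eq = ∧-right {B x} (∧-left h)
        agree₂ : nsum ψ₂ x ≈ nsum ψ₂ z′
        agree₂ = nsum-restr-agree S ψ x z′ (λ k kS → agreeOn⇒ ks x z′ (∧-right {Bᵣ v x} h) (elems⁺ S k kS))
        final : nsum ψ x ≈ nsum ψ z
        final = ≈-trans (≡⇒≈ (trans (nsum-compl S ψ x) (ℕ.+-comm (nsum ψ₂ x) (nsum ψ₁ x))))
          (≈-trans (≈-+ (eqm⇒≈ {nsum ψ₁ x} {v} v-eq) agree₂) eq)
      sub : M ≤ M′
      sub = mass-mono nn imp

    goalᵣ : ∀ v → Goalᵣ v
    goalᵣ v with top-full q ψ
    ... | inj₁ full = let (z′ , e) = reach⇒point ψ₂ (nsum ψ z) v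
                            (reach-all (support ψ₂) (support-nonzero ψ₂) (ℕ.≤-trans full (ℕ.≤-reflexive (sym (length-support ψ₂)))) (nsum ψ z) v)
                      in hit v z′ e
    -- Here `ψ` has fewer than `q` non-zero coordinates and `ψ₁` vanishes. For `v = 0` the point `z`
    -- itself serves, and no point of the cube gives another `v`.
    ... | inj₂ null with v ≈? 0
    ...   | yes v≈0 = hit v z (≈-trans (≈-+ (≈-trans v≈0 (≈-sym (null z))) (≈-refl {nsum ψ₂ z}))
                        (≡⇒≈ (trans (ℕ.+-comm (nsum ψ₁ z) (nsum ψ₂ z)) (sym (nsum-compl S ψ z)))))
    ...   | no v≉0 = subst (_≤ R * pow2 q * M′ + pow2 q * P) (sym zero-mass) (((0≤+ {r} ⊠ 0≤+ {2 ℕ.^ q}) ⊠ mass-nonneg nn) ⊞ (0≤+ {2 ℕ.^ q} ⊠ 0≤+ {2 ℕ.^ n}))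
      where
      M′ = mass f (λ x → (B x ∧ E x) ∧ eqm (nsum ψ₁ x) v)
      empty : ∀ x → f x * ⟦ Bᵣ v x ⟧ ≡ 0ℤ
      empty x = trans (cong (λ b → f x * ⟦ b ⟧) (not-true {Bᵣ v x} λ h → v≉0 (≈-trans (≈-sym (eqm⇒≈ {nsum ψ₁ x} {v} (∧-right {B x} h))) (null x)))) (*-zeroʳ (f x))
      zero-mass : R * mass f (Bᵣ v) ≡ 0ℤ
      zero-mass = trans (cong (R *_) (trans (Σc-cong empty) (Σc-0 n))) (*-zeroʳ R)

    fresh : R * mass f B ≤ R * pow2 q * mass f (λ x → B x ∧ E x) + + p * (pow2 q * P)
    fresh = subst₂ _≤_
      (trans (Σr-*ˡ p R (λ v → mass f (Bᵣ v))) (cong (R *_) (mass-partition f B (nsum ψ₁))))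
      (trans (Σr-+ p (λ v → R * pow2 q * mass f (λ x → (B x ∧ E x) ∧ eqm (nsum ψ₁ x) v)) (λ _ → pow2 q * P))
        (cong₂ _+_ (trans (Σr-*ˡ p (R * pow2 q) (λ v → mass f (λ x → (B x ∧ E x) ∧ eqm (nsum ψ₁ x) v)))
                          (cong (R * pow2 q *_) (mass-partition f (λ x → B x ∧ E x) (nsum ψ₁))))
                   (Σr-const p (pow2 q * P))))
      (Σr-mono p (λ v _ → goalᵣ v))

  -- No bounded set of coordinates need determine a core form, so its value cannot be part of a
  -- measurable event. It is built into the function that is regularised instead.
  slice : ∀ {n} → CubeSet n → NForm n → ℕ → Cube n → ℤ
  slice A c u x = ⟦ A x ∧ eqm (nsum c x) u ⟧

  slices : ∀ {n} → CubeSet n → List (NForm n) → List (Cube n → ℤ)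
  slices A [] = []
  slices A (c ∷ C) = map (slice A c) (upTo p) ++ slices A C

  length-slices : ∀ {n} (A : CubeSet n) C → length (slices A C) ≡ length C ℕ.* p
  length-slices A [] = refl
  length-slices A (c ∷ C) = trans (length-++ (map (slice A c) (upTo p)))
    (cong₂ ℕ._+_ (trans (length-map (slice A c) (upTo p)) (length-upTo p)) (length-slices A C))

  slices-bounded : ∀ {n} (A : CubeSet n) C → All Bounded (slices A C)
  slices-bounded A [] = []
  slices-bounded A (c ∷ C) = All.++⁺ (All.map⁺ (All.universal (λ u → (λ x → 0≤⟦⟧ (A x ∧ eqm (nsum c x) u)) , (λ x → ⟦⟧≤1 (A x ∧ eqm (nsum c x) u))) (upTo p))) (slices-bounded A C)

  ∈-slices : ∀ {n} (A : CubeSet n) {C c u} → c ∈ C → u ℕ.< p → slice A c u ∈ slices A C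
  ∈-slices A {C = c ∷ C} (here refl) u<p = ∈-++⁺ˡ (∈-map⁺ (slice A c) (∈-upTo⁺ u<p))
  ∈-slices A {C = c ∷ C} (there c∈) u<p = ∈-++⁺ʳ (map (slice A c) (upTo p)) (∈-slices A c∈ u<p)

  mass-slice : ∀ {n} (A : CubeSet n) c u B → mass (slice A c u) B ≡ mass (indicator A) (λ x → B x ∧ eqm (nsum c x) u)
  mass-slice A c u B = Σc-cong (λ x → go (A x) (B x) (eqm (nsum c x) u))
    where
    go : ∀ a b e → ⟦ a ∧ e ⟧ * ⟦ b ⟧ ≡ ⟦ a ⟧ * ⟦ b ∧ e ⟧
    go true true true = refl
    go true true false = refl
    go true false true = refl
    go true false false = refl
    go false b e = refl

  indicator-nonneg : ∀ {n} (A : CubeSet n) x → 0ℤ ≤ indicator A x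
  indicator-nonneg A x = 0≤⟦⟧ (A x)

  wt-restr : ∀ {n} (J : Mask n) ψ → wt (restr J ψ) ℕ.≤ wt ψ
  wt-restr [] [] = z≤n
  wt-restr (true ∷ J) (a ∷ ψ) = ℕ.+-monoʳ-≤ (if eqm a 0 then 0 else 1) (wt-restr J ψ)
  wt-restr (false ∷ J) (a ∷ ψ) = ℕ.≤-trans (wt-restr J ψ) (ℕ.m≤n+m _ (if eqm a 0 then 0 else 1))

  -- The frequency of the target value on one set.

  module Local {n} (A : CubeSet n) (C : List (NForm n)) (r D : ℕ) (J Tm : Mask n) (T⊑J : Tm ⊑ J)
    (stable : Stable D (r ℕ.* r) (slices A C) J)
    {c : NForm n} (c∈ : c ∈ C) (κ : ℕ) (ψ : NForm n) (light : wt ψ ℕ.≤ D) (v : ℕ) where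

    P R : ℤ
    P = pow2 n
    R = + r
    base : Cube n → Bool
    base x = eqm (κ ℕ.* nsum c x ℕ.+ nsum (restr Tm ψ) x) v
    priv : Cube n → ℕ
    priv x = nsum (restr (J ∖ Tm) ψ) x
    target : Cube n → Cube n → Bool
    target z x = eqm (κ ℕ.* nsum c x ℕ.+ nsum ψ x) (v ℕ.+ nsum (restr (compl Tm) ψ) z)

    -- The private value is given through a point `z` that attains it, because points can be glued
    -- across the members of a tuple and values cannot. Such a point exists since the popular event
    -- has positive mass.
    popular : 0ℤ < size A → size A ≤ + p * mass (indicator A) base →
      ∃ λ z → size A ≤ + p * + p * mass (indicator A) (λ x → base x ∧ eqm (priv x) (priv z))
    popular pos h with Σr-pigeonhole p (λ u → mass (indicator A) (λ x → base x ∧ eqm (priv x) u)) (s≤s z≤n)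
    ... | u , u<p , pop = z , subst (λ M → size A ≤ + p * + p * M) (mass-cong (indicator A) (λ x → cong (base x ∧_) (eqm-cong (≈-refl {priv x}) (≈-sym z≈u)))) bound
      where
      M = mass (indicator A) (λ x → base x ∧ eqm (priv x) u)
      lem : ∀ s p b M → p * p * M - s ≡ (p * b - s) + p * (p * M - b)
      lem = solve-∀
      bound : size A ≤ + p * + p * M
      bound = slack h ⊞ (0≤+ {p} ⊠ slack (subst (_≤ + p * M) (mass-partition (indicator A) base priv) pop))
        by lem (size A) (+ p) (mass (indicator A) base) M
      M-pos : 0ℤ < M
      M-pos with 0ℤ <? M
      ... | yes h = h
      ... | no ¬h = ⊥-elim (<-irrefl refl (<-≤-trans pos (≤-trans bound (≤-trans (*-monoˡ-≤-nonNeg (+ p * + p) (≮⇒≥ ¬h)) (≤-reflexive (*-zeroʳ (+ p * + p)))))))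
      wit = Σc-ind-witness (λ x → A x ∧ (base x ∧ eqm (priv x) u))
        (subst (0ℤ <_) (Σc-cong (λ x → sym (⟦∧⟧ (A x) (base x ∧ eqm (priv x) u)))) M-pos)
      z = proj₁ wit
      z≈u : priv z ≈ u
      z≈u = eqm⇒≈ {priv z} {u} (∧-right {base z} (∧-right {A z} (proj₂ wit)))

    module _ (z : Cube n) where

      B₀ : Cube n → Bool
      B₀ x = base x ∧ eqm (priv x) (priv z)

      Bᵤ : ℕ → Cube n → Bool
      Bᵤ u x = eqm (κ ℕ.* u ℕ.+ nsum (restr Tm ψ) x) v ∧ eqm (priv x) (priv z)

      J∖T⊑J : (J ∖ Tm) ⊑ J
      J∖T⊑J k h = ∧-left (trans (sym (lookup-zipWith (λ a b → a ∧ not b) k J Tm)) h)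

      Bᵤ-meas : ∀ u → Measurable J (Bᵤ u)
      Bᵤ-meas u x y a = cong₂ _∧_
        (eqm-cong (≈-+ (≈-refl {κ ℕ.* u}) (nsum-restr-agree Tm ψ x y (λ k h → a k (T⊑J k h)))) (≈-refl {v}))
        (eqm-cong (nsum-restr-agree (J ∖ Tm) ψ x y (λ k h → a k (J∖T⊑J k h))) (≈-refl {priv z}))

      rest : NForm n
      rest = restr (compl J) ψ

      E : Cube n → Bool
      E x = eqm (nsum rest x) (nsum rest z)

      switch : ∀ u x → nsum c x ≈ u → base x ≡ eqm (κ ℕ.* u ℕ.+ nsum (restr Tm ψ) x) v
      switch u x e = eqm-cong (≈-+ (≈-* (≈-refl {κ}) e) (≈-refl {nsum (restr Tm ψ) x})) (≈-refl {v})

      reaches-target : ∀ u x → (Bᵤ u x ∧ E x) ∧ eqm (nsum c x) u ≡ true → target z x ∧ eqm (nsum c x) u ≡ true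
      reaches-target u x h = ∧-true (≈⇒eqm eq) (∧-right {Bᵤ u x ∧ E x} h)
        where
        hB : Bᵤ u x ≡ true
        hB = ∧-left (∧-left h)
        c≈u = eqm⇒≈ {nsum c x} {u} (∧-right {Bᵤ u x ∧ E x} h)
        eq₁ : κ ℕ.* nsum c x ℕ.+ nsum (restr Tm ψ) x ≈ v
        eq₁ = eqm⇒≈ (trans (switch u x c≈u) (∧-left hB))
        eq₂ : nsum (restr (compl Tm) ψ) x ≈ nsum (restr (compl Tm) ψ) z
        eq₂ = ≈-trans (≡⇒≈ (nsum-∖ J Tm T⊑J ψ x)) (≈-trans
          (≈-+ (eqm⇒≈ {priv x} {priv z} (∧-right {eqm (κ ℕ.* u ℕ.+ nsum (restr Tm ψ) x) v} hB)) (eqm⇒≈ {nsum rest x} {nsum rest z} (∧-right {Bᵤ u x} (∧-left h))))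
          (≡⇒≈ (sym (nsum-∖ J Tm T⊑J ψ z))))
        eq : κ ℕ.* nsum c x ℕ.+ nsum ψ x ≈ v ℕ.+ nsum (restr (compl Tm) ψ) z
        eq = ≈-trans (≡⇒≈ (trans (cong (κ ℕ.* nsum c x ℕ.+_) (nsum-compl Tm ψ x)) (sym (ℕ.+-assoc (κ ℕ.* nsum c x) _ _)))) (≈-+ eq₁ eq₂)

      -- On the slice the term `κ c` is constant, so the base event depends only on coordinates in
      -- `J`, and `fresh` applies to the part of `ψ` outside `J`.
      per-slice : ∀ u → u ℕ.< p →
        R * mass (indicator A) (λ x → B₀ x ∧ eqm (nsum c x) u) ≤
        R * pow2 q * mass (indicator A) (λ x → target z x ∧ eqm (nsum c x) u) + + p * (pow2 q * P)
      per-slice u u<p = ≤-trans (≤-reflexive (cong (R *_) (trans (mass-cong (indicator A) same-event) (sym (mass-slice A c u (Bᵤ u))))))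
        (≤-trans (Fresh.fresh (slice A c u) (λ x → 0≤⟦⟧ (A x ∧ eqm (nsum c x) u)) r D J stable′ (Bᵤ u) (Bᵤ-meas u) rest off
            (ℕ.≤-trans (wt-restr (compl J) ψ) light) z)
         ((0≤+ {r} ⊠ 0≤+ {2 ℕ.^ q}) ⊠ slack sub by lem R (pow2 q) M M′ (+ p * (pow2 q * P))))
        where
        M = mass (slice A c u) (λ x → Bᵤ u x ∧ E x)
        M′ = mass (indicator A) (λ x → target z x ∧ eqm (nsum c x) u)
        lem : ∀ R Q M M′ e → (R * Q * M′ + e) - (R * Q * M + e) ≡ R * Q * (M′ - M)
        lem = solve-∀
        sub : M ≤ M′
        sub = ≤-trans (≤-reflexive (mass-slice A c u (λ x → Bᵤ u x ∧ E x))) (mass-mono (indicator-nonneg A) (reaches-target u))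
        same-event : ∀ x → B₀ x ∧ eqm (nsum c x) u ≡ Bᵤ u x ∧ eqm (nsum c x) u
        same-event x with eqm (nsum c x) u in e
        ... | true = cong (λ b → (b ∧ eqm (priv x) (priv z)) ∧ true) (switch u x (eqm⇒≈ {nsum c x} {u} e))
        ... | false = trans (∧-zeroʳ (B₀ x)) (sym (∧-zeroʳ (Bᵤ u x)))
        stable′ : ∀ I → ∣ I ∣ₘ ℕ.≤ D → + r * + r * (energy (J ∪ₘ I) (slice A c u) - energy J (slice A c u)) ≤ P * P
        stable′ I small = subst (λ w → w * (energy (J ∪ₘ I) (slice A c u) - energy J (slice A c u)) ≤ P * P) (pos-* r r) (stable I small (∈-slices A c∈ u<p))
        off : ∀ k → k ∈ₘ J → lookup rest k ≡ 0
        off k h = restr-out (compl J) ψ k (trans (lookup-map k not J) (cong not h))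

      local : R * mass (indicator A) B₀ ≤ R * pow2 q * mass (indicator A) (target z) + + p * (+ p * (pow2 q * P))
      local = subst₂ _≤_
        (trans (Σr-*ˡ p R (λ u → mass (indicator A) (λ x → B₀ x ∧ eqm (nsum c x) u))) (cong (R *_) (mass-partition (indicator A) B₀ (nsum c))))
        (trans (Σr-+ p (λ u → R * pow2 q * mass (indicator A) (λ x → target z x ∧ eqm (nsum c x) u)) (λ _ → + p * (pow2 q * P)))
          (cong₂ _+_ (trans (Σr-*ˡ p (R * pow2 q) (λ u → mass (indicator A) (λ x → target z x ∧ eqm (nsum c x) u)))
                            (cong (R * pow2 q *_) (mass-partition (indicator A) (target z) (nsum c))))
                     (Σr-const p (+ p * (pow2 q * P)))))
        (Σr-mono p per-slice)

      -- The error p⁴ 2^q 2^n has one factor p from the values of the revealed part in `fresh`, one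
      -- from the slices, and p² from the popular event.
      local-bound : size A ≤ + p * + p * mass (indicator A) B₀ →
        R * size A ≤ R * (+ p * + p * pow2 q) * mass (indicator A) (target z) + + p * + p * (+ p * + p) * pow2 q * P
      local-bound h = (0≤+ {r} ⊠ slack h) ⊞ ((0≤+ {p} ⊠ 0≤+ {p}) ⊠ slack local)
        by lem R (size A) (+ p) (pow2 q) (mass (indicator A) B₀) (mass (indicator A) (target z)) P
        where
        lem : ∀ R s p Q M M′ P → (R * (p * p * Q) * M′ + p * p * (p * p) * Q * P) - R * s ≡
          R * (p * p * M - s) + (p * p) * ((R * Q * M′ + p * (p * (Q * P))) - R * M)
        lem = solve-∀

  abstract
    popular-value : ∀ {n} (A : CubeSet n) (y : Cube n → ℕ) → ∃ λ v → v ℕ.< p × size A ≤ + p * mass (indicator A) (λ x → eqm (y x) v)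
    popular-value A y with Σr-pigeonhole p (λ v → mass (indicator A) (λ x → true ∧ eqm (y x) v)) (s≤s z≤n)
    ... | v , v<p , h = v , v<p , subst (_≤ + p * mass (indicator A) (λ x → eqm (y x) v))
        (trans (mass-partition (indicator A) (λ _ → true) y) (Σc-cong (λ x → *-identityʳ (indicator A x)))) h

  -- Nearness of forms

  Near : ∀ {n} → ℕ → NForm n → NForm n → Set
  Near D φ c = ∃ λ l → l ℕ.< p × wt (comb φ l c) ℕ.< D

  near? : ∀ {n} D (φ c : NForm n) → Dec (Near D φ c)
  near? D φ c = ℕ.anyUpTo? (λ l → wt (comb φ l c) ℕ.<? D) p

  ¬near⇒far : ∀ {n} D (φ c : NForm n) → ¬ Near D φ c → Far D φ c
  ¬near⇒far D φ c h l l<p = ℕ.≮⇒≥ (λ w → h (l , l<p , w))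

  wt-subadd : ∀ {n} (α β γ : NForm n) → (∀ k → lookup α k ≈ 0 → lookup β k ≈ 0 → lookup γ k ≈ 0) → wt γ ℕ.≤ wt α ℕ.+ wt β
  wt-subadd [] [] [] h = z≤n
  wt-subadd (a ∷ α) (b ∷ β) (c ∷ γ) h = ℕ.≤-trans (ℕ.+-mono-≤ head (wt-subadd α β γ (h ∘ suc)))
      (ℕ.≤-reflexive (lem (if eqm a 0 then 0 else 1) (if eqm b 0 then 0 else 1) (wt α) (wt β)))
    where
    lem : ∀ a b c d → (a ℕ.+ b) ℕ.+ (c ℕ.+ d) ≡ (a ℕ.+ c) ℕ.+ (b ℕ.+ d)
    lem = solveℕ
    head : (if eqm c 0 then 0 else 1) ℕ.≤ (if eqm a 0 then 0 else 1) ℕ.+ (if eqm b 0 then 0 else 1)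
    head with eqm a 0 in ea | eqm b 0 in eb
    ... | true | true rewrite ≈⇒eqm (h zero (eqm⇒≈ {a} {0} ea) (eqm⇒≈ {b} {0} eb)) = z≤n
    ... | true | false = le (eqm c 0)
      where
      le : ∀ b → (if b then 0 else 1) ℕ.≤ 1
      le true = z≤n
      le false = s≤s z≤n
    ... | false | b′ = ℕ.≤-trans (le (eqm c 0)) (s≤s z≤n)
      where
      le : ∀ b → (if b then 0 else 1) ℕ.≤ 1
      le true = z≤n
      le false = s≤s z≤n

  lookup-comb : ∀ {n} (φ : NForm n) l c k → lookup (comb φ l c) k ≡ lookup φ k ℕ.+ l ℕ.* lookup c k
  lookup-comb φ l c k = lookup-zipWith (λ a b → a ℕ.+ l ℕ.* b) k φ c

  -- If φ + l u and φ + m w are light, so is their difference m w - l u; division by `m` gives the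
  -- multiple -l/m of `u`. For m = 0 the form `φ` itself is light.
  near-join : ∀ {n} D (φ u w : NForm n) → Near D φ u → Near D φ w → wt φ ℕ.< D ⊎ Near (D ℕ.+ D) w u
  near-join D φ u w (l , _ , near-u) (zero , _ , near-w) = inj₁ (subst (λ v → wt v ℕ.< D) (comb-0 φ w) near-w)
  near-join D φ u w (l , _ , near-u) (m@(suc _) , m<p , near-w) = inj₂ (κ , m%n<n κ′ p ,
      ℕ.≤-<-trans (wt-subadd (comb φ l u) (comb φ m w) (comb w κ u) zero-imp) (ℕ.+-mono-<-≤ near-u (ℕ.<⇒≤ near-w)))
    where
    m≉0 : m ≉ 0
    m≉0 h with () ← trans (sym (m<n⇒m%n≡m m<p)) (_≈_.%-≡ h)
    m′ = proj₁ (inverse m m≉0)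
    κ′ = q ℕ.* (m′ ℕ.* l)
    κ = κ′ % p
    zero-imp : ∀ k → lookup (comb φ l u) k ≈ 0 → lookup (comb φ m w) k ≈ 0 → lookup (comb w κ u) k ≈ 0
    zero-imp k hu hw = ≈-trans (≡⇒≈ (lookup-comb w κ u k)) (≈-trans (≈-+ (≈-refl {d}) (≈-* (%-≈ κ′) (≈-refl {b})))
        (≈-trans (≈-+ d≈ (≈-refl {κ′ ℕ.* b})) (≈-trans (≡⇒≈ (r₃ m′ l b q)) (+q*-cancel 0 (m′ ℕ.* (l ℕ.* b))))))
      where
      a = lookup φ k
      b = lookup u k
      d = lookup w k
      md≈lb : m ℕ.* d ≈ l ℕ.* b
      md≈lb = ≈-cancelˡ a (≈-trans (≈-sym (≡⇒≈ (lookup-comb φ m w k))) (≈-trans hw (≈-trans (≈-sym hu) (≡⇒≈ (lookup-comb φ l u k)))))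
      r₁ : ∀ m′ m d → m′ ℕ.* (m ℕ.* d) ≡ m′ ℕ.* m ℕ.* d
      r₁ = solveℕ
      d≈ : d ≈ m′ ℕ.* (l ℕ.* b)
      d≈ = ≈-trans (≈-sym (≡⇒≈ (ℕ.*-identityˡ d))) (≈-trans (≈-* (≈-sym (proj₂ (inverse m m≉0))) (≈-refl {d}))
        (≈-trans (≡⇒≈ (sym (r₁ m′ m d))) (≈-* (≈-refl {m′}) md≈lb)))
      r₃ : ∀ m′ l b q → m′ ℕ.* (l ℕ.* b) ℕ.+ q ℕ.* (m′ ℕ.* l) ℕ.* b ≡ 0 ℕ.+ m′ ℕ.* (l ℕ.* b) ℕ.+ q ℕ.* (m′ ℕ.* (l ℕ.* b))
      r₃ = solveℕ

  near-trans : ∀ {n} D D′ (φ u c : NForm n) → Near D φ u → Near D′ u c → Near (D ℕ.+ D′) φ c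
  near-trans D D′ φ u c (l , _ , near-u) (m , _ , near-c) = κ , m%n<n κ′ p ,
      ℕ.≤-<-trans (wt-subadd (comb φ l u) (comb u m c) (comb φ κ c) zero-imp) (ℕ.+-mono-<-≤ near-u (ℕ.<⇒≤ near-c))
    where
    κ′ = q ℕ.* (l ℕ.* m)
    κ = κ′ % p
    zero-imp : ∀ k → lookup (comb φ l u) k ≈ 0 → lookup (comb u m c) k ≈ 0 → lookup (comb φ κ c) k ≈ 0
    zero-imp k hu hc = ≈-trans (≡⇒≈ (lookup-comb φ κ c k)) (≈-trans (≈-+ (≈-refl {a}) (≈-* (%-≈ κ′) (≈-refl {d})))
        (≈-cancelʳ (l ℕ.* (b ℕ.+ m ℕ.* d)) (≈-trans (≡⇒≈ (r a q l m d b)) (≈-trans (+q*-cancel (a ℕ.+ l ℕ.* b) (l ℕ.* m ℕ.* d))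
        (≈-trans (≈-sym (≡⇒≈ (lookup-comb φ l u k))) (≈-trans hu (≈-sym (≈-trans (≈-* (≈-refl {l}) (≈-trans (≈-sym (≡⇒≈ (lookup-comb u m c k))) hc)) (≡⇒≈ (ℕ.*-zeroʳ l))))))))))
      where
      a = lookup φ k
      b = lookup u k
      d = lookup c k
      r : ∀ a q l m d b → a ℕ.+ q ℕ.* (l ℕ.* m) ℕ.* d ℕ.+ l ℕ.* (b ℕ.+ m ℕ.* d) ≡ a ℕ.+ l ℕ.* b ℕ.+ l ℕ.* m ℕ.* d ℕ.+ q ℕ.* (l ℕ.* m ℕ.* d)
      r = solveℕ

  -- With coefficients below p, the restrictions to `T` run through the finite list `formsOn T` and
  -- can serve as keys for the pigeonholing.
  reduce : ∀ {n} → NForm n → NForm n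
  reduce = Vec.map (_% p)

  nsum-reduce : ∀ {n} (ψ : NForm n) x → nsum (reduce ψ) x ≈ nsum ψ x
  nsum-reduce [] [] = ≈-refl
  nsum-reduce (a ∷ ψ) (false ∷ x) = nsum-reduce ψ x
  nsum-reduce (a ∷ ψ) (true ∷ x) = ≈-+ (%-≈ a) (nsum-reduce ψ x)

  wt-reduce : ∀ {n} (ψ : NForm n) → wt (reduce ψ) ≡ wt ψ
  wt-reduce [] = refl
  wt-reduce (a ∷ ψ) = cong₂ (λ b w → (if b then 0 else 1) ℕ.+ w) (eqm-cong (%-≈ a) (≈-refl {0})) (wt-reduce ψ)

  formsOn : ∀ {n} → Mask n → List (NForm n)
  formsOn [] = [] ∷ []
  formsOn (true ∷ T) = cartesianProductWith _∷_ (upTo p) (formsOn T)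
  formsOn (false ∷ T) = map (0 ∷_) (formsOn T)

  length-formsOn : ∀ {n} (T : Mask n) → length (formsOn T) ≡ p ℕ.^ ∣ T ∣ₘ
  length-formsOn [] = refl
  length-formsOn (true ∷ T) = trans (length-product _∷_ (upTo p) (formsOn T)) (cong₂ ℕ._*_ (length-upTo p) (length-formsOn T))
  length-formsOn (false ∷ T) = trans (length-map (0 ∷_) (formsOn T)) (length-formsOn T)

  ∈-formsOn : ∀ {n} (T : Mask n) ψ → restr T (reduce ψ) ∈ formsOn T
  ∈-formsOn [] [] = here refl
  ∈-formsOn (true ∷ T) (a ∷ ψ) = ∈-cartesianProductWith⁺ _∷_ (∈-upTo⁺ (m%n<n a p)) (∈-formsOn T ψ)
  ∈-formsOn (false ∷ T) (a ∷ ψ) = ∈-map⁺ (0 ∷_) (∈-formsOn T ψ)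

  -- `t` majorises both possible losses: 2p for a form that is not near the core, and p² 2^q for one
  -- that is.
  Q t : ℕ
  Q = 2 ℕ.^ q
  t = Q ℕ.* Q ℕ.* Q

  p≤Q : p ℕ.≤ Q
  p≤Q = go q
    where
    go : ∀ k → suc k ℕ.≤ 2 ℕ.^ k
    go zero = ℕ.≤-refl
    go (suc k) = ℕ.≤-trans (s≤s (go k)) (ℕ.≤-trans (ℕ.+-monoˡ-≤ (2 ℕ.^ k) (ℕ.m^n>0 2 k)) (ℕ.≤-reflexive (cong (2 ℕ.^ k ℕ.+_) (sym (ℕ.+-identityʳ _)))))

  1≤Q : 1 ℕ.≤ Q
  1≤Q = ℕ.m^n>0 2 q

  2p≤t : 2 ℕ.* p ℕ.≤ t
  2p≤t = ℕ.≤-trans (ℕ.*-mono-≤ (ℕ.≤-trans (s≤s q-positive) p≤Q) p≤Q) (ℕ.≤-trans (ℕ.≤-reflexive (sym (ℕ.*-identityʳ _))) (ℕ.*-monoʳ-≤ (Q ℕ.* Q) 1≤Q))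

  ppQ≤t : p ℕ.* p ℕ.* Q ℕ.≤ t
  ppQ≤t = ℕ.*-monoˡ-≤ Q (ℕ.*-mono-≤ p≤Q p≤Q)

  fromList : ∀ {n} → List (Fin n) → Mask n
  fromList {n} [] = replicate n false
  fromList (c ∷ C) = add c (fromList C)

  ∣add∣ : ∀ {n} (k : Fin n) J → ∣ add k J ∣ₘ ℕ.≤ suc ∣ J ∣ₘ
  ∣add∣ zero (true ∷ J) = ℕ.n≤1+n _
  ∣add∣ zero (false ∷ J) = ℕ.≤-refl
  ∣add∣ (suc k) (true ∷ J) = s≤s (∣add∣ k J)
  ∣add∣ (suc k) (false ∷ J) = ∣add∣ k J

  ∣fromList∣ : ∀ {n} (C : List (Fin n)) → ∣ fromList C ∣ₘ ℕ.≤ length C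
  ∣fromList∣ {n} [] = ℕ.≤-reflexive (∣empty∣ n)
  ∣fromList∣ (c ∷ C) = ℕ.≤-trans (∣add∣ c (fromList C)) (s≤s (∣fromList∣ C))

  ∈-fromList : ∀ {n} {C : List (Fin n)} {k} → k ∈ C → k ∈ₘ fromList C
  ∈-fromList {C = c ∷ C} (here refl) = ∈-add c (fromList C)
  ∈-fromList {C = c ∷ C} {k} (there k∈) = ⊑-add c (fromList C) k (∈-fromList k∈)

  ∈-fromList⁻ : ∀ {n} (C : List (Fin n)) k → k ∈ₘ fromList C → k ∈ C
  ∈-fromList⁻ {n} [] k h with () ← trans (sym (lookup-replicate k false)) h
  ∈-fromList⁻ (c ∷ C) k h with add-elim c (fromList C) k h
  ... | inj₁ refl = here refl
  ... | inj₂ h′ = there (∈-fromList⁻ C k h′)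

  choose : ∀ {n} → Mask n → Cube n → Cube n → Cube n
  choose J x y = tabulate (λ k → if lookup J k then lookup x k else lookup y k)

  ∖-elim : ∀ {n} (J T : Mask n) k → k ∈ₘ (J ∖ T) → k ∈ₘ J × ¬ (k ∈ₘ T)
  ∖-elim J T k h = ∧-left {lookup J k} e , λ kT → false≢true (trans (cong not (sym kT)) (∧-right {lookup J k} e))
    where
    e : lookup J k ∧ not (lookup T k) ≡ true
    e = trans (sym (lookup-zipWith (λ a b → a ∧ not b) k J T)) h
    false≢true : ¬ (false ≡ true)
    false≢true ()

  glue : ∀ {n} {X : Set} (M : X → Mask n) (Good : X → Cube n → Set) ts →
    All (λ i → ∃ (Good i)) ts → AllPairs (λ i j → ∀ k → k ∈ₘ M i → k ∈ₘ M j → ⊥) ts →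
    ∃ λ z → All (λ i → ∃ λ zᵢ → Good i zᵢ × Agree (M i) z zᵢ) ts
  glue {n} M Good [] [] [] = replicate n false , []
  glue M Good (i ∷ ts) ((zᵢ , g) ∷ gs) (d ∷ ds) =
    choose (M i) zᵢ z′ , (zᵢ , g , λ k h → trans (lookup∘tabulate _ k) (cong (λ b → if b then lookup zᵢ k else lookup z′ k) h)) ∷
    keep ts d (proj₂ rec)
    where
    rec = glue M Good ts gs ds
    z′ = proj₁ rec
    keep : ∀ ts → All (λ j → ∀ k → k ∈ₘ M i → k ∈ₘ M j → ⊥) ts → All (λ j → ∃ λ zⱼ → Good j zⱼ × Agree (M j) z′ zⱼ) ts →
      All (λ j → ∃ λ zⱼ → Good j zⱼ × Agree (M j) (choose (M i) zᵢ z′) zⱼ) ts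
    keep [] [] [] = []
    keep (j ∷ ts) (dj ∷ d) ((zⱼ , g , a) ∷ as) = (zⱼ , g , λ k h → trans (lookup∘tabulate _ k)
      (trans (cong (λ b → if b then lookup zᵢ k else lookup z′ k) (not-true {lookup (M i) k} (λ ki → dj k ki h))) (a k h))) ∷ keep ts d as

  does⇒ : ∀ {P : Set} (d : Dec P) → does d ≡ true → P
  does⇒ (yes p) _ = p

  -- The three passages to subfamilies.

  module Regularise (a : ℕ) (a≥1 : 1 ℕ.≤ a) (G : ℕ) (G≥1 : 1 ℕ.≤ G) (E : ℕ) (E≥1 : 1 ℕ.≤ E) where

    open Centers a using (radius; centers; centers-exist; Spread)

    F D₃ L r K₂ keyCount M₃ E₂ M₂ M₂₃ E₁ M₁ M : ℕ
    F = p ℕ.* p ℕ.* (p ℕ.* p) ℕ.* Q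
    -- `radius` from a form to a centre, and twice that from the centre to the core.
    D₃ = radius ℕ.+ (radius ℕ.+ radius)
    L = suc centers
    -- Division by `r` turns the error F 2^n of `local-bound` into 2^n / G.
    r = G ℕ.* F
    K₂ = suc (stable-bound D₃ (r ℕ.* r) (L ℕ.* p))
    -- `suc p` and not `p`: the multiplier `p ∸ l` takes the value p at l = 0.
    keyCount = L ℕ.* (suc p ℕ.* p ℕ.^ K₂)
    M₃ = p ℕ.^ keyCount
    -- A later subfamily of proportion 1/M₃ may contain all bad pairs, whose proportion then grows
    -- by M₃². The factor two shares the allowance between the two kinds of clash.
    E₂ = (E ℕ.+ E) ℕ.* (M₃ ℕ.* M₃)
    M₂ = (E₂ ℕ.* K₂) ℕ.^ K₂
    M₂₃ = M₂ ℕ.* M₃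
    E₁ = (E ℕ.+ E) ℕ.* (M₂₃ ℕ.* M₂₃)
    M₁ = (E₁ ℕ.* centers) ℕ.^ centers
    M = M₁ ℕ.* M₂₃

    1≤* : ∀ {x y} → 1 ℕ.≤ x → 1 ℕ.≤ y → 1 ℕ.≤ x ℕ.* y
    1≤* = ℕ.*-mono-≤

    1≤^ : ∀ {x} k → 1 ℕ.≤ x → 1 ℕ.≤ x ℕ.^ k
    1≤^ {x} k h = ℕ.m^n>0 x {{ℕ.>-nonZero h}} k

    1≤M₃ : 1 ℕ.≤ M₃
    1≤M₃ = 1≤^ keyCount (s≤s z≤n)

    1≤2E : 1 ℕ.≤ E ℕ.+ E
    1≤2E = ℕ.≤-trans E≥1 (ℕ.m≤m+n E E)

    1≤E₂ : 1 ℕ.≤ E₂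
    1≤E₂ = 1≤* 1≤2E (1≤* 1≤M₃ 1≤M₃)

    1≤M₂₃ : 1 ℕ.≤ M₂₃
    1≤M₂₃ = 1≤* (1≤^ K₂ (1≤* 1≤E₂ (s≤s z≤n))) 1≤M₃

    1≤E₁ : 1 ℕ.≤ E₁
    1≤E₁ = 1≤* 1≤2E (1≤* 1≤M₂₃ 1≤M₂₃)

    1≤M : 1 ℕ.≤ M
    1≤M = 1≤* (1≤^ centers (1≤* 1≤E₁ (s≤s z≤n))) 1≤M₂₃

    1≤F : 1 ℕ.≤ F
    1≤F = 1≤* {p ℕ.* p ℕ.* (p ℕ.* p)} (s≤s z≤n) 1≤Q

    transfer : ∀ H M x N N₁ → 1 ℕ.≤ M → (H ℕ.* (M ℕ.* M)) ℕ.* x ℕ.≤ N₁ ℕ.* N₁ → N₁ ℕ.≤ M ℕ.* N → H ℕ.* x ℕ.≤ N ℕ.* N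
    transfer H M x N N₁ 1≤M few big = ℕ.*-cancelˡ-≤ (M ℕ.* M) {{ℕ.>-nonZero (1≤* 1≤M 1≤M)}}
      (ℕ.≤-trans (ℕ.≤-reflexive (l₁ H M x)) (ℕ.≤-trans few (ℕ.≤-trans (ℕ.*-mono-≤ big big) (ℕ.≤-reflexive (l₂ M N)))))
      where
      l₁ : ∀ H M x → M ℕ.* M ℕ.* (H ℕ.* x) ≡ H ℕ.* (M ℕ.* M) ℕ.* x
      l₁ = solveℕ
      l₂ : ∀ M N → M ℕ.* N ℕ.* (M ℕ.* N) ≡ M ℕ.* M ℕ.* (N ℕ.* N)
      l₂ = solveℕ

    module _ {n : ℕ} {X : Set} (A : X → CubeSet n) (xs : List X) (nonempty : ∀ i → 0ℤ < size (A i))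
      (dense : ∀ i → pow2 n ≤ + a * size (A i)) where

      P = pow2 n

      Common : List X → Form p n → ℕ → Set
      Common ts φ d = All (λ i → + G * size (A i) ≤ + G * + t * hits (A i) (toN φ) d + P) ts

      abstract
        centersOf : ∀ i → ∃ λ V → length V ℕ.≤ centers × Spread (A i) a≥1 (dense i) V
        centersOf i = centers-exist (A i) a≥1 (dense i)

      V : X → List (NForm n)
      V i = proj₁ (centersOf i)

      -- Twice the radius is what `near-join` yields for two centres near the same heavy form.
      simF : NForm n → NForm n → Bool
      simF u w = does (near? (radius ℕ.+ radius) w u)

      module S₁ = Sunflower simF V E₁ centers 1≤E₁ (s≤s z≤n)

      abstract
        stage₁ : S₁.Flower xs
        stage₁ = S₁.sunflower xs (λ {i} _ → proj₁ (proj₂ (centersOf i)))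

      open S₁.Flower stage₁ using () renaming
        (sel to q₁; core to C₁; core-small to C₁-small; large to size₁; few to few-clash₁)
      ys₁ = filterᵇ q₁ xs

      -- The zero form is adjoined so that a form which is light itself also counts as near the
      -- core.
      C : List (NForm n)
      C = replicate n 0 ∷ C₁

      abstract
        stable-J : ∀ i → ∃ λ J → ∣ J ∣ₘ ℕ.≤ stable-bound D₃ (r ℕ.* r) (length (slices (A i) C)) × Stable D₃ (r ℕ.* r) (slices (A i) C) J
        stable-J i = stable-mask D₃ (r ℕ.* r) (slices (A i) C) (slices-bounded (A i) C)

      J : X → Mask n
      J i = proj₁ (stable-J i)

      length-J : ∀ i → length (elems (J i)) ℕ.≤ K₂
      length-J i = ℕ.≤-trans (ℕ.≤-reflexive (length-elems (J i))) (ℕ.≤-trans (proj₁ (proj₂ (stable-J i)))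
        (ℕ.≤-trans (ℕ.*-monoˡ-≤ D₃ (s≤s (ℕ.*-monoʳ-≤ (r ℕ.* r) (ℕ.≤-trans (ℕ.≤-reflexive (length-slices (A i) C))
          (ℕ.*-monoˡ-≤ p (s≤s C₁-small))))))
        (ℕ.n≤1+n _)))

      simC : Fin n → Fin n → Bool
      simC j k = does (j Fin.≟ k)

      module S₂ = Sunflower simC (elems ∘ J) E₂ K₂ 1≤E₂ (s≤s z≤n)

      abstract
        stage₂ : S₂.Flower ys₁
        stage₂ = S₂.sunflower ys₁ (λ {i} _ → length-J i)

      open S₂.Flower stage₂ using () renaming
        (sel to q₂; core to C₂; core-small to C₂-small; large to size₂; few to few-clash₂; core-common to C₂-common)
      ys₂ = filterᵇ q₂ ys₁

      Tm : Mask n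
      Tm = fromList C₂

      T⊑J : ∀ {i} → i ∈ ys₂ → Tm ⊑ J i
      T⊑J {i} i∈ k h with anyB-elim (elems (J i)) (C₂-common (∈-fromList⁻ C₂ k h) i∈)
      ... | w , w∈ , e with refl ← does⇒ (k Fin.≟ w) e = elems⁻ (J i) w∈

      Key : Set
      Key = NForm n × ℕ × NForm n

      keys : List Key
      keys = cartesianProduct C (cartesianProduct (upTo (suc p)) (formsOn Tm))

      read : Key → Cube n → ℕ
      read (c , κ , χ) x = κ ℕ.* nsum c x ℕ.+ nsum χ x

      colour : Key → X → ℕ
      colour k i = proj₁ (popular-value (A i) (read k))

      abstract
        stage₃ : ∃ λ sel → length ys₂ ℕ.≤ p ℕ.^ length keys ℕ.* length (filterᵇ sel ys₂) ×
          (∀ {κ} → κ ∈ keys → ∃ λ v → ∀ {i} → i ∈ filterᵇ sel ys₂ → colour κ i ≡ v)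
        stage₃ = monochromatic p colour (λ k i → proj₁ (proj₂ (popular-value (A i) (read k)))) keys ys₂

      q₃ = proj₁ stage₃
      ys₃ = filterᵇ q₃ ys₂

      length-keys : length keys ℕ.≤ keyCount
      length-keys = ℕ.≤-trans (ℕ.≤-reflexive (length-product _,_ C (cartesianProduct (upTo (suc p)) (formsOn Tm)))) (ℕ.*-mono-≤ (s≤s C₁-small)
        (ℕ.≤-trans (ℕ.≤-reflexive (trans (length-product _,_ (upTo (suc p)) (formsOn Tm)) (cong₂ ℕ._*_ (length-upTo (suc p)) (length-formsOn Tm))))
          (ℕ.*-monoʳ-≤ (suc p) (ℕ.^-monoʳ-≤ p (ℕ.≤-trans (∣fromList∣ C₂) C₂-small)))))

      size₃ : length ys₂ ℕ.≤ M₃ ℕ.* length ys₃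
      size₃ = ℕ.≤-trans (proj₁ (proj₂ stage₃)) (ℕ.*-monoˡ-≤ (length ys₃) (ℕ.^-monoʳ-≤ p length-keys))

      size₂₃ : length ys₁ ℕ.≤ M₂₃ ℕ.* length ys₃
      size₂₃ = ℕ.≤-trans size₂ (ℕ.≤-trans (ℕ.*-monoʳ-≤ M₂ size₃) (ℕ.≤-reflexive (sym (ℕ.*-assoc M₂ M₃ (length ys₃)))))

      size₁₂₃ : length xs ℕ.≤ M ℕ.* length ys₃
      size₁₂₃ = ℕ.≤-trans size₁ (ℕ.≤-trans (ℕ.*-monoʳ-≤ M₁ size₂₃) (ℕ.≤-reflexive (sym (ℕ.*-assoc M₁ M₂₃ (length ys₃)))))

      bad : X → X → Bool
      bad i j = S₁.clash C₁ i j ∨ S₂.clash C₂ i j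

      few-bad : E ℕ.* pairs ys₃ bad ℕ.≤ length ys₃ ℕ.* length ys₃
      few-bad = halve-ℕ (ℕ.≤-trans (ℕ.*-monoʳ-≤ (E ℕ.+ E) split)
          (ℕ.≤-trans (ℕ.≤-reflexive (ℕ.*-distribˡ-+ (E ℕ.+ E) p₁ p₂)) (ℕ.+-mono-≤ few₁ few₂)))
        where
        N = length ys₃
        p₁ = pairs ys₃ (S₁.clash C₁)
        p₂ = pairs ys₃ (S₂.clash C₂)
        split : pairs ys₃ bad ℕ.≤ p₁ ℕ.+ p₂
        split = ℕ.≤-trans (sumL-mono ys₃ (λ {i} _ → countB-∨ (S₁.clash C₁ i) (S₂.clash C₂ i) ys₃))
          (ℕ.≤-reflexive (sumL-+ (λ i → countB (S₁.clash C₁ i) ys₃) (λ i → countB (S₂.clash C₂ i) ys₃) ys₃))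
        few₁ : (E ℕ.+ E) ℕ.* p₁ ℕ.≤ N ℕ.* N
        few₁ = transfer (E ℕ.+ E) M₂₃ p₁ N (length ys₁) 1≤M₂₃
          (ℕ.≤-trans (ℕ.*-monoʳ-≤ E₁ (ℕ.≤-trans (pairs-filterᵇ q₃ ys₂ _) (pairs-filterᵇ q₂ ys₁ _))) few-clash₁) size₂₃
        few₂ : (E ℕ.+ E) ℕ.* p₂ ℕ.≤ N ℕ.* N
        few₂ = transfer (E ℕ.+ E) M₃ p₂ N (length ys₂) 1≤M₃
          (ℕ.≤-trans (ℕ.*-monoʳ-≤ E₂ (pairs-filterᵇ q₃ ys₂ _)) few-clash₂) size₃
        halve-ℕ : ∀ {x y} → (E ℕ.+ E) ℕ.* x ℕ.≤ y ℕ.+ y → E ℕ.* x ℕ.≤ y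
        halve-ℕ {x} {y} h = ℕ.*-cancelˡ-≤ 2 (ℕ.≤-trans (ℕ.≤-reflexive (l₁ E x)) (ℕ.≤-trans h (ℕ.≤-reflexive (l₂ y))))
          where
          l₁ : ∀ E x → 2 ℕ.* (E ℕ.* x) ≡ (E ℕ.+ E) ℕ.* x
          l₁ = solveℕ
          l₂ : ∀ y → y ℕ.+ y ≡ 2 ℕ.* y
          l₂ = solveℕ

      hits-nonneg : ∀ i φ d → 0ℤ ≤ hits (A i) (toN φ) d
      hits-nonneg i φ d = mass-nonneg (indicator-nonneg (A i))

      common-from-2p : ∀ i φ d → size (A i) ≤ + 2 * + p * hits (A i) (toN φ) d →
        + G * size (A i) ≤ + G * + t * hits (A i) (toN φ) d + P
      common-from-2p i φ d h = (0≤+ {G} ⊠ (slack h ⊞ (slack 2p≤t′ ⊠ hits-nonneg i φ d))) ⊞ 0≤+ {2 ℕ.^ n}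
        by lem (+ G) (+ t) (+ p) (size (A i)) (hits (A i) (toN φ) d) P
        where
        2p≤t′ : + 2 * + p ≤ + t
        2p≤t′ = subst (_≤ + t) (pos-* 2 p) (+≤+ 2p≤t)
        lem : ∀ G t p s h P → (G * t * h + P) - G * s ≡ G * ((+ 2 * p * h - s) + (t - + 2 * p) * h) + P
        lem = solve-∀

      -- A common value for every form.

      Structured : Form p n → X → Set
      Structured φ i = Any (Near radius (toN φ)) (V i)

      unstructured : ∀ φ i → ¬ Structured φ i → ∀ d → d ℕ.< p → + G * size (A i) ≤ + G * + t * hits (A i) (toN φ) d + P
      unstructured φ i h d d<p = common-from-2p i φ d (proj₂ (proj₂ (centersOf i)) φ
        (All.map (λ {c} → ¬near⇒far radius (toN φ) c) (All.¬Any⇒All¬ (V i) h)) d d<p)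

      spread-case : ∀ φ ts → AllPairs (λ i j → ¬ (Structured φ i × Structured φ j)) ts → ∃ λ d → d ℕ.< p × Common ts φ d
      spread-case φ [] [] = 0 , s≤s z≤n , []
      spread-case φ (i ∷ ts) (ap ∷ aps) with Any.any? (near? radius (toN φ)) (V i)
      ... | no ¬s = let (d , d<p , h) = spread-case φ ts aps in d , d<p , unstructured φ i ¬s d d<p ∷ h
      ... | yes s = d , d<p , common-from-2p i φ d 2p-bound ∷ All.map (λ {j} h → unstructured φ j (λ s′ → h (s , s′)) d d<p) ap
        where
        pop = popular-value (A i) (nsum (toN φ))
        d = proj₁ pop
        d<p = proj₁ (proj₂ pop)
        lem : ∀ p s h → + 2 * p * h - s ≡ (p * h - s) + p * h
        lem = solve-∀
        2p-bound : size (A i) ≤ + 2 * + p * hits (A i) (toN φ) d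
        2p-bound = slack (proj₂ (proj₂ pop)) ⊞ (0≤+ {p} ⊠ hits-nonneg i φ d) by lem (+ p) (size (A i)) (hits (A i) (toN φ) d)

      -- A form that is structured for two members is near a centre of each, so these two centres
      -- are similar and one of them is near the core.
      far-from-core : ∀ φ → ¬ Any (Near D₃ (toN φ)) C → ∀ i j → S₁.clash C₁ i j ≡ false → ¬ (Structured φ i × Structured φ j)
      far-from-core φ far i j ok (si , sj) with find si | find sj
      ... | u , u∈ , nu | w , w∈ , nw = go (near-join radius (toN φ) u w nu nw)
        where
        D = radius
        from-core : ∀ v → Near D (toN φ) v → S₁.covered C₁ v ≡ true → ⊥
        from-core v nv cov with anyB-elim C₁ cov
        ... | c , c∈ , e = far (there (Any.map (λ { refl → near-trans D (D ℕ.+ D) (toN φ) v c nv (does⇒ (near? (D ℕ.+ D) v c) e) }) c∈))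
        go : wt (toN φ) ℕ.< D ⊎ Near (D ℕ.+ D) w u → ⊥
        go (inj₁ light) = far (here (0 , s≤s z≤n , subst (λ v → wt v ℕ.< D₃) (sym (comb-0 (toN φ) (replicate n 0))) (ℕ.<-≤-trans light (ℕ.m≤m+n D (D ℕ.+ D)))))
        go (inj₂ near) with S₁.no-clash C₁ i j ok u∈ w∈ (dec-true (near? (D ℕ.+ D) w u) near)
        ... | inj₁ cov = from-core u nu cov
        ... | inj₂ cov = from-core w nw cov

      module _ (φ : Form p n) {c : NForm n} (c∈ : c ∈ C) (l : ℕ) (l<p : l ℕ.< p) (light : wt (comb (toN φ) l c) ℕ.< D₃) where

        -- Minus `l` modulo p, so that `φ` is κ c + ψ.
        κ : ℕ
        κ = p ℕ.∸ l
        ψ : NForm n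
        ψ = reduce (comb (toN φ) l c)
        key : Key
        key = c , κ , restr Tm ψ

        key∈ : key ∈ keys
        key∈ = ∈-cartesianProduct⁺ c∈ (∈-cartesianProduct⁺ (∈-upTo⁺ (s≤s (ℕ.m∸n≤m p l))) (∈-formsOn Tm (comb (toN φ) l c)))

        v : ℕ
        v = proj₁ (proj₂ (proj₂ stage₃) key∈)

        ψ-light : wt ψ ℕ.≤ D₃
        ψ-light = ℕ.≤-trans (ℕ.≤-reflexive (wt-reduce (comb (toN φ) l c))) (ℕ.<⇒≤ light)

        module At {i : X} (i∈ : i ∈ ys₃) = Local (A i) C r D₃ (J i) Tm (T⊑J (proj₁ (∈-filterᵇ⁻ q₃ ys₂ i∈))) (proj₂ (proj₂ (stable-J i))) c∈ κ ψ ψ-light v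

        priv : X → Cube n → ℕ
        priv i x = nsum (restr (J i ∖ Tm) ψ) x

        base : Cube n → Bool
        base x = eqm (read key x) v

        Good : X → Cube n → Set
        Good i z = i ∈ ys₃ × size (A i) ≤ + p * + p * mass (indicator (A i)) (λ x → base x ∧ eqm (priv i x) (priv i z))

        good : ∀ {i} → i ∈ ys₃ → ∃ (Good i)
        good {i} i∈ = let (z , h) = At.popular i∈ (nonempty i)
                                      (subst (λ w → size (A i) ≤ + p * mass (indicator (A i)) (λ x → eqm (read key x) w))
                                         (proj₂ (proj₂ (proj₂ stage₃) key∈) i∈) (proj₂ (proj₂ (popular-value (A i) (read key)))))
                      in z , i∈ , h

        agree-target : ∀ x z → eqm (κ ℕ.* nsum c x ℕ.+ nsum ψ x) (v ℕ.+ nsum (restr (compl Tm) ψ) z) ≡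
                               eqm (nsum (toN φ) x) ((v ℕ.+ nsum (restr (compl Tm) ψ) z) % p)
        agree-target x z = eqm-cong eq (≈-sym (%-≈ (v ℕ.+ nsum (restr (compl Tm) ψ) z)))
          where
          s = nsum (toN φ) x
          w = nsum c x
          lem : ∀ κ l s w → κ ℕ.* w ℕ.+ (s ℕ.+ l ℕ.* w) ≡ s ℕ.+ w ℕ.* (κ ℕ.+ l)
          lem = solveℕ
          eq : κ ℕ.* w ℕ.+ nsum ψ x ≈ s
          eq = ≈-trans (≈-+ (≈-refl {κ ℕ.* w}) (≈-trans (nsum-reduce (comb (toN φ) l c) x) (≡⇒≈ (nsum-comb (toN φ) l c x))))
            (≈-trans (≡⇒≈ (trans (lem κ l s w) (cong (λ y → s ℕ.+ w ℕ.* y) (ℕ.m∸n+n≡m (ℕ.<⇒≤ l<p))))) (+kp s w))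

        -- The glued point has to agree with `zᵢ` only where the private value is read. On the
        -- coordinates outside `J i` it may be arbitrary, as the fresh coordinates can produce
        -- whatever value the form attains there.
        conclude : ∀ {i} z zᵢ → Good i zᵢ → Agree (J i ∖ Tm) z zᵢ →
          + G * size (A i) ≤ + G * + t * hits (A i) (toN φ) ((v ℕ.+ nsum (restr (compl Tm) ψ) z) % p) + P
        conclude {i} z zᵢ (i∈ , h) agree =
          *-cancelˡ-≤-pos (+ G * size (A i)) (+ G * + t * H + P) (+ F) {{pos 1≤F}}
            (slack bound ⊞ ((0≤+ {G} ⊠ 0≤+ {F}) ⊠ (slack ppQ≤t′ ⊠ hits-nonneg i φ d))
             by lem (+ G) (+ F) (size (A i)) H (+ p * + p * + Q) (+ t) P)
          where
          pos : ∀ {k} → 1 ℕ.≤ k → Positive (+ k)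
          pos {suc k} _ = _
          d = (v ℕ.+ nsum (restr (compl Tm) ψ) z) % p
          H = hits (A i) (toN φ) d
          h′ : size (A i) ≤ + p * + p * mass (indicator (A i)) (λ x → base x ∧ eqm (priv i x) (priv i z))
          h′ = subst (λ w → size (A i) ≤ + p * + p * w) (mass-cong (indicator (A i)) (λ x → cong (base x ∧_)
                 (eqm-cong (≈-refl {priv i x}) (≈-sym (nsum-restr-agree (J i ∖ Tm) ψ z zᵢ agree))))) h
          ppQ≤t′ : + p * + p * + Q ≤ + t
          ppQ≤t′ = subst (_≤ + t) (trans (pos-* (p ℕ.* p) Q) (cong (_* + Q) (pos-* p p))) (+≤+ ppQ≤t)
          bound : + G * + F * size (A i) ≤ + G * + F * (+ p * + p * + Q) * H + + F * P
          bound = subst₂ (λ R F → R * size (A i) ≤ R * (+ p * + p * + Q) * H + F * P) (pos-* G F) (sym F-eq)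
            (subst (λ w → + r * size (A i) ≤ + r * (+ p * + p * + Q) * w + + p * + p * (+ p * + p) * + Q * P)
              (mass-cong (indicator (A i)) (λ x → agree-target x z)) (At.local-bound i∈ z h′))
            where
            F-eq : + F ≡ + p * + p * (+ p * + p) * + Q
            F-eq = trans (pos-* (p ℕ.* p ℕ.* (p ℕ.* p)) Q) (cong (_* + Q) (trans (pos-* (p ℕ.* p) (p ℕ.* p)) (cong₂ _*_ (pos-* p p) (pos-* p p))))
          lem : ∀ G F s H k t P → F * (G * t * H + P) - F * (G * s) ≡ (G * F * k * H + F * P - G * F * s) + G * F * ((t - k) * H)
          lem = solve-∀

        value : Cube n → ℕ
        value z = (v ℕ.+ nsum (restr (compl Tm) ψ) z) % p

        Glued : Cube n → X → Set
        Glued z i = ∃ λ zᵢ → Good i zᵢ × Agree (J i ∖ Tm) z zᵢ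

        conclude-all : ∀ z ts → All (Glued z) ts → Common ts φ (value z)
        conclude-all z [] [] = []
        conclude-all z (i ∷ ts) ((zᵢ , g , agree) ∷ gs) = conclude {i} z zᵢ g agree ∷ conclude-all z ts gs

        unglue : ∀ ts → (∃ λ z → All (Glued z) ts) → ∃ λ d → d ℕ.< p × Common ts φ d
        unglue ts (z , gs) = value z , m%n<n (v ℕ.+ nsum (restr (compl Tm) ψ) z) p , conclude-all z ts gs

        core-case : ∀ ts → All (_∈ ys₃) ts → AllPairs (λ i j → S₂.clash C₂ i j ≡ false) ts → ∃ λ d → d ℕ.< p × Common ts φ d
        core-case ts ts∈ ok = unglue ts (glue (λ i → J i ∖ Tm) Good ts (All.map (λ {i} → good {i}) ts∈) (AllPairs.map (λ {i} {j} → disjoint {i} {j}) ok))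
          where
          disjoint : ∀ {i j} → S₂.clash C₂ i j ≡ false → ∀ k → k ∈ₘ (J i ∖ Tm) → k ∈ₘ (J j ∖ Tm) → ⊥
          disjoint {i} {j} none k ki kj = go (S₂.no-clash C₂ i j none (elems⁺ (J i) k (proj₁ (∖-elim (J i) Tm k ki)))
                                                                 (elems⁺ (J j) k (proj₁ (∖-elim (J j) Tm k kj))) (dec-true (k Fin.≟ k) refl))
            where
            cov : S₂.covered C₂ k ≡ true → ⊥
            cov e with anyB-elim C₂ e
            ... | c , c∈ , e′ with refl ← does⇒ (c Fin.≟ k) e′ = proj₂ (∖-elim (J i) Tm k ki) (∈-fromList c∈)
            go : S₂.covered C₂ k ≡ true ⊎ S₂.covered C₂ k ≡ true → ⊥
            go (inj₁ e) = cov e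
            go (inj₂ e) = cov e

      common-value : ∀ {m} (t : Vec X m) → All (_∈ ys₃) (toList t) → badTuple bad t ≡ false → ∀ φ → ∃ λ d → d ℕ.< p × Common (toList t) φ d
      common-value t t∈ ok φ with Any.any? (near? D₃ (toN φ)) C
      ... | no far = spread-case φ (toList t) (AllPairs.map (λ {i} {j} h → far-from-core φ far i j (left h)) (badTuple⇒AllPairs bad t ok))
        where
        left : ∀ {a b} → a ∨ b ≡ false → a ≡ false
        left {false} _ = refl
      ... | yes near = go (find near)
        where
        right : ∀ {a b} → a ∨ b ≡ false → b ≡ false
        right {false} h = h
        go : (∃ λ c → c ∈ C × Near D₃ (toN φ) c) → _
        go (c , c∈ , l , l<p , light) = core-case φ c∈ l l<p light (toList t) t∈
          (AllPairs.map (λ {i} {j} h → right {S₁.clash C₁ i j} h) (badTuple⇒AllPairs bad t ok))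

      regularise : ∃ λ sel → ∃ λ (bad : X → X → Bool) → length xs ℕ.≤ M ℕ.* length (filterᵇ sel xs) ×
        E ℕ.* pairs (filterᵇ sel xs) bad ℕ.≤ length (filterᵇ sel xs) ℕ.* length (filterᵇ sel xs) ×
        (∀ {m} (t : Vec X m) → All (_∈ filterᵇ sel xs) (toList t) → badTuple bad t ≡ false → ∀ φ → ∃ λ d → d ℕ.< p × Common (toList t) φ d)
      regularise = (λ i → q₁ i ∧ (q₂ i ∧ q₃ i)) , bad ,
        subst (λ zs → length xs ℕ.≤ M ℕ.* length zs) eq size₁₂₃ ,
        subst (λ zs → E ℕ.* pairs zs bad ℕ.≤ length zs ℕ.* length zs) eq few-bad ,
        (λ t t∈ → common-value t (subst (λ zs → All (_∈ zs) (toList t)) (sym eq) t∈))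
        where
        eq : ys₃ ≡ filterᵇ (λ i → q₁ i ∧ (q₂ i ∧ q₃ i)) xs
        eq = trans (filterᵇ-filterᵇ q₂ q₃ ys₁) (filterᵇ-filterᵇ q₁ (λ i → q₂ i ∧ q₃ i) xs)

-- From integer counts to rational densities and overlaps.

open import Data.Fin.Subset using (Subset; _∈_; ∣_∣)
open import Data.Integer using (+_)
import Data.Integer as ℤ
import Data.Integer.Properties as ℤ
open import Data.Nat using (_≥_; _^_; _∸_)
open import Data.Rational using (ℚ; 0ℚ; 1ℚ; _<_; _≤_; _*_; _-_; _/_; _+_; -_; mkℚ; *<*; toℚᵘ; nonNegative)
import Data.Rational.Properties as ℚ
open import Data.Rational.Unnormalised as ℚᵘ using (mkℚᵘ)
import Data.Rational.Unnormalised.Properties as ℚᵘ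
open Counting
open Density using (pow2; Σc; ⟦_⟧; ⟦∧⟧; Σc-cong; countB-allBits)

fr : ℕ → ℕ → ℚ
fr a b = (+ a) / suc b

fr-toℚᵘ : ∀ a b → toℚᵘ (fr a b) ℚᵘ.≃ mkℚᵘ (+ a) b
fr-toℚᵘ a b = ℚ.toℚᵘ-fromℚᵘ (mkℚᵘ (+ a) b)

fr-≤ : ∀ {a b c d} → a ℕ.* suc d ℕ.≤ c ℕ.* suc b → fr a b ≤ fr c d
fr-≤ {a} {b} {c} {d} h = ℚ.toℚᵘ-cancel-≤ (ℚᵘ.≤-respˡ-≃ (ℚᵘ.≃-sym (fr-toℚᵘ a b)) (ℚᵘ.≤-respʳ-≃ (ℚᵘ.≃-sym (fr-toℚᵘ c d))
  (ℚᵘ.*≤* (subst₂ ℤ._≤_ (ℤ.pos-* a (suc d)) (ℤ.pos-* c (suc b)) (ℤ.+≤+ h)))))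

fr-≤⁻ : ∀ {a b c d} → fr a b ≤ fr c d → a ℕ.* suc d ℕ.≤ c ℕ.* suc b
fr-≤⁻ {a} {b} {c} {d} h with ℚᵘ.≤-respˡ-≃ (fr-toℚᵘ a b) (ℚᵘ.≤-respʳ-≃ (fr-toℚᵘ c d) (ℚ.toℚᵘ-mono-≤ h))
... | ℚᵘ.*≤* k = ℤ.drop‿+≤+ (subst₂ ℤ._≤_ (sym (ℤ.pos-* a (suc d))) (sym (ℤ.pos-* c (suc b))) k)

fr-* : ∀ a b c d → fr a b * fr c d ≡ fr (a ℕ.* c) (d ℕ.+ b ℕ.* suc d)
fr-* a b c d = ℚ.toℚᵘ-injective (ℚᵘ.≃-trans (ℚ.toℚᵘ-homo-* (fr a b) (fr c d))
  (ℚᵘ.≃-trans (ℚᵘ.*-cong (fr-toℚᵘ a b) (fr-toℚᵘ c d))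
  (ℚᵘ.≃-trans (ℚᵘ.≃-reflexive (cong (λ u → mkℚᵘ u (d ℕ.+ b ℕ.* suc d)) (sym (ℤ.pos-* a c)))) (ℚᵘ.≃-sym (fr-toℚᵘ (a ℕ.* c) (d ℕ.+ b ℕ.* suc d))))))

fr-+ : ∀ a b c d → fr a b + fr c d ≡ fr (a ℕ.* suc d ℕ.+ c ℕ.* suc b) (d ℕ.+ b ℕ.* suc d)
fr-+ a b c d = ℚ.toℚᵘ-injective (ℚᵘ.≃-trans (ℚ.toℚᵘ-homo-+ (fr a b) (fr c d))
  (ℚᵘ.≃-trans (ℚᵘ.+-cong (fr-toℚᵘ a b) (fr-toℚᵘ c d))
  (ℚᵘ.≃-trans (ℚᵘ.≃-reflexive (cong (λ u → mkℚᵘ u (d ℕ.+ b ℕ.* suc d)) (cong₂ ℤ._+_ (sym (ℤ.pos-* a (suc d))) (sym (ℤ.pos-* c (suc b))))))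
    (ℚᵘ.≃-sym (fr-toℚᵘ (a ℕ.* suc d ℕ.+ c ℕ.* suc b) (d ℕ.+ b ℕ.* suc d))))))

frac≡fr : ∀ a b → 1 ℕ.≤ b → frac a b ≡ fr a (ℕ.pred b)
frac≡fr a (suc b) _ = refl

-- The numerator is at least 1, so the denominator of `δ` itself serves.
reciprocal-below : ∀ δ → 0ℚ < δ → ∃ λ k → fr 1 k ≤ δ
reciprocal-below (mkℚ (+ zero) d c) (*<* (ℤ.+<+ ()))
reciprocal-below (mkℚ ℤ.-[1+ n ] d c) (*<* ())
reciprocal-below δ@(mkℚ (+ suc n) d c) h = d , subst (fr 1 d ≤_) (ℚ.fromℚᵘ-toℚᵘ δ) (fr-≤ {1} {d} {suc n} {d} (ℕ.*-monoˡ-≤ (suc d) (s≤s (z≤n {n}))))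

≤+⇒-≤ : ∀ {x y} z → x ≤ y + z → x - z ≤ y
≤+⇒-≤ {x} {y} z h = subst (x - z ≤_) (trans (ℚ.+-assoc y z (- z)) (trans (cong (λ u → y + u) (ℚ.+-inverseʳ z)) (ℚ.+-identityʳ y))) (ℚ.+-monoˡ-≤ (- z) h)

0≤fr : ∀ a b → 0ℚ ≤ fr a b
0≤fr a b = fr-≤ {0} {0} {a} {b} z≤n

0≤frac : ∀ a b → 0ℚ ≤ frac a b
0≤frac a zero = ℚ.≤-refl
0≤frac a (suc b) = 0≤fr a b

minOf-glb : ∀ {y} xs → 1 ℕ.≤ length xs → All (y ≤_) xs → y ≤ minOf xs
minOf-glb (x ∷ []) _ (h ∷ []) = h
minOf-glb (x ∷ z ∷ xs) _ (h ∷ hs) = ℚ.⊓-glb h (minOf-glb (z ∷ xs) (s≤s z≤n) hs)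

minOf-nonneg : ∀ xs → All (0ℚ ≤_) xs → 0ℚ ≤ minOf xs
minOf-nonneg [] [] = ℚ.≤-refl
minOf-nonneg xs@(_ ∷ _) h = minOf-glb xs (s≤s z≤n) h

sumQ-nonneg : ∀ {X : Set} (f : X → ℚ) xs → (∀ x → 0ℚ ≤ f x) → 0ℚ ≤ sumQ (map f xs)
sumQ-nonneg f [] h = ℚ.≤-refl
sumQ-nonneg f (x ∷ xs) h = ℚ.+-mono-≤ (h x) (sumQ-nonneg f xs h)

term≤sumQ : ∀ {X : Set} (f : X → ℚ) xs → (∀ x → 0ℚ ≤ f x) → ∀ {x} → x List.∈ xs → f x ≤ sumQ (map f xs)
term≤sumQ f (x ∷ xs) h (here refl) = subst (_≤ sumQ (map f (x ∷ xs))) (ℚ.+-identityʳ (f x)) (ℚ.+-monoʳ-≤ (f x) (sumQ-nonneg f xs h))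
term≤sumQ f (y ∷ xs) h {x} (there x∈) = subst (_≤ sumQ (map f (y ∷ xs))) (ℚ.+-identityˡ (f x)) (ℚ.+-mono-≤ (h y) (term≤sumQ f xs h x∈))

-- One value `d` is enough: the terms of the overlap at the other values are non-negative.
omega-lower : ∀ {p n} (As : List (CubeSet n)) (φ : Form p n) d y → 1 ℕ.≤ length As → All (λ A → y ≤ prob A φ d) As → y ≤ omega As φ
omega-lower {p} As φ d y len h = ℚ.≤-trans (minOf-glb (map (λ A → prob A φ d) As) (subst (1 ℕ.≤_) (sym (length-map (λ A → prob A φ d) As)) len) (All.map⁺ h))
  (term≤sumQ (λ d → minOf (map (λ A → prob A φ d) As)) (allFin p)
    (λ d → minOf-nonneg (map (λ A → prob A φ d) As) (All.map⁺ (All.universal (λ A → 0≤frac _ (card A)) As))) (∈-allFin d))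

∣tabulate∣ : ∀ {Y : Set} s (h : Fin s → Y) (f : Y → Bool) → ∣ tabulate (f ∘ h) ∣ ≡ countB f (List.tabulate h)
∣tabulate∣ zero h f = refl
∣tabulate∣ (suc s) h f with f (h Fin.zero)
... | true = cong suc (∣tabulate∣ s (h ∘ Fin.suc) f)
... | false = ∣tabulate∣ s (h ∘ Fin.suc) f

formSum≡nsum : ∀ q (pr : Prime (suc q)) {n} (φ : Form (suc q) n) x → formSum φ x ≡ Residues.nsum q pr (Residues.toN q pr φ) x
formSum≡nsum q pr [] [] = refl
formSum≡nsum q pr (a ∷ φ) (false ∷ x) = formSum≡nsum q pr φ x
formSum≡nsum q pr (a ∷ φ) (true ∷ x) = cong (toℕ a ℕ.+_) (formSum≡nsum q pr φ x)

card≡size : ∀ q (pr : Prime (suc q)) {n} (A : CubeSet n) → + card A ≡ Residues.size q pr A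
card≡size q pr A = countB-allBits A

count≡hits : ∀ q (pr : Prime (suc q)) {n} (A : CubeSet n) (φ : Form (suc q) n) d (d<p : d ℕ.< suc q) →
  + countB (λ x → A x ∧ (evalForm φ x ℕ.≡ᵇ toℕ (fromℕ< d<p))) (allBits n) ≡ Residues.hits q pr A (Residues.toN q pr φ) d
count≡hits q pr A φ d d<p = trans (countB-allBits (λ x → A x ∧ (evalForm φ x ℕ.≡ᵇ toℕ (fromℕ< d<p))))
  (Σc-cong (λ x → trans (⟦∧⟧ (A x) _) (cong (λ b → ⟦ A x ⟧ ℤ.* ⟦ b ⟧)
    (cong₂ ℕ._≡ᵇ_ (cong (_% suc q) (formSum≡nsum q pr φ x)) (trans (Fin.toℕ-fromℕ< d<p) (sym (m<n⇒m%n≡m d<p)))))))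

mainTheorem2 : (p m : ℕ) → Prime p → m ≥ 2 → (δ ν ε : ℚ) → 0ℚ < δ → 0ℚ < ν → 0ℚ < ε →
    Σ ℚ λ c → 0ℚ < c ×
    ((n s : ℕ) → s ≥ 1 → (A : Fin s → CubeSet n) →
    ((i : Fin s) → card (A i) ≥ 1) →
    ((i : Fin s) → δ ≤ density (A i)) →
    Σ (Subset s) λ Q →
    (c * ((+ s) / 1) ≤ (+ ∣ Q ∣) / 1) ×
    Σ (List (Vec (Fin s) m)) λ L →
    Unique L ×
    All (λ t → All (λ i → i ∈ Q) (toList t) ×
    ((φ : Form p n) →
    frac 1 (2 ^ ((m ℕ.+ 1) ℕ.* (p ∸ 1))) - ν ≤ omega (map A (toList t)) φ)) L ×
    ((1ℚ - ε) * ((+ (∣ Q ∣ ^ m)) / 1) ≤ (+ length L) / 1))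
mainTheorem2 zero m pr = ⊥-elim (¬prime[0] pr)
mainTheorem2 (suc q) m pr m≥2 δ ν ε 0<δ 0<ν 0<ε = fr 1 (ℕ.pred M) , 0<c , main
  where
  module R = Residues q pr
  a₀ = proj₁ (reciprocal-below δ 0<δ)
  b₀ = proj₁ (reciprocal-below ν 0<ν)
  e₀ = proj₁ (reciprocal-below ε 0<ε)
  a b E : ℕ
  a = suc a₀
  b = suc b₀
  -- The factor `m * m` cancels the number of pairs of positions in `bad-bound` and leaves bad
  -- tuples in proportion at most 1/(e₀ + 1) ≤ ε.
  E = suc e₀ ℕ.* (m ℕ.* m)
  1≤m : 1 ℕ.≤ m
  1≤m = ℕ.≤-trans (s≤s z≤n) m≥2
  -- For G = a b the error 2^n / G is at most |A|/b by density, and 1/b ≤ ν.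
  module Reg = R.Regularise a (s≤s z≤n) (a ℕ.* b) (s≤s z≤n) E (ℕ.*-mono-≤ {1} {suc e₀} (s≤s z≤n) (ℕ.*-mono-≤ 1≤m 1≤m))
  M = Reg.M
  sucM : suc (ℕ.pred M) ≡ M
  sucM = ℕ.suc-pred M {{ℕ.>-nonZero Reg.1≤M}}
  0<c : 0ℚ < fr 1 (ℕ.pred M)
  0<c = ℚ.≰⇒> (λ h → ℕ.<⇒≱ (s≤s z≤n) (fr-≤⁻ {1} {ℕ.pred M} {0} {0} h))
  module _ (n s : ℕ) (s≥1 : s ≥ 1) (A : Fin s → CubeSet n) (ne : ∀ i → card (A i) ≥ 1) (dense : ∀ i → δ ≤ density (A i)) where

    dense-ℕ : ∀ i → 2 ^ n ℕ.≤ a ℕ.* card (A i)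
    dense-ℕ i = subst₂ ℕ._≤_ (trans (ℕ.*-identityˡ _) (ℕ.suc-pred (2 ^ n) {{ℕ.>-nonZero (ℕ.m^n>0 2 n)}})) (ℕ.*-comm (card (A i)) a)
      (fr-≤⁻ {1} {a₀} {card (A i)} {ℕ.pred (2 ^ n)} (ℚ.≤-trans (proj₂ (reciprocal-below δ 0<δ))
        (subst (δ ≤_) (frac≡fr (card (A i)) (2 ^ n) (ℕ.m^n>0 2 n)) (dense i))))

    abstract
      reg : ∃ λ sel → ∃ λ (bad : Fin s → Fin s → Bool) → length (allFin s) ℕ.≤ M ℕ.* length (filterᵇ sel (allFin s)) ×
        E ℕ.* pairs (filterᵇ sel (allFin s)) bad ℕ.≤ length (filterᵇ sel (allFin s)) ℕ.* length (filterᵇ sel (allFin s)) ×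
        (∀ {m} (t : Vec (Fin s) m) → All (List._∈ filterᵇ sel (allFin s)) (toList t) → badTuple bad t ≡ false → ∀ φ →
          ∃ λ d → d ℕ.< suc q × All (λ i → + (a ℕ.* b) ℤ.* Residues.size q pr (A i) ℤ.≤ + (a ℕ.* b) ℤ.* + R.t ℤ.* Residues.hits q pr (A i) (Residues.toN q pr φ) d ℤ.+ pow2 n) (toList t))
      reg = Reg.regularise A (allFin s)
        (λ i → subst (ℤ.0ℤ ℤ.<_) (card≡size q pr (A i)) (ℤ.+<+ (ne i)))
        (λ i → subst (λ u → pow2 n ℤ.≤ + a ℤ.* u) (card≡size q pr (A i)) (subst (pow2 n ℤ.≤_) (ℤ.pos-* a (card (A i))) (ℤ.+≤+ (dense-ℕ i))))

    sel : Fin s → Bool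
    sel = proj₁ reg
    bad : Fin s → Fin s → Bool
    bad = proj₁ (proj₂ reg)
    ys : List (Fin s)
    ys = filterᵇ sel (allFin s)
    N : ℕ
    N = length ys
    Q : Subset s
    Q = tabulate sel
    L : List (Vec (Fin s) m)
    L = filterᵇ (not ∘ badTuple bad) (tuples ys m)

    ∣Q∣ : ∣ Q ∣ ≡ N
    ∣Q∣ = trans (∣tabulate∣ s id sel) (sym (length-filterᵇ sel (allFin s)))

    s≤MN : s ℕ.≤ M ℕ.* N
    s≤MN = subst (ℕ._≤ M ℕ.* N) (length-tabulate id) (proj₁ (proj₂ (proj₂ reg)))

    large : fr 1 (ℕ.pred M) * fr s 0 ≤ fr ∣ Q ∣ 0
    large = subst₂ (λ u k → u ≤ fr k 0) (sym (fr-* 1 (ℕ.pred M) s 0)) (sym ∣Q∣)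
      (fr-≤ {1 ℕ.* s} {0 ℕ.+ ℕ.pred M ℕ.* 1} {N} {0} (ℕ.≤-trans (ℕ.≤-reflexive (l₁ s)) (ℕ.≤-trans s≤MN
        (ℕ.≤-reflexive (trans (cong (ℕ._* N) (sym sucM)) (l₂ (ℕ.pred M) N))))))
      where
      l₁ : ∀ s → 1 ℕ.* s ℕ.* 1 ≡ s
      l₁ = solveℕ
      l₂ : ∀ M N → (1 ℕ.+ M) ℕ.* N ≡ N ℕ.* (1 ℕ.+ (0 ℕ.+ M ℕ.* 1))
      l₂ = solveℕ

    ys-unique : Unique ys
    ys-unique = Unique.filter⁺ (T? ∘ sel) (Unique.allFin⁺ s)

    L-unique : Unique L
    L-unique = Unique.filter⁺ (T? ∘ (not ∘ badTuple bad)) (tuples-unique ys-unique m)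

    bad-count : suc e₀ ℕ.* countB (badTuple bad) (tuples ys m) ℕ.≤ N ^ m
    bad-count = ℕ.*-cancelˡ-≤ (m ℕ.* m) {{ℕ.>-nonZero (ℕ.*-mono-≤ 1≤m 1≤m)}}
      (ℕ.≤-trans (ℕ.≤-reflexive (l (m ℕ.* m) (suc e₀) (countB (badTuple bad) (tuples ys m))))
        (BadTuples.bad-bound ys bad E (proj₁ (proj₂ (proj₂ (proj₂ reg)))) m))
      where
      l : ∀ k e c → k ℕ.* (e ℕ.* c) ≡ e ℕ.* k ℕ.* c
      l = solveℕ

    length-L : length L ℕ.+ countB (badTuple bad) (tuples ys m) ≡ N ^ m
    length-L = trans (cong (ℕ._+ countB (badTuple bad) (tuples ys m)) (length-filterᵇ (not ∘ badTuple bad) (tuples ys m)))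
      (trans (countB-complement (badTuple bad) (tuples ys m)) (length-tuples ys m))

    many : (1ℚ - ε) * fr (∣ Q ∣ ^ m) 0 ≤ fr (length L) 0
    many = subst (λ k → (1ℚ - ε) * fr (k ^ m) 0 ≤ fr (length L) 0) (sym ∣Q∣)
      (subst (_≤ fr (length L) 0) (sym distrib) (≤+⇒-≤ (ε * X) (ℚ.≤-trans step (ℚ.+-monoʳ-≤ (fr (length L) 0) ηX≤εX))))
      where
      x = N ^ m
      X = fr x 0
      η = fr 1 e₀
      distrib : (1ℚ - ε) * X ≡ X - ε * X
      distrib = trans (ℚ.*-distribʳ-+ X 1ℚ (- ε)) (cong₂ _+_ (ℚ.*-identityˡ X) (sym (ℚ.neg-distribˡ-* ε X)))
      ηX≤εX : η * X ≤ ε * X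
      ηX≤εX = ℚ.*-monoʳ-≤-nonNeg X {{nonNegative (0≤fr x 0)}} (proj₂ (reciprocal-below ε 0<ε))
      B = countB (badTuple bad) (tuples ys m)
      step : X ≤ fr (length L) 0 + η * X
      step = subst (X ≤_) (sym (trans (cong (λ u → fr (length L) 0 + u) (fr-* 1 e₀ x 0)) (fr-+ (length L) 0 (1 ℕ.* x) (0 ℕ.+ e₀ ℕ.* 1))))
        (fr-≤ {x} {0} {length L ℕ.* suc (0 ℕ.+ e₀ ℕ.* 1) ℕ.+ 1 ℕ.* x ℕ.* 1} {(0 ℕ.+ e₀ ℕ.* 1) ℕ.+ 0 ℕ.* suc (0 ℕ.+ e₀ ℕ.* 1)} (subst₂ ℕ._≤_ lhs rhs (ℕ.+-monoʳ-≤ (length L ℕ.* suc e₀) bad-count)))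
        where
        l₂ : ∀ ℓ B e → ℓ ℕ.* (1 ℕ.+ e) ℕ.+ (1 ℕ.+ e) ℕ.* B ≡ (ℓ ℕ.+ B) ℕ.* (1 ℕ.+ ((0 ℕ.+ e ℕ.* 1) ℕ.+ 0))
        l₂ = solveℕ
        l₃ : ∀ ℓ x e → ℓ ℕ.* (1 ℕ.+ e) ℕ.+ x ≡ (ℓ ℕ.* (1 ℕ.+ (0 ℕ.+ e ℕ.* 1)) ℕ.+ 1 ℕ.* x ℕ.* 1) ℕ.* 1
        l₃ = solveℕ
        lhs : length L ℕ.* suc e₀ ℕ.+ suc e₀ ℕ.* B ≡ x ℕ.* suc ((0 ℕ.+ e₀ ℕ.* 1) ℕ.+ 0 ℕ.* suc (0 ℕ.+ e₀ ℕ.* 1))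
        lhs = trans (l₂ (length L) B e₀) (cong (ℕ._* suc ((0 ℕ.+ e₀ ℕ.* 1) ℕ.+ 0)) length-L)
        rhs : length L ℕ.* suc e₀ ℕ.+ x ≡ (length L ℕ.* suc (0 ℕ.+ e₀ ℕ.* 1) ℕ.+ 1 ℕ.* x ℕ.* 1) ℕ.* 1
        rhs = l₃ (length L) x e₀

    threshold : ℕ
    threshold = 2 ^ ((m ℕ.+ 1) ℕ.* q)

    -- `t` is 2^(3q), and `m ≥ 2` gives 3 ≤ m + 1.
    t≤threshold : R.t ℕ.≤ threshold
    t≤threshold = ℕ.≤-trans (ℕ.≤-reflexive (trans (cong (ℕ._* (2 ^ q)) (sym (ℕ.^-distribˡ-+-* 2 q q))) (sym (ℕ.^-distribˡ-+-* 2 (q ℕ.+ q) q))))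
      (ℕ.^-monoʳ-≤ 2 (ℕ.≤-trans (ℕ.≤-reflexive (l q)) (ℕ.*-monoˡ-≤ q (ℕ.+-monoˡ-≤ 1 m≥2))))
      where
      l : ∀ q → q ℕ.+ q ℕ.+ q ≡ 3 ℕ.* q
      l = solveℕ

    overlap-bound : ∀ i (φ : Form (suc q) n) d (d<p : d ℕ.< suc q) →
      + (a ℕ.* b) ℤ.* Residues.size q pr (A i) ℤ.≤ + (a ℕ.* b) ℤ.* + R.t ℤ.* Residues.hits q pr (A i) (Residues.toN q pr φ) d ℤ.+ pow2 n →
      frac 1 threshold - ν ≤ prob (A i) φ (fromℕ< d<p)
    overlap-bound i φ d d<p h = ≤+⇒-≤ ν (ℚ.≤-trans step (ℚ.+-monoʳ-≤ (prob (A i) φ (fromℕ< d<p)) (proj₂ (reciprocal-below ν 0<ν))))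
      where
      c = card (A i)
      k = countB (λ x → A i x ∧ (evalForm φ x ℕ.≡ᵇ toℕ (fromℕ< d<p))) (allBits n)
      h-ℕ : a ℕ.* b ℕ.* c ℕ.≤ a ℕ.* b ℕ.* R.t ℕ.* k ℕ.+ 2 ^ n
      h-ℕ = ℤ.drop‿+≤+ (subst₂ ℤ._≤_
        (trans (cong (+ (a ℕ.* b) ℤ.*_) (sym (card≡size q pr (A i)))) (sym (ℤ.pos-* (a ℕ.* b) c)))
        (cong (ℤ._+ pow2 n) (trans (cong₂ ℤ._*_ (sym (ℤ.pos-* (a ℕ.* b) R.t)) (sym (count≡hits q pr (A i) φ d d<p))) (sym (ℤ.pos-* (a ℕ.* b ℕ.* R.t) k))))
        h)
      bc : b ℕ.* c ℕ.≤ b ℕ.* R.t ℕ.* k ℕ.+ c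
      bc = ℕ.*-cancelˡ-≤ a (ℕ.≤-trans (ℕ.≤-reflexive (sym (ℕ.*-assoc a b c))) (ℕ.≤-trans h-ℕ
        (ℕ.≤-trans (ℕ.+-monoʳ-≤ (a ℕ.* b ℕ.* R.t ℕ.* k) (dense-ℕ i)) (ℕ.≤-reflexive (l a b R.t k c)))))
        where
        l : ∀ a b t k c → a ℕ.* b ℕ.* t ℕ.* k ℕ.+ a ℕ.* c ≡ a ℕ.* (b ℕ.* t ℕ.* k ℕ.+ c)
        l = solveℕ
      1≤T : 1 ℕ.≤ threshold
      1≤T = ℕ.m^n>0 2 ((m ℕ.+ 1) ℕ.* q)
      sucT : suc (ℕ.pred threshold) ≡ threshold
      sucT = ℕ.suc-pred threshold {{ℕ.>-nonZero 1≤T}}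
      sucC : suc (ℕ.pred c) ≡ c
      sucC = ℕ.suc-pred c {{ℕ.>-nonZero (ne i)}}
      numeric : ∀ T C → T ≡ threshold → C ≡ c → C ℕ.* b ℕ.≤ (k ℕ.* b ℕ.+ 1 ℕ.* C) ℕ.* T
      numeric T C refl refl = ℕ.≤-trans (ℕ.≤-reflexive (ℕ.*-comm c b)) (ℕ.≤-trans bc
        (ℕ.≤-trans (ℕ.+-mono-≤ (ℕ.≤-trans (ℕ.≤-reflexive (l₁ b R.t k)) (ℕ.*-monoʳ-≤ (k ℕ.* b) t≤threshold))
            (ℕ.≤-trans (ℕ.≤-reflexive (sym (ℕ.*-identityʳ c))) (ℕ.*-monoʳ-≤ c 1≤T)))
          (ℕ.≤-reflexive (l₂ k b c threshold))))
        where
        l₁ : ∀ b t k → b ℕ.* t ℕ.* k ≡ k ℕ.* b ℕ.* t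
        l₁ = solveℕ
        l₂ : ∀ k b c T → k ℕ.* b ℕ.* T ℕ.+ c ℕ.* T ≡ (k ℕ.* b ℕ.+ 1 ℕ.* c) ℕ.* T
        l₂ = solveℕ
      step : frac 1 threshold ≤ prob (A i) φ (fromℕ< d<p) + fr 1 b₀
      step = subst₂ _≤_ (sym (frac≡fr 1 threshold 1≤T))
        (sym (trans (cong (_+ fr 1 b₀) (frac≡fr k c (ne i))) (fr-+ k (ℕ.pred c) 1 b₀)))
        (fr-≤ {1} {ℕ.pred threshold} {k ℕ.* b ℕ.+ 1 ℕ.* suc (ℕ.pred c)} {b₀ ℕ.+ ℕ.pred c ℕ.* b} (ℕ.≤-trans (ℕ.≤-reflexive (ℕ.*-identityˡ _)) (numeric (suc (ℕ.pred threshold)) (suc (ℕ.pred c)) sucT sucC)))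

    good-tuples : All (λ t → All (λ i → i ∈ Q) (toList t) × ((φ : Form (suc q) n) → frac 1 threshold - ν ≤ omega (map A (toList t)) φ)) L
    good-tuples = All.tabulate λ {t} t∈ → go t (∈-filterᵇ⁻ (not ∘ badTuple bad) (tuples ys m) t∈)
      where
      not⁻ : ∀ {b} → not b ≡ true → b ≡ false
      not⁻ {false} _ = refl
      in-Q : ∀ {i} → i List.∈ ys → i ∈ Q
      in-Q {i} i∈ = lookup⇒[]= i Q (trans (lookup∘tabulate sel i) (proj₂ (∈-filterᵇ⁻ sel (allFin s) i∈)))
      go : ∀ t → t List.∈ tuples ys m × not (badTuple bad t) ≡ true →
        All (λ i → i ∈ Q) (toList t) × ((φ : Form (suc q) n) → frac 1 threshold - ν ≤ omega (map A (toList t)) φ)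
      go t (t∈ , ok) = All.map in-Q (tuples-∈ ys m t∈) , λ φ → overlaps φ (proj₂ (proj₂ (proj₂ (proj₂ reg))) t (tuples-∈ ys m t∈) (not⁻ ok) φ)
        where
        overlaps : ∀ φ → (∃ λ d → d ℕ.< suc q × All (λ i → + (a ℕ.* b) ℤ.* Residues.size q pr (A i) ℤ.≤ + (a ℕ.* b) ℤ.* + R.t ℤ.* Residues.hits q pr (A i) (Residues.toN q pr φ) d ℤ.+ pow2 n) (toList t)) →
          frac 1 threshold - ν ≤ omega (map A (toList t)) φ
        overlaps φ (d , d<p , h) = omega-lower (map A (toList t)) φ (fromℕ< d<p) (frac 1 threshold - ν)
          (subst (1 ℕ.≤_) (sym (trans (length-map A (toList t)) (length-toList t))) 1≤m)
          (All.map⁺ (All.map (λ {i} → overlap-bound i φ d d<p) h))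

    main : Σ (Subset s) λ Q →
      (fr 1 (ℕ.pred M) * ((+ s) / 1) ≤ (+ ∣ Q ∣) / 1) ×
      Σ (List (Vec (Fin s) m)) λ L →
      Unique L ×
      All (λ t → All (λ i → i ∈ Q) (toList t) × ((φ : Form (suc q) n) → frac 1 threshold - ν ≤ omega (map A (toList t)) φ)) L ×
      ((1ℚ - ε) * ((+ (∣ Q ∣ ^ m)) / 1) ≤ (+ length L) / 1)
    main = Q , large , L , L-unique , good-tuples , many
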